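{- Let $\mathcal C$ be the class of unlabeled connected outerplanar graphs and $\hat{\mathcal C}$ the class of unlabeled vertex-rooted connected outerplanar graphs. Then $$Z(\mathcal C)=Z(\hat{\mathcal C})+Z\big(\mathcal D;Z(\hat{\mathcal C})\big)-Z\big(\mathcal V;Z(\hat{\mathcal C})\big),$$ where for a cycle index sum $Z(\mathcal K)$ the expression $Z(\mathcal K;Z(\hat{\mathcal C}))$ denotes the series obtained from $Z(\mathcal K)$ by replacing each $s_i$ by $Z(\hat{\mathcal C};s_i,s_{2i},s_{3i},\dots)$.
   Context: Cycle index: for a permutation group $A$ on $\{1,\dots,n\}$, $Z(A)=\frac1{|A|}\sum_{\alpha\in A}\prod_k s_k^{j_k(\alpha)}$, $j_k(\alpha)$ the number of $k$-cycles of $\alpha$. For a graph, $Z(G)$ is the cycle index of its automorphism group acting on vertices; for a rooted graph the automorphisms are required to fix the root. For a class $\mathcal K$ of unlabeled (possibly rooted) graphs, $Z(\mathcal K)=\sum_{K\in\mathcal K}Z(K)$, one representative per isomorphism class; $Z(\mathcal K;t_1,t_2,\dots)$ denotes $Z(\mathcal K)$ with $s_i$ replaced by $t_i$. An outerplanar graph embeds in the plane with all vertices on the outer face. A dissection is a two-connected outerplanar graph with at least three vertices; $\mathcal D$ is the class of unlabeled dissections together with the single edge $K_2$, and $\mathcal V$ is the class of unlabeled vertex-rooted dissections together with the vertex-rooted single edge. Explicitly $Z(\mathcal V;s_1,s_2)=\frac{s_1}{8}\big(1+s_1-\sqrt{s_1^2-6s_1+1}\big)+\frac{s_1}{8s_2^2}(s_1+s_2)\big(1-3s_2-\sqrt{s_2^2-6s_2+1}\big)$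 and $Z(\mathcal V)=s_1\frac{\partial}{\partial s_1}Z(\mathcal D)$. -}

module Defs where

open import Data.Bool using (Bool; true; false; _∧_; _∨_; not; if_then_else_)
open import Data.Nat using (ℕ; zero; suc; _+_; _*_; _≡ᵇ_; _<ᵇ_; _≤ᵇ_)
open import Data.Nat.DivMod using (_/_)
open import Data.Fin using (Fin; zero; suc; toℕ)
open import Data.Maybe using (Maybe; just; nothing)
open import Data.List using (List; []; _∷_; map; concatMap; foldr; allFin; upTo; length; filterᵇ; replicate)
open import Data.Product using (_×_; _,_)
open import Data.Integer using (+_)
open import Data.Rational using (ℚ; 0ℚ; 1ℚ) renaming (_/_ to _/ℚ_; _+_ to _+ℚ_; _*_ to _*ℚ_)

eqB : Bool → Bool → Bool
eqB true  b = b
eqB false b = not b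

_==ᶠ_ : ∀ {n} → Fin n → Fin n → Bool
i ==ᶠ j = toℕ i ≡ᵇ toℕ j

anyL : ∀ {A : Set} → List A → (A → Bool) → Bool
anyL xs p = foldr (λ x b → p x ∨ b) false xs

allL : ∀ {A : Set} → List A → (A → Bool) → Bool
allL xs p = foldr (λ x b → p x ∧ b) true xs

allB : (n : ℕ) → (Fin n → Bool) → Bool
allB n = allL (allFin n)

anyB : (n : ℕ) → (Fin n → Bool) → Bool
anyB n = anyL (allFin n)

countL : ∀ {A : Set} → List A → (A → Bool) → ℕ
countL xs p = length (filterᵇ p xs)

funs : ∀ {A : Set} → List A → (n : ℕ) → List (Fin n → A)
funs xs zero    = (λ ()) ∷ []
funs xs (suc n) = concatMap (λ a → map (λ f → cons a f) (funs xs n)) xs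
  where
  cons : _ → (Fin n → _) → Fin (suc n) → _
  cons a f zero    = a
  cons a f (suc i) = f i

bools : List Bool
bools = true ∷ false ∷ []

injectiveB : ∀ {n} → (Fin n → Fin n) → Bool
injectiveB {n} f = allB n λ i → allB n λ j → not (f i ==ᶠ f j) ∨ (i ==ᶠ j)

perms : (n : ℕ) → List (Fin n → Fin n)
perms n = filterᵇ injectiveB (funs (allFin n) n)

iter : ∀ {n} → (Fin n → Fin n) → ℕ → Fin n → Fin n
iter π zero    i = i
iter π (suc k) i = π (iter π k i)

cycLen : ∀ {n} → (Fin n → Fin n) → Fin n → ℕ
cycLen {n} π i = go n 1
  where
  go : ℕ → ℕ → ℕ
  go zero    k = k
  go (suc f) k = if iter π k i ==ᶠ i then k else go f (suc k)

divN : ℕ → ℕ → ℕ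
divN a zero    = 0
divN a (suc k) = a / suc k

-- Monomials in s₁, s₂, … : a list [j₁, j₂, …] of exponents
-- (the list stands for s₁^j₁ s₂^j₂ ⋯; trailing zeros are irrelevant).
Mono : Set
Mono = List ℕ

cycType : ∀ {n} → (Fin n → Fin n) → Mono
cycType {n} π = map (λ k → divN (countL (allFin n) (λ i → cycLen π i ≡ᵇ k)) k)
                    (map suc (upTo n))

monoEq : Mono → Mono → Bool
monoEq []       ys       = allL ys (λ y → y ≡ᵇ 0)
monoEq (x ∷ xs) []       = allL (x ∷ xs) (λ y → y ≡ᵇ 0)
monoEq (x ∷ xs) (y ∷ ys) = (x ≡ᵇ y) ∧ monoEq xs ys

addMono : Mono → Mono → Mono
addMono []       ys       = ys
addMono (x ∷ xs) []       = x ∷ xs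
addMono (x ∷ xs) (y ∷ ys) = (x + y) ∷ addMono xs ys

deg : Mono → ℕ
deg = go 1
  where
  go : ℕ → Mono → ℕ
  go k []       = 0
  go k (e ∷ es) = k * e + go (suc k) es

-- Polynomials in s₁, s₂, … with rational coefficients, as (unsimplified)
-- lists of terms  c · monomial.

Poly : Set
Poly = List (ℚ × Mono)

coeff : Mono → Poly → ℚ
coeff m p = foldr (λ { (c , m') acc → if monoEq m m' then c +ℚ acc else acc }) 0ℚ p

oneP : Poly
oneP = (1ℚ , []) ∷ []

mulP : Poly → Poly → Poly
mulP p q = concatMap (λ { (c , m) → map (λ { (d , m') → (c *ℚ d , addMono m m') }) q }) p

powP : Poly → ℕ → Poly
powP p zero    = oneP
powP p (suc e) = mulP p (powP p e)

scaleP : ℚ → Poly → Poly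
scaleP c = map (λ { (d , m) → (c *ℚ d , m) })

-- the substitution sᵢ ↦ s_{k·i} (k ≥ 1) on monomials
stretch : ℕ → Mono → Mono
stretch zero    m        = m   -- not used (k ≥ 1 always)
stretch (suc k) []       = []
stretch (suc k) (e ∷ es) = replicate k 0 ++' (e ∷ stretch (suc k) es)
  where
  _++'_ : Mono → Mono → Mono
  [] ++' ys       = ys
  (x ∷ xs) ++' ys = x ∷ (xs ++' ys)

stretchP : ℕ → Poly → Poly
stretchP k = map (λ { (c , m) → (c , stretch k m) })

substMono : Poly → Mono → Poly
substMono q = go 1
  where
  go : ℕ → Mono → Poly
  go i []       = oneP
  go i (e ∷ es) = mulP (powP (stretchP i q) e) (go (suc i) es)

compose : Poly → Poly → Poly
compose F q = concatMap (λ { (c , m) → scaleP c (substMono q m) }) F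

-- Labeled (possibly rooted) graphs on the vertex set Fin n.
-- A graph is an adjacency function; it is a simple graph when this is
-- symmetric and irreflexive.  The root is `nothing` for unrooted graphs
-- and `just r` for graphs rooted at vertex r.

Graph : ℕ → Set
Graph n = Fin n → Fin n → Bool

RGraph : ℕ → Set
RGraph n = Graph n × Maybe (Fin n)

simpleB : ∀ {n} → Graph n → Bool
simpleB {n} G = (allB n λ i → allB n λ j → eqB (G i j) (G j i))
              ∧ (allB n λ i → not (G i i))

mapRoot : ∀ {n} → (Fin n → Fin n) → Maybe (Fin n) → Maybe (Fin n)
mapRoot π nothing  = nothing
mapRoot π (just r) = just (π r)

eqRoot : ∀ {n} → Maybe (Fin n) → Maybe (Fin n) → Bool
eqRoot nothing  nothing  = true
eqRoot (just r) (just s) = r ==ᶠ s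
eqRoot _        _        = false

isoViaB : ∀ {n} → (Fin n → Fin n) → RGraph n → RGraph n → Bool
isoViaB {n} π (G , r) (H , s) =
  (allB n λ i → allB n λ j → eqB (H (π i) (π j)) (G i j)) ∧ eqRoot (mapRoot π r) s

isoB : ∀ {n} → RGraph n → RGraph n → Bool
isoB {n} X Y = anyL (perms n) (λ π → isoViaB π X Y)

auts : ∀ {n} → RGraph n → List (Fin n → Fin n)
auts {n} X = filterᵇ (λ π → isoViaB π X X) (perms n)

objs : (n : ℕ) → List (RGraph n)
objs n = concatMap (λ G → map (λ r → (G , r)) (nothing ∷ map just (allFin n)))
                   (filterᵇ simpleB (funs (funs bools n) n))

reachIn : ∀ {n} → (Fin n → Bool) → Graph n → Fin n → ℕ → Fin n → Bool
reachIn S G u zero    v = S u ∧ (u ==ᶠ v)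
reachIn {n} S G u (suc k) v =
  reachIn S G u k v ∨ (anyB n λ w → reachIn S G u k w ∧ S v ∧ G w v)

-- the subgraph induced on S is connected (any two vertices of S are joined
-- by a path inside S; a path has at most n-1 edges)
connectedOn : ∀ {n} → (Fin n → Bool) → Graph n → Bool
connectedOn {n} S G = allB n λ u → allB n λ v → not (S u ∧ S v) ∨ reachIn S G u n v

connectedB : ∀ {n} → Graph n → Bool
connectedB {n} G = (1 ≤ᵇ n) ∧ connectedOn (λ _ → true) G

twoConnectedB : ∀ {n} → Graph n → Bool
twoConnectedB {n} G = (3 ≤ᵇ n) ∧ connectedB G
                    ∧ (allB n λ v → connectedOn (λ u → not (u ==ᶠ v)) G)

-- with vertices placed on a circle in the cyclic order given by the positions
-- p, no two edges (chords) cross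
noCrossB : ∀ {n} → (Fin n → Fin n) → Graph n → Bool
noCrossB {n} p G = allB n λ a → allB n λ b → allB n λ c → allB n λ d →
  not (G a b ∧ G c d ∧ (toℕ (p a) <ᵇ toℕ (p c)) ∧ (toℕ (p c) <ᵇ toℕ (p b))
       ∧ (toℕ (p b) <ᵇ toℕ (p d)))

-- outerplanar: embeddable in the plane with all vertices on the outer face,
-- i.e. drawable with the vertices on a circle and non-crossing chords as edges
outerplanarB : ∀ {n} → Graph n → Bool
outerplanarB {n} G = anyL (perms n) (λ p → noCrossB p G)

dissectionB : ∀ {n} → Graph n → Bool
dissectionB G = outerplanarB G ∧ twoConnectedB G

-- the single edge K₂ (G is simple)
singleEdgeB : ∀ {n} → Graph n → Bool
singleEdgeB {n} G = (n ≡ᵇ 2) ∧ connectedB G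

-- Classes of (labeled representatives of) graphs, closed under isomorphism

Class : Set
Class = (n : ℕ) → RGraph n → Bool

𝒞 : Class
𝒞 n (G , nothing) = connectedB G ∧ outerplanarB G
𝒞 n (G , just _)  = false

𝒞̂ : Class
𝒞̂ n (G , nothing) = false
𝒞̂ n (G , just _)  = connectedB G ∧ outerplanarB G

𝒟 : Class
𝒟 n (G , nothing) = dissectionB G ∨ singleEdgeB G
𝒟 n (G , just _)  = false

𝒱 : Class
𝒱 n (G , nothing) = false
𝒱 n (G , just _)  = dissectionB G ∨ singleEdgeB G

frac : ℕ → ℕ → ℚ
frac a zero    = 0ℚ
frac a (suc d) = (+ a) /ℚ suc d

cycIndex : ∀ {n} → RGraph n → Poly
cycIndex X = map (λ α → (frac 1 (length (auts X)) , cycType α)) (auts X)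

classSize : ∀ {n} → RGraph n → ℕ
classSize {n} X = countL (objs n) (isoB X)

-- degree-n part of Z(𝒦): one term Z(K) per isomorphism class K of 𝒦 on n
-- vertices, realised as the sum over all labeled members X of the class
-- weighted by 1/(number of labeled copies of X)
classTerms : Class → (n : ℕ) → Poly
classTerms K n = concatMap
  (λ X → if K n X then scaleP (frac 1 (classSize X)) (cycIndex X) else [])
  (objs n)

ZPoly : Class → ℕ → Poly
ZPoly K N = concatMap (classTerms K) (upTo (suc N))

Z : Class → Mono → ℚ
Z K m = coeff m (ZPoly K (deg m))

-- coefficient of the monomial m in Z(𝒦; Z(ℒ)), i.e. Z(𝒦) with each sᵢ
-- replaced by Z(ℒ; sᵢ, s_{2i}, …).  Exact when ℒ has no graph on 0
-- vertices, since then only degree ≤ deg m parts contribute.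
Zsub : Class → Class → Mono → ℚ
Zsub K L m = coeff m (compose (ZPoly K (deg m)) (ZPoly L (deg m)))

{-# OPTIONS --safe #-}
-- A labelled graph weighted by 1/n! is counted together with an automorphism α, so Z(𝒦) becomes a sum over pairs (G , α).
-- For a connected graph G and an automorphism α, the vertices and blocks fixed by α exceed the fixed flags
-- (vertex on block) by one: rooting G shows this for the identity, and every flag moved by α is, for exactly one
-- moved vertex or block, the first step towards its image.  Since Z(𝒱) = s₁ ∂Z(𝒟)/∂s₁, the theorem then says that
-- Z(𝒟; Z(𝒞̂)) counts triples (G , α , α-invariant block B).  The gate map of B splits G into the graph on B and the
-- rooted connected outerplanar graphs hanging at its vertices; α permutes the latter along the cycles of its
-- restriction σ to B, and a cycle of length ℓ contributes one factor Z(𝒞̂; s_ℓ , s_2ℓ , …).  This last statement is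
-- proved by removing the cycles of σ one at a time.
module Submission where

open import Defs
open import Data.Bool using (Bool; true; false; _∧_; _∨_; not; if_then_else_)
open import Data.Bool.Properties using () renaming (_≟_ to _≟B_)
open import Data.Fin using (Fin; zero; suc; toℕ; punchOut; fromℕ<; _↑ˡ_; _↑ʳ_; combine; remQuot; splitAt; join)
open import Data.List using (List; []; _∷_; map; concatMap; length; filterᵇ; allFin; _++_; replicate; upTo)
open import Data.Vec using (Vec; []; _∷_; lookup; tabulate)
open import Data.Maybe using (Maybe; just; nothing)
open import Data.Product using (_×_; _,_; proj₁; proj₂; ∃)
open import Data.Empty using (⊥-elim)
open import Data.Rational using (ℚ; 0ℚ; 1ℚ) renaming (_+_ to _+ℚ_; _*_ to _*ℚ_; _-_ to _-ℚ_; -_ to -ℚ_)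
open import Relation.Nullary using (¬_; Dec; yes; no; does; contradiction; _×-dec_; _→-dec_; _⊎-dec_)
open import Relation.Nullary.Decidable using (map′; ¬?)
open import Relation.Binary using (DecidableEquality; tri<; tri≈; tri>)
open import Function using (_∘_; id; case_of_)
open import Data.Nat.Divisibility using (_∣_; divides; ∣m∣n⇒∣m+n; ∣-refl)
open import Data.Sum using (_⊎_; inj₁; inj₂)
open import Relation.Binary.Construct.Closure.ReflexiveTransitive using (Star; ε; _◅_; _◅◅_; gmap; reverse)
open import Data.Nat.DivMod using (_/_; _%_; m≡m%n+[m/n]*n; m%n<n; m*n/n≡m)
open import Data.Rational.Solver using (module +-*-Solver)
import Data.Fin.Properties as Finₚ
import Data.List.Properties as Listₚ
import Data.Vec.Properties as Vecₚ
import Data.Maybe.Properties as Maybeₚ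
import Data.Product.Properties as Productₚ
import Data.Integer as ℤ
import Data.Integer.Properties as ℤₚ
import Data.Rational as ℚ
import Data.Rational.Properties as ℚₚ
import Data.Rational.Unnormalised as ℚᵘ
import Data.Rational.Unnormalised.Properties as ℚᵘₚ
import Data.Bool.Properties as Boolₚ
import Data.Nat.Properties as ℕₚ
import Data.Nat as ℕ
open import Relation.Binary.PropositionalEquality
open import Data.Nat using (ℕ; zero; suc)

open ≡-Reasoning

module Sums where

  open import Data.Nat using (_<_; _+_; _*_)
  open import Data.Integer using (+_)

  private variable
    A B : Set
    P Q : Set

  χᵇ : Bool → ℚ
  χᵇ true  = 1ℚ
  χᵇ false = 0ℚ

  χ : Dec P → ℚ
  χ d = χᵇ (does d)

  χ-yes : (d : Dec P) → P → χ d ≡ 1ℚ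
  χ-yes (yes _) _ = refl
  χ-yes (no ¬p) p = contradiction p ¬p

  χ-no : (d : Dec P) → ¬ P → χ d ≡ 0ℚ
  χ-no (yes p) ¬p = contradiction p ¬p
  χ-no (no _)  _  = refl

  χ-⇔ : (d : Dec P) (e : Dec Q) → (P → Q) → (Q → P) → χ d ≡ χ e
  χ-⇔ (yes p) e f g = sym (χ-yes e (f p))
  χ-⇔ (no ¬p) e f g = sym (χ-no e (¬p ∘ g))

  χ-× : (d : Dec P) (e : Dec Q) → χ (d ×-dec e) ≡ χ d *ℚ χ e
  χ-× (yes p) e = sym (ℚₚ.*-identityˡ (χ e))
  χ-× (no ¬p) e = sym (ℚₚ.*-zeroˡ (χ e))

  χᵇ-dec : (b : Bool) (d : Dec P) → (b ≡ true → P) → (P → b ≡ true) → χᵇ b ≡ χ d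
  χᵇ-dec true  d f g = sym (χ-yes d (f refl))
  χᵇ-dec false d f g = sym (χ-no d (λ p → case g p of λ ()))

  χ-guard : (d : Dec P) {x y : ℚ} → (P → x ≡ y) → χ d *ℚ x ≡ χ d *ℚ y
  χ-guard (yes p) eq = cong (1ℚ *ℚ_) (eq p)
  χ-guard (no ¬p) {x} {y} eq = trans (ℚₚ.*-zeroˡ x) (sym (ℚₚ.*-zeroˡ y))

  χ-vanish : (d : Dec P) {x : ℚ} → (P → x ≡ 0ℚ) → χ d *ℚ x ≡ 0ℚ
  χ-vanish d {x} eq = trans (χ-guard d eq) (ℚₚ.*-zeroʳ (χ d))

  interchange+ : ∀ a b c d → (a +ℚ b) +ℚ (c +ℚ d) ≡ (a +ℚ c) +ℚ (b +ℚ d)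
  interchange+ a b c d = begin
    (a +ℚ b) +ℚ (c +ℚ d) ≡⟨ ℚₚ.+-assoc a b (c +ℚ d) ⟩
    a +ℚ (b +ℚ (c +ℚ d)) ≡⟨ cong (a +ℚ_) (sym (ℚₚ.+-assoc b c d)) ⟩
    a +ℚ ((b +ℚ c) +ℚ d) ≡⟨ cong (λ z → a +ℚ (z +ℚ d)) (ℚₚ.+-comm b c) ⟩
    a +ℚ ((c +ℚ b) +ℚ d) ≡⟨ cong (a +ℚ_) (ℚₚ.+-assoc c b d) ⟩
    a +ℚ (c +ℚ (b +ℚ d)) ≡⟨ sym (ℚₚ.+-assoc a c (b +ℚ d)) ⟩
    (a +ℚ c) +ℚ (b +ℚ d) ∎

  swap*ˡ : ∀ a b c → a *ℚ (b *ℚ c) ≡ b *ℚ (a *ℚ c)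
  swap*ˡ a b c = trans (sym (ℚₚ.*-assoc a b c)) (trans (cong (_*ℚ c) (ℚₚ.*-comm a b)) (ℚₚ.*-assoc b a c))

  ∑ : List A → (A → ℚ) → ℚ
  ∑ []       f = 0ℚ
  ∑ (x ∷ xs) f = f x +ℚ ∑ xs f

  ∑-cong : (xs : List A) {f g : A → ℚ} → (∀ x → f x ≡ g x) → ∑ xs f ≡ ∑ xs g
  ∑-cong []       eq = refl
  ∑-cong (x ∷ xs) eq = cong₂ _+ℚ_ (eq x) (∑-cong xs eq)

  ∑-0 : (xs : List A) → ∑ xs (λ _ → 0ℚ) ≡ 0ℚ
  ∑-0 []       = refl
  ∑-0 (x ∷ xs) = trans (ℚₚ.+-identityˡ _) (∑-0 xs)

  ∑-vanish : (xs : List A) {f : A → ℚ} → (∀ x → f x ≡ 0ℚ) → ∑ xs f ≡ 0ℚ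
  ∑-vanish xs eq = trans (∑-cong xs eq) (∑-0 xs)

  ∑-+ : (xs : List A) (f g : A → ℚ) → ∑ xs (λ x → f x +ℚ g x) ≡ ∑ xs f +ℚ ∑ xs g
  ∑-+ []       f g = refl
  ∑-+ (x ∷ xs) f g = trans (cong ((f x +ℚ g x) +ℚ_) (∑-+ xs f g)) (interchange+ (f x) (g x) _ _)

  ∑-*ˡ : (xs : List A) (c : ℚ) (f : A → ℚ) → ∑ xs (λ x → c *ℚ f x) ≡ c *ℚ ∑ xs f
  ∑-*ˡ []       c f = sym (ℚₚ.*-zeroʳ c)
  ∑-*ˡ (x ∷ xs) c f = trans (cong (c *ℚ f x +ℚ_) (∑-*ˡ xs c f)) (sym (ℚₚ.*-distribˡ-+ c (f x) (∑ xs f)))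

  ∑-*ʳ : (xs : List A) (c : ℚ) (f : A → ℚ) → ∑ xs (λ x → f x *ℚ c) ≡ ∑ xs f *ℚ c
  ∑-*ʳ xs c f = trans (∑-cong xs (λ x → ℚₚ.*-comm (f x) c)) (trans (∑-*ˡ xs c f) (ℚₚ.*-comm c _))

  ∑-swap : (xs : List A) (ys : List B) (f : A → B → ℚ) →
    ∑ xs (λ x → ∑ ys (f x)) ≡ ∑ ys (λ y → ∑ xs (λ x → f x y))
  ∑-swap []       ys f = sym (∑-0 ys)
  ∑-swap (x ∷ xs) ys f = trans (cong (∑ ys (f x) +ℚ_) (∑-swap xs ys f)) (sym (∑-+ ys (f x) _))

  ∑-++ : (xs ys : List A) (f : A → ℚ) → ∑ (xs ++ ys) f ≡ ∑ xs f +ℚ ∑ ys f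
  ∑-++ []       ys f = sym (ℚₚ.+-identityˡ _)
  ∑-++ (x ∷ xs) ys f = trans (cong (f x +ℚ_) (∑-++ xs ys f)) (sym (ℚₚ.+-assoc (f x) _ _))

  ∑-map : (h : A → B) (xs : List A) (f : B → ℚ) → ∑ (map h xs) f ≡ ∑ xs (f ∘ h)
  ∑-map h []       f = refl
  ∑-map h (x ∷ xs) f = cong (f (h x) +ℚ_) (∑-map h xs f)

  ∑-concatMap : (h : A → List B) (xs : List A) (f : B → ℚ) → ∑ (concatMap h xs) f ≡ ∑ xs (λ x → ∑ (h x) f)
  ∑-concatMap h []       f = refl
  ∑-concatMap h (x ∷ xs) f = trans (∑-++ (h x) (concatMap h xs) f) (cong (∑ (h x) f +ℚ_) (∑-concatMap h xs f))

  ∑-filter : (p : A → Bool) (xs : List A) (f : A → ℚ) → ∑ (filterᵇ p xs) f ≡ ∑ xs (λ x → χᵇ (p x) *ℚ f x)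
  ∑-filter p []       f = refl
  ∑-filter p (x ∷ xs) f with p x
  ... | true  = cong₂ _+ℚ_ (sym (ℚₚ.*-identityˡ (f x))) (∑-filter p xs f)
  ... | false = trans (∑-filter p xs f) (trans (sym (ℚₚ.+-identityˡ _)) (cong (_+ℚ ∑ xs _) (sym (ℚₚ.*-zeroˡ (f x)))))

  ι : ℕ → ℚ
  ι zero    = 0ℚ
  ι (suc n) = 1ℚ +ℚ ι n

  toℚᵘ-ι : ∀ n → ℚ.toℚᵘ (ι n) ℚᵘ.≃ ℚᵘ.mkℚᵘ (+ n) 0
  toℚᵘ-ι zero    = ℚᵘₚ.≃-refl
  toℚᵘ-ι (suc n) = ℚᵘₚ.≃-trans (ℚₚ.toℚᵘ-homo-+ 1ℚ (ι n))
    (ℚᵘₚ.≃-trans (ℚᵘₚ.+-congʳ (ℚ.toℚᵘ 1ℚ) (toℚᵘ-ι n)) (ℚᵘ.*≡* (ℤ-eq n)))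
    where
    ℤ-eq : ∀ n → ((+ 1) ℤ.* (+ 1) ℤ.+ (+ n) ℤ.* (+ 1)) ℤ.* (+ 1) ≡ (+ suc n) ℤ.* (+ 1)
    ℤ-eq n = cong (λ z → ((+ 1) ℤ.* (+ 1) ℤ.+ z) ℤ.* (+ 1)) (ℤₚ.*-identityʳ (+ n))

  frac-ι : ∀ d → 0 < d → frac 1 d *ℚ ι d ≡ 1ℚ
  frac-ι (suc d) _ = ℚₚ.toℚᵘ-injective
    (ℚᵘₚ.≃-trans (ℚₚ.toℚᵘ-homo-* (frac 1 (suc d)) (ι (suc d)))
    (ℚᵘₚ.≃-trans (ℚᵘₚ.*-cong (ℚₚ.toℚᵘ-fromℚᵘ (ℚᵘ.mkℚᵘ (+ 1) d)) (toℚᵘ-ι (suc d)))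
    (ℚᵘ.*≡* (ℤ-eq d))))
    where
    ℤ-eq : ∀ d → ((+ 1) ℤ.* (+ suc d)) ℤ.* (+ 1) ≡ (+ 1) ℤ.* ((+ suc d) ℤ.* (+ 1))
    ℤ-eq d = ℤₚ.*-assoc (+ 1) (+ suc d) (+ 1)

  ι-length : (xs : List A) → ι (length xs) ≡ ∑ xs (λ _ → 1ℚ)
  ι-length []       = refl
  ι-length (x ∷ xs) = cong (1ℚ +ℚ_) (ι-length xs)

  record Finite (A : Set) : Set where
    field
      elems : List A
      _≟_   : DecidableEquality A
      once  : ∀ a → ∑ elems (λ x → χ (x ≟ a)) ≡ 1ℚ

    sum : (A → ℚ) → ℚ
    sum = ∑ elems

    private
      pick′ : ∀ xs a (f : A → ℚ) → ∑ xs (λ x → χ (x ≟ a) *ℚ f x) ≡ ∑ xs (λ x → χ (x ≟ a)) *ℚ f a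
      pick′ xs a f = trans (∑-cong xs (λ x → χ-guard (x ≟ a) (cong f))) (∑-*ʳ xs (f a) _)

    pick : ∀ a (f : A → ℚ) → sum (λ x → χ (x ≟ a) *ℚ f x) ≡ f a
    pick a f = trans (pick′ elems a f) (trans (cong (_*ℚ f a) (once a)) (ℚₚ.*-identityˡ (f a)))

    unique : {P : A → Set} (P? : ∀ x → Dec (P x)) (a : A) (f : A → ℚ) → P a → (∀ x → P x → x ≡ a) →
      sum (λ x → χ (P? x) *ℚ f x) ≡ f a
    unique P? a f pa u =
      trans (∑-cong elems (λ x → cong (_*ℚ f x) (χ-⇔ (P? x) (x ≟ a) (u x) (λ { refl → pa })))) (pick a f)

    unique1 : {P : A → Set} (P? : ∀ x → Dec (P x)) (a : A) → P a → (∀ x → P x → x ≡ a) →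
      sum (λ x → χ (P? x)) ≡ 1ℚ
    unique1 P? a pa u =
      trans (∑-cong elems (λ x → sym (ℚₚ.*-identityʳ _))) (unique P? a (λ _ → 1ℚ) pa u)

  open Finite using (elems; sum; pick; unique; unique1)

  module _ (X : Finite A) (Y : Finite B)
    {P : A → Set} {Q : B → Set} (P? : ∀ a → Dec (P a)) (Q? : ∀ b → Dec (Q b))
    (R : A → B → Set)
    (to   : ∀ a → P a → ∃ λ b → Q b × R a b)
    (from : ∀ b → Q b → ∃ λ a → P a × R a b)
    (functional : ∀ {a b b′} → P a → Q b → Q b′ → R a b → R a b′ → b ≡ b′)
    (injective  : ∀ {a a′ b} → Q b → P a → P a′ → R a b → R a′ b → a ≡ a′)
    (f : A → ℚ) (g : B → ℚ)
    (agree : ∀ {a b} → P a → Q b → R a b → f a ≡ g b)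
    where

    private
      module X = Finite X
      module Y = Finite Y

      W : A → B → Set
      W a b = P a × Q b × R a b

      W? : ∀ a b → Dec (W a b)
      W? a b with P? a
      ... | no ¬p = no (¬p ∘ proj₁)
      ... | yes p with to a p
      ...   | b′ , q , r with b Y.≟ b′
      ...     | yes refl = yes (p , q , r)
      ...     | no b≢b′  = no (λ { (p , q′ , r′) → b≢b′ (functional p q′ q r′ r) })

      row : ∀ a → χ (P? a) *ℚ f a ≡ Y.sum (λ b → χ (W? a b) *ℚ g b)
      row a = by (P? a)
        where
        by : Dec (P a) → χ (P? a) *ℚ f a ≡ Y.sum (λ b → χ (W? a b) *ℚ g b)
        by (no ¬p) = trans (χ-vanish (P? a) (⊥-elim ∘ ¬p)) (sym (∑-vanish Y.elems (λ b → χ-vanish (W? a b) (⊥-elim ∘ ¬p ∘ proj₁))))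
        by (yes p) = let b , q , r = to a p in
          trans (cong (_*ℚ f a) (χ-yes (P? a) p)) (trans (ℚₚ.*-identityˡ (f a)) (trans (agree p q r)
            (sym (Y.unique (W? a) b g (p , q , r) (λ { b′ (_ , q′ , r′) → functional p q′ q r′ r })))))

      column : ∀ b → χ (Q? b) *ℚ g b ≡ X.sum (λ a → χ (W? a b) *ℚ g b)
      column b = by (Q? b)
        where
        by : Dec (Q b) → χ (Q? b) *ℚ g b ≡ X.sum (λ a → χ (W? a b) *ℚ g b)
        by (no ¬q) = trans (χ-vanish (Q? b) (⊥-elim ∘ ¬q)) (sym (∑-vanish X.elems (λ a → χ-vanish (W? a b) (⊥-elim ∘ ¬q ∘ proj₁ ∘ proj₂))))
        by (yes q) = let a , p , r = from b q in
          trans (cong (_*ℚ g b) (χ-yes (Q? b) q)) (trans (ℚₚ.*-identityˡ (g b))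
            (sym (X.unique (λ a′ → W? a′ b) a (λ _ → g b) (p , q , r) (λ { a′ (p′ , _ , r′) → injective q p′ p r′ r }))))

    bijection : X.sum (λ a → χ (P? a) *ℚ f a) ≡ Y.sum (λ b → χ (Q? b) *ℚ g b)
    bijection = trans (∑-cong X.elems row) (trans (∑-swap X.elems Y.elems _) (sym (∑-cong Y.elems column)))

  ∑-allFin-suc : ∀ n (f : Fin (suc n) → ℚ) → ∑ (allFin (suc n)) f ≡ f zero +ℚ ∑ (allFin n) (f ∘ suc)
  ∑-allFin-suc n f = cong (f zero +ℚ_) (trans (cong (λ xs → ∑ xs f) (sym (Listₚ.map-tabulate id suc))) (∑-map suc (allFin n) f))

  fin : ∀ n → Finite (Fin n)
  fin n = record { elems = allFin n ; _≟_ = Finₚ._≟_ ; once = once n }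
    where
    once : ∀ n (a : Fin n) → ∑ (allFin n) (λ x → χ (x Finₚ.≟ a)) ≡ 1ℚ
    once (suc n) zero    = trans (∑-allFin-suc n (λ x → χ (x Finₚ.≟ zero))) (cong (1ℚ +ℚ_) (∑-vanish (allFin n) (λ x → refl)))
    once (suc n) (suc a) = trans (∑-allFin-suc n (λ x → χ (x Finₚ.≟ suc a))) (trans (ℚₚ.+-identityˡ _)
      (trans (∑-cong (allFin n) (λ x → χ-⇔ (suc x Finₚ.≟ suc a) (x Finₚ.≟ a) Finₚ.suc-injective (cong suc))) (once n a)))

  bool : Finite Bool
  bool = record { elems = bools ; _≟_ = _≟B_ ; once = λ { true → refl ; false → refl } }

  _⊗_ : Finite A → Finite B → Finite (A × B)
  X ⊗ Y = record
    { elems = concatMap (λ a → map (a ,_) (elems Y)) (elems X)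
    ; _≟_   = Productₚ.≡-dec (Finite._≟_ X) (Finite._≟_ Y)
    ; once  = once
    }
    where
    module X = Finite X
    module Y = Finite Y
    once : ∀ ab → ∑ (concatMap (λ a → map (a ,_) Y.elems) X.elems) (λ x → χ (Productₚ.≡-dec X._≟_ Y._≟_ x ab)) ≡ 1ℚ
    once (a₀ , b₀) = begin
      _ ≡⟨ ∑-concatMap _ X.elems _ ⟩
      _ ≡⟨ ∑-cong X.elems (λ a → ∑-map (a ,_) Y.elems _) ⟩
      _ ≡⟨ ∑-cong X.elems (λ a → ∑-cong Y.elems (λ b →
             trans (χ-⇔ (Productₚ.≡-dec X._≟_ Y._≟_ (a , b) (a₀ , b₀)) ((a X.≟ a₀) ×-dec (b Y.≟ b₀)) (λ { refl → refl , refl }) (λ { (refl , refl) → refl }))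
                   (χ-× (a X.≟ a₀) (b Y.≟ b₀)))) ⟩
      _ ≡⟨ ∑-cong X.elems (λ a → ∑-*ˡ Y.elems (χ (a X.≟ a₀)) (λ b → χ (b Y.≟ b₀))) ⟩
      _ ≡⟨ X.pick a₀ (λ _ → Y.sum (λ b → χ (b Y.≟ b₀))) ⟩
      _ ≡⟨ Y.once b₀ ⟩
      1ℚ ∎

  infixr 5 _⊗_

  sum-⊗ : (X : Finite A) (Y : Finite B) (f : A × B → ℚ) → sum (X ⊗ Y) f ≡ sum X (λ a → sum Y (λ b → f (a , b)))
  sum-⊗ X Y f = trans (∑-concatMap _ (elems X) f) (∑-cong (elems X) (λ a → ∑-map (a ,_) (elems Y) f))

  vec : Finite A → ∀ n → Finite (Vec A n)
  vec {A} X n = record { elems = vecs n ; _≟_ = Vecₚ.≡-dec X._≟_ ; once = once n }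
    where
    module X = Finite X
    vecs : ∀ n → List (Vec A n)
    vecs zero    = [] ∷ []
    vecs (suc n) = concatMap (λ a → map (a ∷_) (vecs n)) X.elems
    once : ∀ n v → ∑ (vecs n) (λ x → χ (Vecₚ.≡-dec X._≟_ x v)) ≡ 1ℚ
    once zero    []       = refl
    once (suc n) (a₀ ∷ v) = begin
      _ ≡⟨ ∑-concatMap _ X.elems _ ⟩
      _ ≡⟨ ∑-cong X.elems (λ a → ∑-map (a ∷_) (vecs n) _) ⟩
      _ ≡⟨ ∑-cong X.elems (λ a → ∑-cong (vecs n) (λ w →
             trans (χ-⇔ (Vecₚ.≡-dec X._≟_ (a ∷ w) (a₀ ∷ v)) ((a X.≟ a₀) ×-dec (Vecₚ.≡-dec X._≟_ w v)) (λ { refl → refl , refl }) (λ { (refl , refl) → refl }))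
                   (χ-× (a X.≟ a₀) (Vecₚ.≡-dec X._≟_ w v)))) ⟩
      _ ≡⟨ ∑-cong X.elems (λ a → ∑-*ˡ (vecs n) (χ (a X.≟ a₀)) (λ w → χ (Vecₚ.≡-dec X._≟_ w v))) ⟩
      _ ≡⟨ X.pick a₀ (λ _ → ∑ (vecs n) (λ w → χ (Vecₚ.≡-dec X._≟_ w v))) ⟩
      _ ≡⟨ once n v ⟩
      1ℚ ∎

  lookup-injective : ∀ {n} (v w : Vec A n) → (∀ i → lookup v i ≡ lookup w i) → v ≡ w
  lookup-injective []      []      eq = refl
  lookup-injective (x ∷ v) (y ∷ w) eq = cong₂ _∷_ (eq zero) (lookup-injective v w (eq ∘ suc))

  maybe : Finite A → Finite (Maybe A)
  maybe X = record
    { elems = nothing ∷ map just (elems X)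
    ; _≟_   = Maybeₚ.≡-dec X._≟_
    ; once  = λ
      { nothing  → trans (cong (1ℚ +ℚ_) (trans (∑-map just X.elems _) (∑-0 X.elems))) (ℚₚ.+-identityʳ 1ℚ)
      ; (just a) → trans (ℚₚ.+-identityˡ _) (trans (∑-map just X.elems _)
          (trans (∑-cong X.elems (λ x → χ-⇔ (Maybeₚ.≡-dec X._≟_ (just x) (just a)) (x X.≟ a) Maybeₚ.just-injective (cong just))) (X.once a))) }
    }
    where module X = Finite X

  module _ {_∼_ : B → B → Set} (∼-refl : ∀ {b} → b ∼ b) (X : Finite A) (h : A → B) (xs : List B)
    (represents : ∀ (f : B → ℚ) → (∀ {x y} → x ∼ y → f x ≡ f y) → ∑ xs f ≡ sum X (f ∘ h)) where

    ∑-funs : ∀ n (f : (Fin n → B) → ℚ) → (∀ {g g′} → (∀ i → g i ∼ g′ i) → f g ≡ f g′) →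
      ∑ (funs xs n) f ≡ sum (vec X n) (λ v → f (h ∘ lookup v))
    ∑-funs zero    f ext = cong (_+ℚ 0ℚ) (ext (λ ()))
    ∑-funs (suc n) f ext = begin
      ∑ (funs xs (suc n)) f
        ≡⟨ ∑-concatMap _ xs f ⟩
      _ ≡⟨ ∑-cong xs (λ b → ∑-map _ (funs xs n) f) ⟩
      _ ≡⟨ ∑-cong xs (λ b → ∑-cong (funs xs n) (λ g → ext (λ { zero → ∼-refl ; (suc i) → ∼-refl }))) ⟩
      ∑ xs (λ b → ∑ (funs xs n) (λ g → f (cons b g)))
        ≡⟨ ∑-cong xs (λ b → ∑-funs n (λ g → f (cons b g)) (λ eq → ext (λ { zero → ∼-refl ; (suc i) → eq i }))) ⟩
      ∑ xs (λ b → sum (vec X n) (λ v → f (cons b (h ∘ lookup v))))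
        ≡⟨ represents _ (λ eq → ∑-cong (elems (vec X n)) (λ v → ext (λ { zero → eq ; (suc i) → ∼-refl }))) ⟩
      _ ≡⟨ ∑-cong (elems X) (λ a → ∑-cong (elems (vec X n)) (λ v → ext (λ { zero → ∼-refl ; (suc i) → ∼-refl }))) ⟩
      _ ≡⟨ ∑-cong (elems X) (λ a → sym (∑-map (a ∷_) (elems (vec X n)) _)) ⟩
      _ ≡⟨ sym (∑-concatMap _ (elems X) _) ⟩
      sum (vec X (suc n)) (λ v → f (h ∘ lookup v)) ∎
      where
      cons : ∀ {n} → B → (Fin n → B) → Fin (suc n) → B
      cons b g zero    = b
      cons b g (suc i) = g i

open Sums
open Finite using (elems; sum; pick; unique; unique1)

module Polynomials where

  open import Data.Nat using (_<_; s≤s; _+_; _*_; _≡ᵇ_)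

  -- The functions local to cycLen, deg, substMono and stretch have no name outside Defs.
  -- With-abstraction turns their arguments into distinct variables, and
  -- pattern unification then solves the metavariable with the local function.
  mutual
    cycGo : (n : ℕ) → (Fin n → Fin n) → Fin n → ℕ → ℕ → ℕ
    cycGo = _

    cycLen-suc : ∀ n (π : Fin (suc n) → Fin (suc n)) i →
      cycLen π i ≡ (if iter π 1 i ==ᶠ i then 1 else cycGo (suc n) π i n 2)
    cycLen-suc n π i with suc n | π | i | 2
    ... | _ | _ | _ | _ = refl

  mutual
    degGo : ℕ → Mono → ℕ
    degGo = _

    deg≡degGo : ∀ m → deg m ≡ degGo 1 m
    deg≡degGo m with 1
    ... | _ = refl

  mutual
    substGo : Poly → ℕ → Mono → Poly
    substGo = _

    substMono≡substGo : ∀ q m → substMono q m ≡ substGo q 1 m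
    substMono≡substGo q m with 1
    ... | _ = refl

  mutual
    stretchApp : ℕ → ℕ → Mono → Mono → Mono → Mono
    stretchApp = _

    stretch≡stretchApp : ∀ k e es → stretch (suc k) (e ∷ es) ≡ stretchApp k e es (replicate k 0) (e ∷ stretch (suc k) es)
    stretch≡stretchApp k e es with replicate k 0 | List._∷_ e (stretch (suc k) es)
    ... | _ | _ = refl

  stretch-++ : ∀ k e es → stretch (suc k) (e ∷ es) ≡ replicate k 0 ++ (e ∷ stretch (suc k) es)
  stretch-++ k e es = trans (stretch≡stretchApp k e es) (app≡++ (replicate k 0) (e ∷ stretch (suc k) es))
    where
    app≡++ : ∀ xs ys → stretchApp k e es xs ys ≡ xs ++ ys
    app≡++ []       ys = refl
    app≡++ (x ∷ xs) ys = cong (x ∷_) (app≡++ xs ys)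

  ⟪_,_⟫ : Poly → (Mono → ℚ) → ℚ
  ⟪ p , φ ⟫ = ∑ p (λ t → proj₁ t *ℚ φ (proj₂ t))

  ⟪⟫-cong : ∀ p {φ ψ} → (∀ m → φ m ≡ ψ m) → ⟪ p , φ ⟫ ≡ ⟪ p , ψ ⟫
  ⟪⟫-cong p eq = ∑-cong p (λ t → cong (proj₁ t *ℚ_) (eq (proj₂ t)))

  ⟪⟫-swap : ∀ p q (φ : Mono → Mono → ℚ) → ⟪ p , (λ a → ⟪ q , φ a ⟫) ⟫ ≡ ⟪ q , (λ b → ⟪ p , (λ a → φ a b) ⟫) ⟫
  ⟪⟫-swap p q φ = begin
    _ ≡⟨ ∑-cong p (λ s → sym (∑-*ˡ q (proj₁ s) _)) ⟩
    _ ≡⟨ ∑-swap p q _ ⟩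
    _ ≡⟨ ∑-cong q (λ t → ∑-cong p (λ s → swap*ˡ (proj₁ s) (proj₁ t) _)) ⟩
    _ ≡⟨ ∑-cong q (λ t → ∑-*ˡ p (proj₁ t) _) ⟩
    _ ∎

  ⟪⟫-coeff : ∀ m p → coeff m p ≡ ⟪ p , (λ m′ → χᵇ (monoEq m m′)) ⟫
  ⟪⟫-coeff m [] = refl
  ⟪⟫-coeff m ((c , m′) ∷ p) with monoEq m m′
  ... | true  = cong₂ _+ℚ_ (sym (ℚₚ.*-identityʳ c)) (⟪⟫-coeff m p)
  ... | false = trans (⟪⟫-coeff m p) (trans (sym (ℚₚ.+-identityˡ _)) (cong (_+ℚ ⟪ p , _ ⟫) (sym (ℚₚ.*-zeroʳ c))))

  ⟪⟫-oneP : ∀ φ → ⟪ oneP , φ ⟫ ≡ φ []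
  ⟪⟫-oneP φ = trans (ℚₚ.+-identityʳ _) (ℚₚ.*-identityˡ (φ []))

  ⟪⟫-scaleP : ∀ c p φ → ⟪ scaleP c p , φ ⟫ ≡ c *ℚ ⟪ p , φ ⟫
  ⟪⟫-scaleP c p φ = trans (∑-map _ p _) (trans (∑-cong p (λ t → ℚₚ.*-assoc c (proj₁ t) _)) (∑-*ˡ p c _))

  ⟪⟫-stretchP : ∀ k p φ → ⟪ stretchP k p , φ ⟫ ≡ ⟪ p , φ ∘ stretch k ⟫
  ⟪⟫-stretchP k p φ = ∑-map _ p _

  ⟪⟫-mulP : ∀ p q φ → ⟪ mulP p q , φ ⟫ ≡ ⟪ p , (λ a → ⟪ q , (λ b → φ (addMono a b)) ⟫) ⟫
  ⟪⟫-mulP p q φ = begin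
    _ ≡⟨ ∑-concatMap _ p _ ⟩
    _ ≡⟨ ∑-cong p (λ s → ∑-map _ q _) ⟩
    _ ≡⟨ ∑-cong p (λ s → ∑-cong q (λ t → ℚₚ.*-assoc (proj₁ s) (proj₁ t) _)) ⟩
    _ ≡⟨ ∑-cong p (λ s → ∑-*ˡ q (proj₁ s) _) ⟩
    _ ∎

  ⟪⟫-compose : ∀ F q φ → ⟪ compose F q , φ ⟫ ≡ ⟪ F , (λ m → ⟪ substMono q m , φ ⟫) ⟫
  ⟪⟫-compose F q φ = trans (∑-concatMap _ F _) (∑-cong F (λ t → ⟪⟫-scaleP (proj₁ t) (substMono q (proj₂ t)) φ))

  addMono-identityʳ : ∀ m → addMono m [] ≡ m
  addMono-identityʳ []      = refl
  addMono-identityʳ (x ∷ m) = refl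

  addMono-comm : ∀ a b → addMono a b ≡ addMono b a
  addMono-comm []      b       = sym (addMono-identityʳ b)
  addMono-comm (x ∷ a) []      = refl
  addMono-comm (x ∷ a) (y ∷ b) = cong₂ _∷_ (ℕₚ.+-comm x y) (addMono-comm a b)

  addMono-assoc : ∀ a b c → addMono (addMono a b) c ≡ addMono a (addMono b c)
  addMono-assoc []      b       c       = refl
  addMono-assoc (x ∷ a) []      c       = refl
  addMono-assoc (x ∷ a) (y ∷ b) []      = refl
  addMono-assoc (x ∷ a) (y ∷ b) (z ∷ c) = cong₂ _∷_ (ℕₚ.+-assoc x y z) (addMono-assoc a b c)

  inc : ℕ → Mono → Mono
  inc zero    []      = 1 ∷ []
  inc zero    (x ∷ m) = suc x ∷ m
  inc (suc t) []      = 0 ∷ inc t []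
  inc (suc t) (x ∷ m) = x ∷ inc t m

  module _ (q : Poly) where

    private
      IncSpec : ℕ → Mono → Set
      IncSpec t m = ∀ i φ → ⟪ substGo q i (inc t m) , φ ⟫ ≡
        ⟪ substGo q i m , (λ a → ⟪ stretchP (i + t) q , (λ b → φ (addMono a b)) ⟫) ⟫

      inc-zero-∷ : ∀ x m → IncSpec zero (x ∷ m)
      inc-zero-∷ x m i φ = begin
        ⟪ mulP (mulP S (powP S x)) T , φ ⟫
          ≡⟨ trans (⟪⟫-mulP (mulP S (powP S x)) T φ) (⟪⟫-mulP S (powP S x) _) ⟩
        ⟪ S , (λ a → ⟪ powP S x , (λ b → ⟪ T , (λ c → φ (addMono (addMono a b) c)) ⟫) ⟫) ⟫
          ≡⟨ ⟪⟫-swap S (powP S x) _ ⟩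
        ⟪ powP S x , (λ b → ⟪ S , (λ a → ⟪ T , (λ c → φ (addMono (addMono a b) c)) ⟫) ⟫) ⟫
          ≡⟨ ⟪⟫-cong (powP S x) (λ b → ⟪⟫-swap S T _) ⟩
        ⟪ powP S x , (λ b → ⟪ T , (λ c → ⟪ S , (λ a → φ (addMono (addMono a b) c)) ⟫) ⟫) ⟫
          ≡⟨ ⟪⟫-cong (powP S x) (λ b → ⟪⟫-cong T (λ c → ⟪⟫-cong S (λ a → cong φ (rotate a b c)))) ⟩
        ⟪ powP S x , (λ b → ⟪ T , (λ c → ⟪ S , (λ a → φ (addMono (addMono b c) a)) ⟫) ⟫) ⟫
          ≡⟨ sym (⟪⟫-mulP (powP S x) T _) ⟩
        ⟪ mulP (powP S x) T , (λ m → ⟪ S , (λ a → φ (addMono m a)) ⟫) ⟫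
          ≡⟨ cong (λ j → ⟪ mulP (powP S x) T , (λ m → ⟪ stretchP j q , (λ a → φ (addMono m a)) ⟫) ⟫) (sym (ℕₚ.+-identityʳ i)) ⟩
        _ ∎
        where
        S T : Poly
        S = stretchP i q
        T = substGo q (suc i) m
        rotate : ∀ a b c → addMono (addMono a b) c ≡ addMono (addMono b c) a
        rotate a b c = trans (addMono-assoc a b c) (addMono-comm a (addMono b c))

      inc-suc-∷ : ∀ t x m → IncSpec t m → IncSpec (suc t) (x ∷ m)
      inc-suc-∷ t x m ih i φ = begin
        ⟪ mulP S (substGo q (suc i) (inc t m)) , φ ⟫
          ≡⟨ ⟪⟫-mulP S _ φ ⟩
        ⟪ S , (λ a → ⟪ substGo q (suc i) (inc t m) , (λ b → φ (addMono a b)) ⟫) ⟫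
          ≡⟨ ⟪⟫-cong S (λ a → ih (suc i) _) ⟩
        ⟪ S , (λ a → ⟪ T , (λ b → ⟪ stretchP (suc i + t) q , (λ c → φ (addMono a (addMono b c))) ⟫) ⟫) ⟫
          ≡⟨ ⟪⟫-cong S (λ a → ⟪⟫-cong T (λ b → trans
               (⟪⟫-cong (stretchP (suc i + t) q) (λ c → cong φ (sym (addMono-assoc a b c))))
               (cong (λ j → ⟪ stretchP j q , (λ c → φ (addMono (addMono a b) c)) ⟫) (sym (ℕₚ.+-suc i t))))) ⟩
        ⟪ S , (λ a → ⟪ T , (λ b → ⟪ stretchP (i + suc t) q , (λ c → φ (addMono (addMono a b) c)) ⟫) ⟫) ⟫
          ≡⟨ sym (⟪⟫-mulP S T _) ⟩
        _ ∎
        where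
        S T : Poly
        S = powP (stretchP i q) x
        T = substGo q (suc i) m

      pad : ∀ i φ → ⟪ substGo q i (0 ∷ []) , φ ⟫ ≡ ⟪ substGo q i [] , φ ⟫
      pad i φ = trans (⟪⟫-mulP oneP oneP φ) (⟪⟫-oneP (λ a → ⟪ oneP , (λ b → φ (addMono a b)) ⟫))

      incSpec : ∀ t m → IncSpec t m
      incSpec zero    []      i φ = trans (inc-zero-∷ 0 [] i φ) (pad i (λ a → ⟪ stretchP (i + 0) q , (λ b → φ (addMono a b)) ⟫))
      incSpec zero    (x ∷ m) i φ = inc-zero-∷ x m i φ
      incSpec (suc t) []      i φ = trans (inc-suc-∷ t 0 [] (incSpec t []) i φ) (pad i (λ a → ⟪ stretchP (i + suc t) q , (λ b → φ (addMono a b)) ⟫))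
      incSpec (suc t) (x ∷ m) i φ = inc-suc-∷ t x m (incSpec t m) i φ

    substMono-inc : ∀ t m φ → ⟪ substMono q (inc t m) , φ ⟫ ≡
      ⟪ substMono q m , (λ a → ⟪ stretchP (suc t) q , (λ b → φ (addMono a b)) ⟫) ⟫
    substMono-inc t m φ = trans (cong (λ p → ⟪ p , φ ⟫) (substMono≡substGo q (inc t m)))
      (trans (incSpec t m 1 φ) (cong (λ p → ⟪ p , _ ⟫) (sym (substMono≡substGo q m))))

  exponent : Mono → ℕ → ℕ
  exponent []      t       = 0
  exponent (x ∷ m) zero    = x
  exponent (x ∷ m) (suc t) = exponent m t

  -- Two monomials are identified when they differ in trailing zeros only.
  infix 4 _≈_
  _≈_ : Mono → Mono → Set
  a ≈ b = ∀ t → exponent a t ≡ exponent b t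

  ≈-∷ : ∀ {x y a b} → x ≡ y → a ≈ b → (x ∷ a) ≈ (y ∷ b)
  ≈-∷ eq eqs zero    = eq
  ≈-∷ eq eqs (suc t) = eqs t

  zeros-sound : ∀ ys → allL ys (λ y → y ≡ᵇ 0) ≡ true → [] ≈ ys
  zeros-sound []          eq t = refl
  zeros-sound (zero ∷ ys) eq zero = refl
  zeros-sound (zero ∷ ys) eq (suc t) = zeros-sound ys eq t

  zeros-complete : ∀ ys → [] ≈ ys → allL ys (λ y → y ≡ᵇ 0) ≡ true
  zeros-complete []           eq = refl
  zeros-complete (zero ∷ ys)  eq = zeros-complete ys (eq ∘ suc)
  zeros-complete (suc y ∷ ys) eq with () ← eq 0

  ≡ᵇ-sound : ∀ x y → (x ≡ᵇ y) ≡ true → x ≡ y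
  ≡ᵇ-sound zero    zero    eq = refl
  ≡ᵇ-sound (suc x) (suc y) eq = cong suc (≡ᵇ-sound x y eq)

  ≡ᵇ-refl : ∀ x → (x ≡ᵇ x) ≡ true
  ≡ᵇ-refl zero    = refl
  ≡ᵇ-refl (suc x) = ≡ᵇ-refl x

  ∧-sound : ∀ {a b} → a ∧ b ≡ true → a ≡ true × b ≡ true
  ∧-sound {true} {true} eq = refl , refl

  monoEq-sound : ∀ a b → monoEq a b ≡ true → a ≈ b
  monoEq-sound []      b       eq   = zeros-sound b eq
  monoEq-sound (x ∷ a) []      eq   = sym ∘ zeros-sound (x ∷ a) eq
  monoEq-sound (x ∷ a) (y ∷ b) eq   = let p , r = ∧-sound eq in ≈-∷ (≡ᵇ-sound x y p) (monoEq-sound a b r)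

  monoEq-complete : ∀ a b → a ≈ b → monoEq a b ≡ true
  monoEq-complete []      b       eq = zeros-complete b eq
  monoEq-complete (x ∷ a) []      eq = zeros-complete (x ∷ a) (sym ∘ eq)
  monoEq-complete (x ∷ a) (y ∷ b) eq =
    cong₂ _∧_ (subst (λ z → (x ≡ᵇ z) ≡ true) (eq 0) (≡ᵇ-refl x)) (monoEq-complete a b (eq ∘ suc))

  bool-ext : ∀ {a b} → (a ≡ true → b ≡ true) → (b ≡ true → a ≡ true) → a ≡ b
  bool-ext {true}  {b}     f g = sym (f refl)
  bool-ext {false} {false} f g = refl
  bool-ext {false} {true}  f g with () ← g refl

  monoEq-resp : ∀ m {a b} → a ≈ b → monoEq m a ≡ monoEq m b
  monoEq-resp m {a} {b} eq = bool-ext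
    (λ h → monoEq-complete m b (λ t → trans (monoEq-sound m a h t) (eq t)))
    (λ h → monoEq-complete m a (λ t → trans (monoEq-sound m b h t) (sym (eq t))))

  exponent-addMono : ∀ a b t → exponent (addMono a b) t ≡ exponent a t + exponent b t
  exponent-addMono []      b       t       = refl
  exponent-addMono (x ∷ a) []      t       = sym (ℕₚ.+-identityʳ _)
  exponent-addMono (x ∷ a) (y ∷ b) zero    = refl
  exponent-addMono (x ∷ a) (y ∷ b) (suc t) = exponent-addMono a b t

  -- In the cycle type of a permutation, ω m j counts the points on cycles of length j.
  ω : Mono → ℕ → ℕ
  ω m zero    = 0
  ω m (suc t) = suc t * exponent m t

  ω-injective : ∀ a b → (∀ j → ω a j ≡ ω b j) → a ≈ b
  ω-injective a b eq t = ℕₚ.*-cancelˡ-≡ _ _ (suc t) (eq (suc t))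

  ω-cong : ∀ a b → a ≈ b → ∀ j → ω a j ≡ ω b j
  ω-cong a b eq zero    = refl
  ω-cong a b eq (suc t) = cong (suc t *_) (eq t)

  ω-addMono : ∀ a b j → ω (addMono a b) j ≡ ω a j + ω b j
  ω-addMono a b zero    = refl
  ω-addMono a b (suc t) = trans (cong (suc t *_) (exponent-addMono a b t)) (ℕₚ.*-distribˡ-+ (suc t) (exponent a t) (exponent b t))

  exponent-inc : ∀ t m → exponent (inc t m) t ≡ suc (exponent m t)
  exponent-inc zero    []      = refl
  exponent-inc zero    (x ∷ m) = refl
  exponent-inc (suc t) []      = exponent-inc t []
  exponent-inc (suc t) (x ∷ m) = exponent-inc t m

  exponent-inc-≢ : ∀ t m u → t ≢ u → exponent (inc t m) u ≡ exponent m u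
  exponent-inc-≢ zero    m       zero    ne = contradiction refl ne
  exponent-inc-≢ zero    []      (suc u) ne = refl
  exponent-inc-≢ zero    (x ∷ m) (suc u) ne = refl
  exponent-inc-≢ (suc t) []      zero    ne = refl
  exponent-inc-≢ (suc t) (x ∷ m) zero    ne = refl
  exponent-inc-≢ (suc t) []      (suc u) ne = exponent-inc-≢ t [] u (ne ∘ cong suc)
  exponent-inc-≢ (suc t) (x ∷ m) (suc u) ne = exponent-inc-≢ t m u (ne ∘ cong suc)

  ω-inc : ∀ t m → ω (inc t m) (suc t) ≡ suc t + ω m (suc t)
  ω-inc t m = trans (cong (suc t *_) (exponent-inc t m)) (ℕₚ.*-suc (suc t) _)

  ω-inc-≢ : ∀ t m j → suc t ≢ j → ω (inc t m) j ≡ ω m j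
  ω-inc-≢ t m zero    ne = refl
  ω-inc-≢ t m (suc u) ne = cong (suc u *_) (exponent-inc-≢ t m u (ne ∘ cong suc))

  exponent-pad-≥ : ∀ k ys t → exponent (replicate k 0 ++ ys) (k + t) ≡ exponent ys t
  exponent-pad-≥ zero    ys t = refl
  exponent-pad-≥ (suc k) ys t = exponent-pad-≥ k ys t

  exponent-pad-< : ∀ k ys t → t < k → exponent (replicate k 0 ++ ys) t ≡ 0
  exponent-pad-< (suc k) ys zero    t<k       = refl
  exponent-pad-< (suc k) ys (suc t) (s≤s t<k) = exponent-pad-< k ys t t<k

  private
    exponent₁ : Mono → ℕ → ℕ
    exponent₁ m zero    = 0
    exponent₁ m (suc t) = exponent m t

    exponent₁-shift : ∀ k e es j → exponent₁ (stretch (suc k) (e ∷ es)) (suc k + suc j) ≡ exponent (stretch (suc k) es) j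
    exponent₁-shift k e es j rewrite stretch-++ k e es = exponent-pad-≥ k _ (suc j)

    exponent₁-stretch : ∀ k m j → exponent₁ (stretch (suc k) m) (suc k * j) ≡ exponent₁ m j
    exponent₁-stretch k m        zero rewrite ℕₚ.*-zeroʳ k = refl
    exponent₁-stretch k []       (suc j) = refl
    exponent₁-stretch k (e ∷ es) (suc zero) rewrite stretch-++ k e es | ℕₚ.*-identityʳ k =
      trans (cong (exponent (replicate k 0 ++ (e ∷ stretch (suc k) es))) (sym (ℕₚ.+-identityʳ k))) (exponent-pad-≥ k _ 0)
    exponent₁-stretch k (e ∷ es) (suc (suc j)) =
      trans (cong (exponent₁ (stretch (suc k) (e ∷ es))) (ℕₚ.*-suc (suc k) (suc j)))
        (trans (exponent₁-shift k e es (j + k * suc j)) (exponent₁-stretch k es (suc j)))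

    exponent₁-stretch-∤ : ∀ k m j → ¬ (suc k ∣ j) → exponent₁ (stretch (suc k) m) j ≡ 0
    exponent₁-stretch-∤ k m        zero    ∤ = refl
    exponent₁-stretch-∤ k []       (suc j) ∤ = refl
    exponent₁-stretch-∤ k (e ∷ es) (suc j) ∤ with ℕₚ.<-cmp j k
    ... | tri< j<k _ _ rewrite stretch-++ k e es = exponent-pad-< k _ j j<k
    ... | tri≈ _ refl _ = contradiction ∣-refl ∤
    ... | tri> _ _ k<j with ℕₚ.m≤n⇒∃[o]m+o≡n k<j
    ...   | o , refl = trans (cong (exponent₁ (stretch (suc k) (e ∷ es))) (cong suc (sym (ℕₚ.+-suc k o))))
              (trans (exponent₁-shift k e es o) (exponent₁-stretch-∤ k es (suc o) (λ d → ∤ (subst (suc k ∣_) (cong suc (ℕₚ.+-suc k o)) (∣m∣n⇒∣m+n ∣-refl d)))))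

    ω≡ : ∀ m j → ω m j ≡ j * exponent₁ m j
    ω≡ m zero    = refl
    ω≡ m (suc j) = refl

  ω-stretch : ∀ k m j → ω (stretch (suc k) m) (suc k * j) ≡ suc k * ω m j
  ω-stretch k m j = begin
    ω (stretch (suc k) m) (suc k * j)                             ≡⟨ ω≡ (stretch (suc k) m) (suc k * j) ⟩
    (suc k * j) * exponent₁ (stretch (suc k) m) (suc k * j)       ≡⟨ cong ((suc k * j) *_) (exponent₁-stretch k m j) ⟩
    (suc k * j) * exponent₁ m j                                   ≡⟨ ℕₚ.*-assoc (suc k) j _ ⟩
    suc k * (j * exponent₁ m j)                                   ≡⟨ cong (suc k *_) (sym (ω≡ m j)) ⟩
    suc k * ω m j                                                 ∎

  ω-stretch-∤ : ∀ k m j → ¬ (suc k ∣ j) → ω (stretch (suc k) m) j ≡ 0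
  ω-stretch-∤ k m j ∤ = trans (ω≡ (stretch (suc k) m) j) (trans (cong (j *_) (exponent₁-stretch-∤ k m j ∤)) (ℕₚ.*-zeroʳ j))

  degGo-resp : ∀ k a b → a ≈ b → degGo k a ≡ degGo k b
  degGo-resp k []      []      eq = refl
  degGo-resp k []      (y ∷ b) eq = cong₂ _+_ (trans (sym (ℕₚ.*-zeroʳ k)) (cong (k *_) (eq 0))) (degGo-resp (suc k) [] b (eq ∘ suc))
  degGo-resp k (x ∷ a) []      eq = cong₂ _+_ (trans (cong (k *_) (eq 0)) (ℕₚ.*-zeroʳ k)) (degGo-resp (suc k) a [] (eq ∘ suc))
  degGo-resp k (x ∷ a) (y ∷ b) eq = cong₂ _+_ (cong (k *_) (eq 0)) (degGo-resp (suc k) a b (eq ∘ suc))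

  deg-resp : ∀ a b → a ≈ b → deg a ≡ deg b
  deg-resp a b eq = trans (deg≡degGo a) (trans (degGo-resp 1 a b eq) (sym (deg≡degGo b)))

  deg-addMono : ∀ a b → deg (addMono a b) ≡ deg a + deg b
  deg-addMono a b = trans (deg≡degGo (addMono a b)) (trans (go 1 a b) (sym (cong₂ _+_ (deg≡degGo a) (deg≡degGo b))))
    where
    interchange : ∀ a b c d → (a + b) + (c + d) ≡ (a + c) + (b + d)
    interchange a b c d = trans (ℕₚ.+-assoc a b (c + d)) (trans (cong (a +_)
      (trans (sym (ℕₚ.+-assoc b c d)) (trans (cong (_+ d) (ℕₚ.+-comm b c)) (ℕₚ.+-assoc c b d)))) (sym (ℕₚ.+-assoc a c (b + d))))
    go : ∀ k a b → degGo k (addMono a b) ≡ degGo k a + degGo k b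
    go k []      b       = refl
    go k (x ∷ a) []      = sym (ℕₚ.+-identityʳ _)
    go k (x ∷ a) (y ∷ b) = trans (cong₂ _+_ (ℕₚ.*-distribˡ-+ k x y) (go (suc k) a b)) (interchange (k * x) (k * y) _ _)

  deg-inc : ∀ t m → deg (inc t m) ≡ suc t + deg m
  deg-inc t m = trans (deg≡degGo (inc t m)) (trans (go 1 t m) (cong (suc t +_) (sym (deg≡degGo m))))
    where
    go-[] : ∀ k t → degGo k (inc t []) ≡ k + t
    go-[] k zero    = trans (ℕₚ.+-identityʳ _) (trans (ℕₚ.*-identityʳ k) (sym (ℕₚ.+-identityʳ k)))
    go-[] k (suc t) = trans (cong (_+ degGo (suc k) (inc t [])) (ℕₚ.*-zeroʳ k)) (trans (go-[] (suc k) t) (sym (ℕₚ.+-suc k t)))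
    go : ∀ k t m → degGo k (inc t m) ≡ (k + t) + degGo k m
    go k t       []      = trans (go-[] k t) (sym (ℕₚ.+-identityʳ _))
    go k zero    (x ∷ m) rewrite ℕₚ.*-suc k x | ℕₚ.+-identityʳ k = ℕₚ.+-assoc k (k * x) _
    go k (suc t) (x ∷ m) rewrite go (suc k) t m | ℕₚ.+-suc k t =
      trans (sym (ℕₚ.+-assoc (k * x) (suc (k + t)) _)) (trans (cong (_+ degGo (suc k) m) (ℕₚ.+-comm (k * x) (suc (k + t)))) (ℕₚ.+-assoc (suc (k + t)) (k * x) _))

  deg-stretch : ∀ k m → deg (stretch (suc k) m) ≡ suc k * deg m
  deg-stretch k m = trans (deg≡degGo (stretch (suc k) m)) (trans (trans (cong (λ z → degGo (suc z) (stretch (suc k) m)) (sym (ℕₚ.*-zeroʳ k))) (go 0 m)) (cong (suc k *_) (sym (deg≡degGo m))))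
    where
    go-pad : ∀ i k ys → degGo i (replicate k 0 ++ ys) ≡ degGo (k + i) ys
    go-pad i zero    ys = refl
    go-pad i (suc k) ys rewrite ℕₚ.*-zeroʳ i = trans (go-pad (suc i) k ys) (cong (λ z → degGo z ys) (ℕₚ.+-suc k i))
    go : ∀ t m → degGo (suc (suc k * t)) (stretch (suc k) m) ≡ suc k * degGo (suc t) m
    go t []       = sym (ℕₚ.*-zeroʳ k)
    go t (e ∷ es) rewrite stretch-++ k e es = begin
      _ ≡⟨ go-pad (suc (suc k * t)) k (e ∷ stretch (suc k) es) ⟩
      degGo (k + suc (suc k * t)) (e ∷ stretch (suc k) es)
        ≡⟨ cong (λ z → degGo z (e ∷ stretch (suc k) es)) (trans (ℕₚ.+-suc k (suc k * t)) (sym (ℕₚ.*-suc (suc k) t))) ⟩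
      (suc k * suc t) * e + degGo (suc (suc k * suc t)) (stretch (suc k) es)
        ≡⟨ cong₂ _+_ (ℕₚ.*-assoc (suc k) (suc t) e) (go (suc t) es) ⟩
      suc k * (suc t * e) + suc k * degGo (suc (suc t)) es
        ≡⟨ sym (ℕₚ.*-distribˡ-+ (suc k) (suc t * e) _) ⟩
      suc k * (suc t * e + degGo (suc (suc t)) es) ∎

open Polynomials

module Isomorphisms where

  open import Data.Nat using (_≤_; _<_; s≤s; z≤n; _≡ᵇ_)

  private variable
    A B : Set
    n : ℕ

  ∧-complete : ∀ {a b} → a ≡ true → b ≡ true → a ∧ b ≡ true
  ∧-complete refl refl = refl

  ∨-sound : ∀ {a b} → a ∨ b ≡ true → a ≡ true ⊎ b ≡ true
  ∨-sound {true}  eq = inj₁ refl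
  ∨-sound {false} eq = inj₂ eq

  ∨-completeˡ : ∀ {a b} → a ≡ true → a ∨ b ≡ true
  ∨-completeˡ refl = refl

  ∨-completeʳ : ∀ {a b} → b ≡ true → a ∨ b ≡ true
  ∨-completeʳ {true}  refl = refl
  ∨-completeʳ {false} refl = refl

  not-sound : ∀ {a} → not a ≡ true → ¬ (a ≡ true)
  not-sound {true} () refl
  not-sound {false} refl ()

  not-complete : ∀ {a} → ¬ (a ≡ true) → not a ≡ true
  not-complete {true}  ne = contradiction refl ne
  not-complete {false} ne = refl

  ⇒-sound : ∀ {a b} → not a ∨ b ≡ true → a ≡ true → b ≡ true
  ⇒-sound {true} {true} eq refl = refl

  ⇒-complete : ∀ {a b} → (a ≡ true → b ≡ true) → not a ∨ b ≡ true
  ⇒-complete {true}  f = f refl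
  ⇒-complete {false} f = refl

  eqB-sound : ∀ {a b} → eqB a b ≡ true → a ≡ b
  eqB-sound {true}  {true}  eq = refl
  eqB-sound {false} {false} eq = refl

  eqB-complete : ∀ {a b} → a ≡ b → eqB a b ≡ true
  eqB-complete {true}  refl = refl
  eqB-complete {false} refl = refl

  ==-sound : {i j : Fin n} → (i ==ᶠ j) ≡ true → i ≡ j
  ==-sound {i = i} {j} eq = Finₚ.toℕ-injective (≡ᵇ-sound (toℕ i) (toℕ j) eq)

  ==-complete : {i j : Fin n} → i ≡ j → (i ==ᶠ j) ≡ true
  ==-complete {i = i} refl = ≡ᵇ-refl (toℕ i)

  allB-sound : ∀ n {p : Fin n → Bool} → allB n p ≡ true → ∀ i → p i ≡ true
  allB-sound (suc n) {p} eq zero = proj₁ (∧-sound eq)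
  allB-sound (suc n) {p} eq (suc i) = go n suc (proj₂ (∧-sound {p zero} eq)) i
    where
    go : ∀ {m} k (f : Fin k → Fin m) {p : Fin m → Bool} → allL (Data.List.tabulate f) p ≡ true → ∀ i → p (f i) ≡ true
    go (suc k) f eq zero        = proj₁ (∧-sound eq)
    go (suc k) f {p} eq (suc i) = go k (f ∘ suc) (proj₂ (∧-sound {p (f zero)} eq)) i

  allB-complete : ∀ n {p : Fin n → Bool} → (∀ i → p i ≡ true) → allB n p ≡ true
  allB-complete n f = go (allFin n) f
    where
    go : ∀ (xs : List A) {p : A → Bool} → (∀ i → p i ≡ true) → allL xs p ≡ true
    go []       f = refl
    go (x ∷ xs) f = ∧-complete (f x) (go xs f)

  anyL-sound : ∀ (xs : List A) {p : A → Bool} → anyL xs p ≡ true → ∃ λ x → p x ≡ true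
  anyL-sound (x ∷ xs) {p} eq with p x in eqx
  ... | true  = x , eqx
  ... | false = anyL-sound xs eq

  anyB-complete : ∀ n {p : Fin n → Bool} i → p i ≡ true → anyB n p ≡ true
  anyB-complete n {p} i eq = go n id i eq
    where
    go : ∀ k (f : Fin k → Fin n) i → p (f i) ≡ true → anyL (Data.List.tabulate f) p ≡ true
    go (suc k) f zero    eq = ∨-completeˡ eq
    go (suc k) f (suc i) eq = ∨-completeʳ {p (f zero)} (go k (f ∘ suc) i eq)

  anyL-++ʳ : ∀ (xs ys : List A) {p : A → Bool} → anyL ys p ≡ true → anyL (xs ++ ys) p ≡ true
  anyL-++ʳ []       ys     eq = eq
  anyL-++ʳ (x ∷ xs) ys {p} eq = ∨-completeʳ {p x} (anyL-++ʳ xs ys eq)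

  anyL-++ˡ : ∀ (xs ys : List A) {p : A → Bool} → anyL xs p ≡ true → anyL (xs ++ ys) p ≡ true
  anyL-++ˡ (x ∷ xs) ys {p} eq with p x
  ... | true  = refl
  ... | false = anyL-++ˡ xs ys eq

  anyL-concatMap : ∀ (h : A → List B) (xs : List A) {p : B → Bool} →
    anyL xs (λ x → anyL (h x) p) ≡ true → anyL (concatMap h xs) p ≡ true
  anyL-concatMap h (x ∷ xs) {p} eq with anyL (h x) p in eqx
  ... | true  = anyL-++ˡ (h x) _ eqx
  ... | false = anyL-++ʳ (h x) _ (anyL-concatMap h xs eq)

  anyL-map : ∀ (h : A → B) (xs : List A) {p : B → Bool} → anyL xs (p ∘ h) ≡ true → anyL (map h xs) p ≡ true
  anyL-map h (x ∷ xs) {p} eq with p (h x)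
  ... | true  = refl
  ... | false = anyL-map h xs eq

  anyL-filter : ∀ (r : A → Bool) (xs : List A) {p : A → Bool} →
    anyL xs (λ x → r x ∧ p x) ≡ true → anyL (filterᵇ r xs) p ≡ true
  anyL-filter r (x ∷ xs) {p} eq with r x
  ... | false = anyL-filter r xs eq
  ... | true with p x
  ...   | true  = refl
  ...   | false = anyL-filter r xs eq

  anyL-filter-sound : ∀ (r : A → Bool) (xs : List A) {p : A → Bool} →
    anyL (filterᵇ r xs) p ≡ true → ∃ λ x → r x ≡ true × p x ≡ true
  anyL-filter-sound r (x ∷ xs) {p} eq with r x in eqr
  ... | false = anyL-filter-sound r xs eq
  ... | true with p x in eqp
  ...   | true  = x , eqr , eqp
  ...   | false = anyL-filter-sound r xs eq

  anyL-funs : ∀ {m} n {p : (Fin n → Fin m) → Bool} → (∀ {f g} → (∀ i → f i ≡ g i) → p f ≡ p g) →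
    ∀ f → p f ≡ true → anyL (funs (allFin m) n) p ≡ true
  anyL-funs zero    {p} ext f eq = ∨-completeˡ (trans (ext (λ ())) eq)
  anyL-funs {m} (suc n) {p} ext f eq = anyL-concatMap _ (allFin m) (anyB-complete m (f zero)
    (anyL-map _ (funs (allFin m) n) (anyL-funs n (λ e → ext (λ { zero → refl ; (suc i) → e i })) (f ∘ suc)
      (trans (ext (λ { zero → refl ; (suc i) → refl })) eq))))

  Injection : ∀ {m n} → (Fin m → Fin n) → Set
  Injection f = ∀ {i j} → f i ≡ f j → i ≡ j

  injectiveB-sound : (f : Fin n → Fin n) → injectiveB f ≡ true → Injection f
  injectiveB-sound {n} f eq {i} {j} e with ∨-sound {not (f i ==ᶠ f j)} (allB-sound n (allB-sound n eq i) j)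
  ... | inj₁ ne = contradiction (==-complete e) (not-sound {f i ==ᶠ f j} ne)
  ... | inj₂ e′ = ==-sound e′

  injectiveB-complete : (f : Fin n → Fin n) → Injection f → injectiveB f ≡ true
  injectiveB-complete {n} f inj = allB-complete n (λ i → allB-complete n (λ j →
    ⇒-complete {f i ==ᶠ f j} (λ e → ==-complete (inj (==-sound e)))))

  injection? : ∀ {m n} (f : Fin m → Fin n) → Dec (Injection f)
  injection? f = map′ (λ h {i} {j} → h i j) (λ h i j → h)
    (Finₚ.all? (λ i → Finₚ.all? (λ j → (f i Finₚ.≟ f j) Relation.Nullary.→-dec (i Finₚ.≟ j))))

  χ-injective : (f : Fin n → Fin n) → χᵇ (injectiveB f) ≡ χ (injection? f)
  χ-injective f = χᵇ-dec (injectiveB f) (injection? f) (λ e {i} {j} → injectiveB-sound f e {i} {j}) (injectiveB-complete f)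

  Extensional : {C : Set} → ((Fin n → A) → C) → Set
  Extensional f = ∀ {g h} → (∀ i → g i ≡ h i) → f g ≡ f h

  selfMaps : ∀ n → Finite (Vec (Fin n) n)
  selfMaps n = vec (fin n) n

  ∑-perms : ∀ n (f : (Fin n → Fin n) → ℚ) → Extensional f →
    ∑ (perms n) f ≡ sum (selfMaps n) (λ v → χ (injection? (lookup v)) *ℚ f (lookup v))
  ∑-perms n f ext = begin
    ∑ (perms n) f
      ≡⟨ ∑-filter injectiveB (funs (allFin n) n) f ⟩
    ∑ (funs (allFin n) n) (λ g → χᵇ (injectiveB g) *ℚ f g)
      ≡⟨ ∑-cong (funs (allFin n) n) (λ g → cong (_*ℚ f g) (χ-injective g)) ⟩
    ∑ (funs (allFin n) n) (λ g → χ (injection? g) *ℚ f g)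
      ≡⟨ ∑-funs {_∼_ = _≡_} refl (fin n) id (allFin n) (λ _ _ → refl) n _ (λ {g} {h} eq → cong₂ _*ℚ_
           (χ-⇔ (injection? g) (injection? h) (λ i e → i (trans (eq _) (trans e (sym (eq _))))) (λ i e → i (trans (sym (eq _)) (trans e (eq _)))))
           (ext eq)) ⟩
    _ ∎

  anyL-perms : ∀ n {p : (Fin n → Fin n) → Bool} → Extensional p →
    ∀ f → Injection f → p f ≡ true → anyL (perms n) p ≡ true
  anyL-perms n {p} ext f inj eq = anyL-filter injectiveB (funs (allFin n) n) (anyL-funs n
    (λ {g} {h} e → cong₂ _∧_ (bool-ext
      (λ t → injectiveB-complete h (λ e′ → injectiveB-sound g t (trans (e _) (trans e′ (sym (e _))))))
      (λ t → injectiveB-complete g (λ e′ → injectiveB-sound h t (trans (sym (e _)) (trans e′ (e _))))))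
      (ext e))
    f (∧-complete (injectiveB-complete f inj) eq))

  anyL-perms-sound : ∀ n {p : (Fin n → Fin n) → Bool} → anyL (perms n) p ≡ true →
    ∃ λ f → Injection f × p f ≡ true
  anyL-perms-sound n eq with anyL-filter-sound injectiveB (funs (allFin n) n) eq
  ... | f , i , e = f , (λ {_} {_} → injectiveB-sound f i) , e

  weight : ℕ → ℚ
  weight n = frac 1 (length (perms n))

  1≢0 : 1ℚ ≢ 0ℚ
  1≢0 ()

  length-perms>0 : ∀ n → 0 < length (perms n)
  length-perms>0 n with anyL-perms n {λ _ → true} (λ _ → refl) id id refl
  ... | eq with perms n
  ...   | _ ∷ _ = s≤s z≤n

  weight-ι : ∀ n → weight n *ℚ ι (length (perms n)) ≡ 1ℚ
  weight-ι n = frac-ι (length (perms n)) (length-perms>0 n)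

  ι-perms : ∀ n → ι (length (perms n)) ≡ sum (selfMaps n) (λ v → χ (injection? (lookup v)))
  ι-perms n = trans (ι-length (perms n)) (trans (∑-perms n (λ _ → 1ℚ) (λ _ → refl)) (∑-cong (elems (selfMaps n)) (λ v → ℚₚ.*-identityʳ _)))

  surjective : ∀ {m n} (f : Fin m → Fin n) → Injection f → n ≤ m → ∀ y → ∃ λ x → f x ≡ y
  surjective {m} {suc n} f inj n≤m y with Finₚ.any? (λ x → f x Finₚ.≟ y)
  ... | yes p = p
  ... | no ¬p = contradiction (ℕₚ.≤-trans n≤m (Finₚ.injective⇒≤ {f = λ x → punchOut (missed x)}
                  (λ {i} {j} e → inj (Finₚ.punchOut-injective (missed i) (missed j) e)))) ℕₚ.1+n≰n
    where
    missed : ∀ x → y ≢ f x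
    missed x e = ¬p (x , sym e)

  inverse : ∀ {m n} (f : Fin m → Fin n) → Injection f → n ≤ m →
    ∃ λ g → (∀ y → f (g y) ≡ y) × (∀ x → g (f x) ≡ x)
  inverse f inj n≤m = (λ y → proj₁ (surj y)) , (λ y → proj₂ (surj y)) , (λ x → inj (proj₂ (surj (f x))))
    where surj = surjective f inj n≤m

  iter-cong : {π ρ : Fin n → Fin n} → (∀ i → π i ≡ ρ i) → ∀ k i → iter π k i ≡ iter ρ k i
  iter-cong eq zero    i = refl
  iter-cong {ρ = ρ} eq (suc k) i = trans (eq _) (cong ρ (iter-cong eq k i))

  cycLen-cong : {π ρ : Fin n → Fin n} → (∀ i → π i ≡ ρ i) → ∀ i → cycLen π i ≡ cycLen ρ i
  cycLen-cong {suc n} {π} {ρ} eq i = begin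
    cycLen π i ≡⟨ cycLen-suc n π i ⟩
    _ ≡⟨ cong₂ (λ x y → if x ==ᶠ i then 1 else y) (eq i) (go n 2) ⟩
    _ ≡⟨ sym (cycLen-suc n ρ i) ⟩
    cycLen ρ i ∎
    where
    go : ∀ f k → cycGo (suc n) π i f k ≡ cycGo (suc n) ρ i f k
    go zero    k = refl
    go (suc f) k = cong₂ (λ x y → if x ==ᶠ i then k else y) (iter-cong eq k i) (go f (suc k))

  filterᵇ-cong : ∀ (xs : List A) {p q : A → Bool} → (∀ x → p x ≡ q x) → filterᵇ p xs ≡ filterᵇ q xs
  filterᵇ-cong []       eq = refl
  filterᵇ-cong (x ∷ xs) {p} {q} eq with p x | q x | eq x
  ... | true  | true  | refl = cong (x ∷_) (filterᵇ-cong xs eq)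
  ... | false | false | refl = filterᵇ-cong xs eq

  cycType-cong : Extensional (cycType {n})
  cycType-cong {n} eq = Listₚ.map-cong (λ k → cong (λ xs → divN (length xs) k)
    (filterᵇ-cong (allFin n) (λ i → cong (_≡ᵇ k) (cycLen-cong eq i)))) (map suc (upTo n))

  app : Vec (Vec A n) n → Fin n → Fin n → A
  app g i j = lookup (lookup g i) j

  mk : (Fin n → Fin n → A) → Vec (Vec A n) n
  mk G = tabulate (λ i → tabulate (G i))

  app-mk : (G : Fin n → Fin n → A) → ∀ i j → app (mk G) i j ≡ G i j
  app-mk G i j = trans (cong (λ v → lookup v j) (Vecₚ.lookup∘tabulate (λ i → tabulate (G i)) i)) (Vecₚ.lookup∘tabulate (G i) j)

  app-injective : (g h : Vec (Vec A n) n) → (∀ i j → app g i j ≡ app h i j) → g ≡ h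
  app-injective g h eq = lookup-injective g h (λ i → lookup-injective (lookup g i) (lookup h i) (eq i))

  graphs : ∀ n → Finite (Vec (Vec Bool n) n)
  graphs n = vec (vec bool n) n

  infix 4 _≗₂_
  _≗₂_ : Graph n → Graph n → Set
  G ≗₂ H = ∀ i j → G i j ≡ H i j

  ∑-graphs : ∀ n (f : Graph n → ℚ) → (∀ {G H} → G ≗₂ H → f G ≡ f H) →
    ∑ (funs (funs bools n) n) f ≡ sum (graphs n) (f ∘ app)
  ∑-graphs n f ext = ∑-funs {_∼_ = λ g h → ∀ i → g i ≡ h i} (λ i → refl) (vec bool n) lookup (funs bools n)
    (λ f′ ext′ → ∑-funs {_∼_ = _≡_} refl bool id bools (λ _ _ → refl) n f′ ext′) n f ext

  record Simple (G : Graph n) : Set where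
    field
      symmetric   : ∀ i j → G i j ≡ G j i
      irreflexive : ∀ i → G i i ≡ false

  simple-sound : (G : Graph n) → simpleB G ≡ true → Simple G
  simple-sound {n} G eq = record
    { symmetric   = λ i j → eqB-sound (allB-sound n (allB-sound n (proj₁ parts) i) j)
    ; irreflexive = λ i → Boolₚ.¬-not (not-sound (allB-sound n (proj₂ parts) i)) }
    where parts = ∧-sound {allB n λ i → allB n λ j → eqB (G i j) (G j i)} eq

  simple-complete : (G : Graph n) → Simple G → simpleB G ≡ true
  simple-complete {n} G s = ∧-complete
    (allB-complete n (λ i → allB-complete n (λ j → eqB-complete (symmetric i j))))
    (allB-complete n (λ i → cong not (irreflexive i)))
    where open Simple s

  simple-cong : {G H : Graph n} → G ≗₂ H → Simple G → Simple H
  simple-cong eq s = record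
    { symmetric   = λ i j → trans (sym (eq i j)) (trans (symmetric i j) (eq j i))
    ; irreflexive = λ i → trans (sym (eq i i)) (irreflexive i) }
    where open Simple s

  simpleB-cong : {G H : Graph n} → G ≗₂ H → simpleB G ≡ simpleB H
  simpleB-cong {G = G} {H} eq = bool-ext
    (λ t → simple-complete H (simple-cong eq (simple-sound G t)))
    (λ t → simple-complete G (simple-cong (λ i j → sym (eq i j)) (simple-sound H t)))

  simple? : (G : Graph n) → Dec (Simple G)
  simple? G = map′ (simple-sound G) (simple-complete G) (simpleB G Boolₚ.≟ true)

  χ-simple : (G : Graph n) → χᵇ (simpleB G) ≡ χ (simple? G)
  χ-simple G = χᵇ-dec (simpleB G) (simple? G) (simple-sound G) (simple-complete G)

  Iso : (Fin n → Fin n) → RGraph n → RGraph n → Set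
  Iso π (G , r) (H , s) = (∀ i j → H (π i) (π j) ≡ G i j) × mapRoot π r ≡ s

  eqRoot-sound : (r s : Maybe (Fin n)) → eqRoot r s ≡ true → r ≡ s
  eqRoot-sound nothing  nothing  eq = refl
  eqRoot-sound (just r) (just s) eq = cong just (==-sound eq)

  eqRoot-complete : (r s : Maybe (Fin n)) → r ≡ s → eqRoot r s ≡ true
  eqRoot-complete nothing  nothing  refl = refl
  eqRoot-complete (just r) (just s) refl = ==-complete {i = r} refl

  iso-sound : (π : Fin n → Fin n) (X Y : RGraph n) → isoViaB π X Y ≡ true → Iso π X Y
  iso-sound {n} π (G , r) (H , s) eq = let p , q = ∧-sound eq in
    (λ i j → eqB-sound (allB-sound n (allB-sound n p i) j)) , eqRoot-sound (mapRoot π r) s q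

  iso-complete : (π : Fin n → Fin n) (X Y : RGraph n) → Iso π X Y → isoViaB π X Y ≡ true
  iso-complete {n} π (G , r) (H , s) (p , q) =
    ∧-complete (allB-complete n (λ i → allB-complete n (λ j → eqB-complete (p i j)))) (eqRoot-complete (mapRoot π r) s q)

  iso? : (π : Fin n → Fin n) (X Y : RGraph n) → Dec (Iso π X Y)
  iso? π X Y = map′ (iso-sound π X Y) (iso-complete π X Y) (isoViaB π X Y Boolₚ.≟ true)

  χ-iso : (π : Fin n → Fin n) (X Y : RGraph n) → χᵇ (isoViaB π X Y) ≡ χ (iso? π X Y)
  χ-iso π X Y = χᵇ-dec (isoViaB π X Y) (iso? π X Y) (iso-sound π X Y) (iso-complete π X Y)

  mapRoot-cong : {π ρ : Fin n → Fin n} → (∀ i → π i ≡ ρ i) → ∀ r → mapRoot π r ≡ mapRoot ρ r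
  mapRoot-cong eq nothing  = refl
  mapRoot-cong eq (just r) = cong just (eq r)

  iso-cong : {π ρ : Fin n → Fin n} {G G′ H H′ : Graph n} {r s : Maybe (Fin n)} →
    (∀ i → π i ≡ ρ i) → G ≗₂ G′ → H ≗₂ H′ → Iso π (G , r) (H , s) → Iso ρ (G′ , r) (H′ , s)
  iso-cong {ρ = ρ} {H = H} {r = r} eq eqG eqH (p , q) =
    (λ i j → trans (sym (eqH _ _)) (trans (sym (cong₂ H (eq i) (eq j))) (trans (p i j) (eqG i j)))) ,
    trans (sym (mapRoot-cong eq r)) q

  isoViaB-cong : {π ρ : Fin n → Fin n} {G G′ H H′ : Graph n} {r s : Maybe (Fin n)} →
    (∀ i → π i ≡ ρ i) → G ≗₂ G′ → H ≗₂ H′ → isoViaB π (G , r) (H , s) ≡ isoViaB ρ (G′ , r) (H′ , s)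
  isoViaB-cong {π = π} {ρ} {G} {G′} {H} {H′} {r} {s} eq eqG eqH = bool-ext
    (λ t → iso-complete ρ (G′ , r) (H′ , s) (iso-cong {H = H} eq eqG eqH (iso-sound π (G , r) (H , s) t)))
    (λ t → iso-complete π (G , r) (H , s) (iso-cong {H = H′} (sym ∘ eq) (λ i j → sym (eqG i j)) (λ i j → sym (eqH i j)) (iso-sound ρ (G′ , r) (H′ , s) t)))

  mapRoot-∘ : (π ρ : Fin n → Fin n) → ∀ r → mapRoot (π ∘ ρ) r ≡ mapRoot π (mapRoot ρ r)
  mapRoot-∘ π ρ nothing  = refl
  mapRoot-∘ π ρ (just r) = refl

  mapRoot-id : (r : Maybe (Fin n)) → mapRoot id r ≡ r
  mapRoot-id nothing  = refl
  mapRoot-id (just r) = refl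

  autSum : RGraph n → ((Fin n → Fin n) → ℚ) → ℚ
  autSum {n} X f = sum (selfMaps n) (λ v → χ (injection? (lookup v)) *ℚ (χ (iso? (lookup v) X X) *ℚ f (lookup v)))

  ∑-isos : (X Y : RGraph n) (f : (Fin n → Fin n) → ℚ) → Extensional f →
    ∑ (perms n) (λ π → χᵇ (isoViaB π X Y) *ℚ f π) ≡
    sum (selfMaps n) (λ v → χ (injection? (lookup v)) *ℚ (χ (iso? (lookup v) X Y) *ℚ f (lookup v)))
  ∑-isos {n} X Y f ext = trans
    (∑-perms n _ (λ e → cong₂ _*ℚ_ (cong χᵇ (isoViaB-cong {H = proj₁ Y} {r = proj₂ X} {proj₂ Y} e (λ _ _ → refl) (λ _ _ → refl))) (ext e)))
    (∑-cong (elems (selfMaps n)) (λ v → cong (λ z → χ (injection? (lookup v)) *ℚ (z *ℚ f (lookup v))) (χ-iso (lookup v) X Y)))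

  ∑-auts : (X : RGraph n) (f : (Fin n → Fin n) → ℚ) → Extensional f → ∑ (auts X) f ≡ autSum X f
  ∑-auts {n} X f ext = trans (∑-filter (λ π → isoViaB π X X) (perms n) f) (∑-isos X X f ext)

  χ-×₂ : ∀ {P Q : Set} (d : Dec P) (e : Dec Q) x → χ d *ℚ (χ e *ℚ x) ≡ χ (d ×-dec e) *ℚ x
  χ-×₂ d e x = trans (sym (ℚₚ.*-assoc (χ d) (χ e) x)) (cong (_*ℚ x) (sym (χ-× d e)))

  isoCount : (X Y : RGraph n) → ℚ
  isoCount {n} X Y = sum (selfMaps n) (λ v → χ (injection? (lookup v)) *ℚ (χ (iso? (lookup v) X Y) *ℚ 1ℚ))

  isos-torsor : (X Y : RGraph n) (π : Fin n → Fin n) → Injection π → Iso π X Y → isoCount X X ≡ isoCount X Y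
  isos-torsor {n} X@(G , r) Y@(H , s) π inj (pres , root) = trans
    (∑-cong (elems (selfMaps n)) (λ v → χ-×₂ (injection? (lookup v)) (iso? (lookup v) X X) 1ℚ))
    (trans (bijection (selfMaps n) (selfMaps n)
      (λ v → injection? (lookup v) ×-dec iso? (lookup v) X X) (λ v → injection? (lookup v) ×-dec iso? (lookup v) X Y)
      (λ v w → ∀ i → lookup w i ≡ π (lookup v i))
      (λ { v (i , (p , q)) → tabulate (π ∘ lookup v) ,
          (((λ e → i (inj (trans (sym (Vecₚ.lookup∘tabulate (π ∘ lookup v) _)) (trans e (Vecₚ.lookup∘tabulate (π ∘ lookup v) _))))) ,
           iso-cong {π = π ∘ lookup v} {H = H} (λ i → sym (Vecₚ.lookup∘tabulate (π ∘ lookup v) i)) (λ _ _ → refl) (λ _ _ → refl)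
             ((λ i j → trans (pres _ _) (p i j)) , trans (mapRoot-∘ π (lookup v) r) (trans (cong (mapRoot π) q) root))) ,
           Vecₚ.lookup∘tabulate (π ∘ lookup v)) })
      (λ { w (i , (p , q)) → tabulate (π⁻¹ ∘ lookup w) ,
          (((λ e → i (trans (sym (ππ⁻¹ _)) (trans (cong π (trans (sym (Vecₚ.lookup∘tabulate (π⁻¹ ∘ lookup w) _)) (trans e (Vecₚ.lookup∘tabulate (π⁻¹ ∘ lookup w) _)))) (ππ⁻¹ _)))) ,
           iso-cong {π = π⁻¹ ∘ lookup w} {H = G} (λ i → sym (Vecₚ.lookup∘tabulate (π⁻¹ ∘ lookup w) i)) (λ _ _ → refl) (λ _ _ → refl)
             ((λ i j → trans (sym (pres _ _)) (trans (cong₂ H (ππ⁻¹ _) (ππ⁻¹ _)) (p i j))) ,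
               trans (mapRoot-∘ π⁻¹ (lookup w) r) (trans (cong (mapRoot π⁻¹) (trans q (sym root))) (trans (sym (mapRoot-∘ π⁻¹ π r)) (trans (mapRoot-cong π⁻¹π r) (mapRoot-id r)))))) ,
           (λ i → sym (trans (cong π (Vecₚ.lookup∘tabulate (π⁻¹ ∘ lookup w) i)) (ππ⁻¹ _)))) })
      (λ _ _ _ e e′ → lookup-injective _ _ (λ i → trans (e i) (sym (e′ i))))
      (λ _ _ _ e e′ → lookup-injective _ _ (λ i → inj (trans (sym (e i)) (e′ i))))
      (λ _ → 1ℚ) (λ _ → 1ℚ) (λ _ _ _ → refl))
    (sym (∑-cong (elems (selfMaps n)) (λ v → χ-×₂ (injection? (lookup v)) (iso? (lookup v) X Y) 1ℚ))))
    where
    inv = inverse π inj ℕₚ.≤-refl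
    π⁻¹ = proj₁ inv
    ππ⁻¹ = proj₁ (proj₂ inv)
    π⁻¹π = proj₂ (proj₂ inv)

  rooted : ∀ n → Finite (Maybe (Fin n))
  rooted n = maybe (fin n)

  ∑-objs : ∀ n (f : RGraph n → ℚ) → (∀ {G H} r → G ≗₂ H → f (G , r) ≡ f (H , r)) →
    ∑ (objs n) f ≡ sum (graphs n) (λ g → χ (simple? (app g)) *ℚ sum (rooted n) (λ r → f (app g , r)))
  ∑-objs n f ext = begin
    ∑ (objs n) f
      ≡⟨ ∑-concatMap _ (filterᵇ simpleB (funs (funs bools n) n)) f ⟩
    _ ≡⟨ ∑-cong (filterᵇ simpleB (funs (funs bools n) n)) (λ G → ∑-map (G ,_) (elems (rooted n)) f) ⟩
    _ ≡⟨ ∑-filter simpleB (funs (funs bools n) n) _ ⟩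
    _ ≡⟨ ∑-graphs n _ (λ e → cong₂ _*ℚ_ (cong χᵇ (simpleB-cong e)) (∑-cong (elems (rooted n)) (λ r → ext r e))) ⟩
    _ ≡⟨ ∑-cong (elems (graphs n)) (λ g → cong (_*ℚ sum (rooted n) (λ r → f (app g , r))) (χ-simple (app g))) ⟩
    _ ∎

  ∑-objs-guard : ∀ n {f g : RGraph n → ℚ} → (∀ G r → Simple G → f (G , r) ≡ g (G , r)) → ∑ (objs n) f ≡ ∑ (objs n) g
  ∑-objs-guard n {f} {g} eq = begin
    ∑ (objs n) f
      ≡⟨ unfold f ⟩
    _ ≡⟨ ∑-cong (funs (funs bools n) n) (λ G → trans (cong (_*ℚ sum (rooted n) (λ r → f (G , r))) (χ-simple G))
           (trans (χ-guard (simple? G) (λ s → ∑-cong (elems (rooted n)) (λ r → eq G r s)))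
             (cong (_*ℚ sum (rooted n) (λ r → g (G , r))) (sym (χ-simple G))))) ⟩
    _ ≡⟨ sym (unfold g) ⟩
    ∑ (objs n) g ∎
    where
    unfold : ∀ f → ∑ (objs n) f ≡ ∑ (funs (funs bools n) n) (λ G → χᵇ (simpleB G) *ℚ sum (rooted n) (λ r → f (G , r)))
    unfold f = trans (∑-concatMap _ (filterᵇ simpleB (funs (funs bools n) n)) f)
      (trans (∑-cong (filterᵇ simpleB (funs (funs bools n) n)) (λ G → ∑-map (G ,_) (elems (rooted n)) f))
        (∑-filter simpleB (funs (funs bools n) n) _))

  copies-via : (G : Graph n) (r : Maybe (Fin n)) → Simple G → (π : Fin n → Fin n) → Injection π →
    ∑ (objs n) (λ Y → χᵇ (isoViaB π (G , r) Y)) ≡ 1ℚ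
  copies-via {n} G r s π inj = begin
    ∑ (objs n) (λ Y → χᵇ (isoViaB π (G , r) Y))
      ≡⟨ ∑-objs n _ (λ { {H} {H′} r′ e → cong χᵇ (isoViaB-cong {H = H} {H′} {r} {r′} (λ _ → refl) (λ _ _ → refl) e) }) ⟩
    sum (graphs n) (λ g → χ (simple? (app g)) *ℚ sum (rooted n) (λ r′ → χᵇ (isoViaB π (G , r) (app g , r′))))
      ≡⟨ ∑-cong (elems (graphs n)) (λ g → trans (sym (∑-*ˡ (elems (rooted n)) (χ (simple? (app g))) _))
           (∑-cong (elems (rooted n)) (λ r′ → trans (cong (χ (simple? (app g)) *ℚ_) (χ-iso π (G , r) (app g , r′)))
             (sym (χ-× (simple? (app g)) (iso? π (G , r) (app g , r′))))))) ⟩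
    sum (graphs n) (λ g → sum (rooted n) (λ r′ → χ (simple? (app g) ×-dec iso? π (G , r) (app g , r′))))
      ≡⟨ sym (sum-⊗ (graphs n) (rooted n) _) ⟩
    sum (graphs n ⊗ rooted n) (λ (g , r′) → χ (simple? (app g) ×-dec iso? π (G , r) (app g , r′)))
      ≡⟨ unique1 (graphs n ⊗ rooted n) (λ (g , r′) → simple? (app g) ×-dec iso? π (G , r) (app g , r′)) (mk image , mapRoot π r)
           (simple-cong (λ i j → sym (app-mk image i j)) image-simple , ((λ i j → trans (app-mk image (π i) (π j)) (cong₂ G (π⁻¹π i) (π⁻¹π j))) , refl))
           (λ { (g , r′) (_ , (p , q)) → cong₂ _,_ (app-injective g (mk image) (λ i j →
              trans (cong₂ (app g) (sym (ππ⁻¹ i)) (sym (ππ⁻¹ j))) (trans (p _ _) (sym (app-mk image i j))))) (sym q) }) ⟩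
    1ℚ ∎
    where
    inv = inverse π inj ℕₚ.≤-refl
    π⁻¹ = proj₁ inv
    ππ⁻¹ = proj₁ (proj₂ inv)
    π⁻¹π = proj₂ (proj₂ inv)
    image : Graph n
    image i j = G (π⁻¹ i) (π⁻¹ j)
    image-simple : Simple image
    image-simple = record { symmetric = λ i j → Simple.symmetric s _ _ ; irreflexive = λ i → Simple.irreflexive s _ }

  anyL-false : (xs : List A) {p : A → Bool} → anyL xs p ≡ false → (f : A → ℚ) → ∑ xs (λ x → χᵇ (p x) *ℚ f x) ≡ 0ℚ
  anyL-false []       eq f = refl
  anyL-false (x ∷ xs) {p} eq f with p x
  ... | false = trans (cong₂ _+ℚ_ (ℚₚ.*-zeroˡ (f x)) (anyL-false xs eq f)) (ℚₚ.+-identityʳ 0ℚ)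

  ι-auts : (X : RGraph n) → ι (length (auts X)) ≡ isoCount X X
  ι-auts X = trans (ι-length (auts X)) (∑-auts X (λ _ → 1ℚ) (λ _ → refl))

  isos-count : (X Y : RGraph n) → χᵇ (isoB X Y) *ℚ ι (length (auts X)) ≡ ∑ (perms n) (λ π → χᵇ (isoViaB π X Y) *ℚ 1ℚ)
  isos-count {n} X Y with isoB X Y in eq
  ... | false = trans (ℚₚ.*-zeroˡ (ι (length (auts X)))) (sym (anyL-false (perms n) eq (λ _ → 1ℚ)))
  ... | true with anyL-perms-sound n eq
  ...   | π , inj , e = trans (ℚₚ.*-identityˡ _) (trans (ι-auts X) (trans (isos-torsor X Y π (λ {_} {_} → inj) (iso-sound π X Y e)) (sym (∑-isos X Y (λ _ → 1ℚ) (λ _ → refl)))))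

  orbit-stabilizer : (G : Graph n) (r : Maybe (Fin n)) → Simple G →
    ι (classSize (G , r)) *ℚ ι (length (auts (G , r))) ≡ ι (length (perms n))
  orbit-stabilizer {n} G r s = begin
    ι (classSize X) *ℚ a
      ≡⟨ cong (_*ℚ a) (trans (ι-length (filterᵇ (isoB X) (objs n))) (∑-filter (isoB X) (objs n) (λ _ → 1ℚ))) ⟩
    ∑ (objs n) (λ Y → χᵇ (isoB X Y) *ℚ 1ℚ) *ℚ a
      ≡⟨ sym (∑-*ʳ (objs n) a _) ⟩
    ∑ (objs n) (λ Y → (χᵇ (isoB X Y) *ℚ 1ℚ) *ℚ a)
      ≡⟨ ∑-cong (objs n) (λ Y → trans (cong (_*ℚ a) (ℚₚ.*-identityʳ (χᵇ (isoB X Y)))) (isos-count X Y)) ⟩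
    ∑ (objs n) (λ Y → ∑ (perms n) (λ π → χᵇ (isoViaB π X Y) *ℚ 1ℚ))
      ≡⟨ ∑-swap (objs n) (perms n) _ ⟩
    ∑ (perms n) (λ π → ∑ (objs n) (λ Y → χᵇ (isoViaB π X Y) *ℚ 1ℚ))
      ≡⟨ ∑-perms n _ (λ e → ∑-cong (objs n) (λ Y → cong (λ b → χᵇ b *ℚ 1ℚ) (isoViaB-cong {H = proj₁ Y} {r = proj₂ X} {proj₂ Y} e (λ _ _ → refl) (λ _ _ → refl)))) ⟩
    sum (selfMaps n) (λ v → χ (injection? (lookup v)) *ℚ ∑ (objs n) (λ Y → χᵇ (isoViaB (lookup v) X Y) *ℚ 1ℚ))
      ≡⟨ ∑-cong (elems (selfMaps n)) (λ v → trans (χ-guard (injection? (lookup v)) (λ inj →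
           trans (∑-cong (objs n) (λ Y → ℚₚ.*-identityʳ _)) (copies-via G r s (lookup v) (λ {_} {_} → inj)))) (ℚₚ.*-identityʳ _)) ⟩
    sum (selfMaps n) (λ v → χ (injection? (lookup v)))
      ≡⟨ sym (ι-perms n) ⟩
    ι (length (perms n)) ∎
    where
    X : RGraph n
    X = G , r
    a : ℚ
    a = ι (length (auts X))

  orbit-weight : (G : Graph n) (r : Maybe (Fin n)) → Simple G →
    frac 1 (classSize (G , r)) *ℚ frac 1 (length (auts (G , r))) ≡ weight n
  orbit-weight {n} G r s = go (classSize (G , r)) (length (auts (G , r))) (orbit-stabilizer G r s)
    where
    absurd : ∀ {A : Set} → 0ℚ ≡ ι (length (perms n)) → A
    absurd e = contradiction (trans (sym (weight-ι n)) (trans (cong (weight n *ℚ_) (sym e)) (ℚₚ.*-zeroʳ (weight n)))) 1≢0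
    go : ∀ c a → ι c *ℚ ι a ≡ ι (length (perms n)) → frac 1 c *ℚ frac 1 a ≡ weight n
    go zero    a       e = absurd (trans (sym (ℚₚ.*-zeroˡ (ι a))) e)
    go (suc c) zero    e = absurd (trans (sym (ℚₚ.*-zeroʳ (ι (suc c)))) e)
    go (suc c) (suc a) e = begin
      x *ℚ y                                   ≡⟨ sym (ℚₚ.*-identityʳ _) ⟩
      (x *ℚ y) *ℚ 1ℚ                           ≡⟨ cong ((x *ℚ y) *ℚ_) (sym (trans (cong (weight n *ℚ_) e) (weight-ι n))) ⟩
      (x *ℚ y) *ℚ (weight n *ℚ (p *ℚ q))       ≡⟨ swap*ˡ (x *ℚ y) (weight n) (p *ℚ q) ⟩
      weight n *ℚ ((x *ℚ y) *ℚ (p *ℚ q))       ≡⟨ cong (weight n *ℚ_) (trans (ℚₚ.*-assoc x y _) (trans (cong (x *ℚ_) (swap*ˡ y p q)) (sym (ℚₚ.*-assoc x p _)))) ⟩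
      weight n *ℚ ((x *ℚ p) *ℚ (y *ℚ q))       ≡⟨ cong (weight n *ℚ_) (cong₂ _*ℚ_ (frac-ι (suc c) (s≤s z≤n)) (frac-ι (suc a) (s≤s z≤n))) ⟩
      weight n *ℚ (1ℚ *ℚ 1ℚ)                   ≡⟨ ℚₚ.*-identityʳ (weight n) ⟩
      weight n                                 ∎
      where
      x = frac 1 (suc c)
      y = frac 1 (suc a)
      p = ι (suc c)
      q = ι (suc a)

  classSum : Class → ∀ n → ((Fin n → Fin n) → ℚ) → ℚ
  classSum K n f = sum (graphs n) (λ g → χ (simple? (app g)) *ℚ
    sum (rooted n) (λ r → χᵇ (K n (app g , r)) *ℚ autSum (app g , r) f))

  ⟪⟫-classTerms : (K : Class) → (∀ {G H} r → G ≗₂ H → K n (G , r) ≡ K n (H , r)) → ∀ φ →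
    ⟪ classTerms K n , φ ⟫ ≡ weight n *ℚ classSum K n (φ ∘ cycType)
  ⟪⟫-classTerms {n} K ext φ = begin
    ⟪ classTerms K n , φ ⟫
      ≡⟨ ∑-concatMap _ (objs n) _ ⟩
    ∑ (objs n) (λ X → ⟪ (if K n X then scaleP (frac 1 (classSize X)) (cycIndex X) else []) , φ ⟫)
      ≡⟨ ∑-objs-guard n (λ G r s → term (G , r) (orbit-weight G r s)) ⟩
    ∑ (objs n) (λ X → weight n *ℚ (χᵇ (K n X) *ℚ ∑ (auts X) (φ ∘ cycType)))
      ≡⟨ ∑-*ˡ (objs n) (weight n) _ ⟩
    weight n *ℚ ∑ (objs n) (λ X → χᵇ (K n X) *ℚ ∑ (auts X) (φ ∘ cycType))
      ≡⟨ cong (weight n *ℚ_) (trans (∑-objs n _ (λ {G} {H} r e → cong₂ _*ℚ_ (cong χᵇ (ext r e))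
           (cong (λ xs → ∑ xs (φ ∘ cycType)) (filterᵇ-cong (perms n) (λ π → isoViaB-cong {G = G} {H} {G} {H} {r} (λ _ → refl) e e)))))
         (∑-cong (elems (graphs n)) (λ g → cong (χ (simple? (app g)) *ℚ_) (∑-cong (elems (rooted n)) (λ r →
           cong (χᵇ (K n (app g , r)) *ℚ_) (∑-auts (app g , r) _ (λ e → cong φ (cycType-cong e)))))))) ⟩
    weight n *ℚ classSum K n (φ ∘ cycType) ∎
    where
    term : ∀ X → frac 1 (classSize X) *ℚ frac 1 (length (auts X)) ≡ weight n →
      ⟪ (if K n X then scaleP (frac 1 (classSize X)) (cycIndex X) else []) , φ ⟫ ≡ weight n *ℚ (χᵇ (K n X) *ℚ ∑ (auts X) (φ ∘ cycType))
    term X w with K n X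
    ... | false = sym (trans (cong (weight n *ℚ_) (ℚₚ.*-zeroˡ (∑ (auts X) (φ ∘ cycType)))) (ℚₚ.*-zeroʳ (weight n)))
    ... | true  = begin
      ⟪ scaleP (frac 1 (classSize X)) (cycIndex X) , φ ⟫
        ≡⟨ ⟪⟫-scaleP (frac 1 (classSize X)) (cycIndex X) φ ⟩
      frac 1 (classSize X) *ℚ ⟪ cycIndex X , φ ⟫
        ≡⟨ cong (frac 1 (classSize X) *ℚ_) (trans (∑-map _ (auts X) _) (∑-*ˡ (auts X) (frac 1 (length (auts X))) _)) ⟩
      frac 1 (classSize X) *ℚ (frac 1 (length (auts X)) *ℚ ∑ (auts X) (φ ∘ cycType))
        ≡⟨ sym (ℚₚ.*-assoc (frac 1 (classSize X)) _ _) ⟩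
      (frac 1 (classSize X) *ℚ frac 1 (length (auts X))) *ℚ ∑ (auts X) (φ ∘ cycType)
        ≡⟨ cong₂ _*ℚ_ w (sym (ℚₚ.*-identityˡ _)) ⟩
      weight n *ℚ (1ℚ *ℚ ∑ (auts X) (φ ∘ cycType)) ∎

open Isomorphisms

module GraphProperties where

  open import Data.Nat using (_≤_; _<_; s≤s; z≤n; _+_; _≡ᵇ_; _<ᵇ_)

  private variable
    n : ℕ

  count : ∀ n → (Fin n → Bool) → ℕ
  count zero    p = 0
  count (suc n) p = (if p zero then 1 else 0) + count n (p ∘ suc)

  count-cong : ∀ n {p q : Fin n → Bool} → (∀ i → p i ≡ q i) → count n p ≡ count n q
  count-cong zero    eq = refl
  count-cong (suc n) eq = cong₂ _+_ (cong (if_then 1 else 0) (eq zero)) (count-cong n (eq ∘ suc))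

  record Enumeration {n} (p : Fin n → Bool) (c : ℕ) : Set where
    field
      at        : Fin c → Fin n
      injective : Injection at
      sound     : ∀ i → p (at i) ≡ true
      complete  : ∀ x → p x ≡ true → ∃ λ i → at i ≡ x

  enumeration : ∀ n (p : Fin n → Bool) → Enumeration p (count n p)
  enumeration zero    p = record { at = λ () ; injective = λ {} ; sound = λ () ; complete = λ () }
  enumeration (suc n) p with p zero in eq | enumeration n (p ∘ suc)
  ... | false | e = record
    { at        = suc ∘ e.at
    ; injective = e.injective ∘ Finₚ.suc-injective
    ; sound     = e.sound
    ; complete  = λ { zero    pz → contradiction (trans (sym eq) pz) λ ()
                    ; (suc x) px → let i , e = e.complete x px in i , cong suc e } }
    where module e = Enumeration e
  ... | true | e = record
    { at        = λ { zero → zero ; (suc i) → suc (e.at i) }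
    ; injective = λ { {zero} {zero} _ → refl ; {suc i} {suc j} x → cong suc (e.injective (Finₚ.suc-injective x)) }
    ; sound     = λ { zero → eq ; (suc i) → e.sound i }
    ; complete  = λ { zero _ → zero , refl ; (suc x) px → let i , e = e.complete x px in suc i , cong suc e } }
    where module e = Enumeration e

  count-≤ : ∀ {m n} {p : Fin m → Bool} {q : Fin n → Bool} (f : Fin m → Fin n) →
    (∀ x → p x ≡ true → q (f x) ≡ true) → (∀ {x y} → p x ≡ true → p y ≡ true → f x ≡ f y → x ≡ y) →
    count m p ≤ count n q
  count-≤ {m} {n} {p} {q} f pq inj = Finₚ.injective⇒≤ {f = proj₁ ∘ target} (λ {i} {j} e → P.injective (inj (P.sound i) (P.sound j)
      (trans (sym (proj₂ (target i))) (trans (cong Q.at e) (proj₂ (target j))))))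
    where
    module P = Enumeration (enumeration m p)
    module Q = Enumeration (enumeration n q)
    target : ∀ i → ∃ λ j → Q.at j ≡ f (P.at i)
    target i = Q.complete (f (P.at i)) (pq _ (P.sound i))

  count-true : ∀ n → count n (λ _ → true) ≡ n
  count-true zero    = refl
  count-true (suc n) = cong suc (count-true n)

  count-false : ∀ n {p : Fin n → Bool} → (∀ i → p i ≡ false) → count n p ≡ 0
  count-false zero    eq = refl
  count-false (suc n) eq rewrite eq zero = count-false n (eq ∘ suc)

  count-enumerated : ∀ {n c} {p : Fin n → Bool} → Enumeration p c → count n p ≡ c
  count-enumerated {n} {c} {p} e = ℕₚ.≤-antisym
    (Finₚ.injective⇒≤ {f = proj₁ ∘ index} (λ {i} {j} eq → P.injective (trans (sym (proj₂ (index i))) (trans (cong at eq) (proj₂ (index j))))))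
    (subst (_≤ count n p) (count-true c) (count-≤ {p = λ _ → true} {q = p} at (λ i _ → sound i) (λ _ _ → injective)))
    where
    open Enumeration e
    module P = Enumeration (enumeration n p)
    index : ∀ i → ∃ λ j → at j ≡ P.at i
    index i = complete (P.at i) (P.sound i)

  count-⊂ : ∀ n {p q : Fin n → Bool} → (∀ x → p x ≡ true → q x ≡ true) → (∃ λ x → p x ≡ false × q x ≡ true) → count n p < count n q
  count-⊂ (suc n) {p} {q} sub (zero  , px , qx) rewrite px | qx = s≤s (count-≤ {p = p ∘ suc} {q ∘ suc} id (sub ∘ suc) (λ _ _ e → e))
  count-⊂ (suc n) {p} {q} sub (suc x , px , qx) = ℕₚ.+-mono-≤-< (mono (sub zero)) (count-⊂ n (sub ∘ suc) (x , px , qx))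
    where
    mono : ∀ {a b} → (a ≡ true → b ≡ true) → (if a then 1 else 0) ≤ (if b then 1 else 0)
    mono {false} f = z≤n
    mono {true}  f rewrite f refl = s≤s z≤n

  -- Connectivity

  Step : (Fin n → Bool) → Graph n → Fin n → Fin n → Set
  Step S G x y = S x ≡ true × S y ≡ true × G x y ≡ true

  Path : (Fin n → Bool) → Graph n → Fin n → Fin n → Set
  Path S G = Star (Step S G)

  module _ (S : Fin n → Bool) (G : Graph n) (u : Fin n) where

    reachIn-suc : ∀ k v → reachIn S G u (suc k) v ≡ true →
      reachIn S G u k v ≡ true ⊎ (∃ λ w → reachIn S G u k w ≡ true × S v ≡ true × G w v ≡ true)
    reachIn-suc k v eq with ∨-sound {reachIn S G u k v} eq
    ... | inj₁ h = inj₁ h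
    ... | inj₂ h = let w , e = anyL-sound (allFin n) h
                       a , b = ∧-sound {reachIn S G u k w} e
                       c , d = ∧-sound {S v} b in inj₂ (w , a , c , d)

    reachIn-mono : ∀ k v → reachIn S G u k v ≡ true → reachIn S G u (suc k) v ≡ true
    reachIn-mono k v eq = ∨-completeˡ eq

    reachIn-step : ∀ k w v → reachIn S G u k w ≡ true → S v ≡ true → G w v ≡ true → reachIn S G u (suc k) v ≡ true
    reachIn-step k w v r s g = ∨-completeʳ {reachIn S G u k v} (anyB-complete n w (∧-complete r (∧-complete s g)))

    reachIn-mono-≤ : ∀ j k v → j ≤ k → reachIn S G u j v ≡ true → reachIn S G u k v ≡ true
    reachIn-mono-≤ j k v j≤k r = go (ℕₚ.≤⇒≤′ j≤k) r
      where
      go : ∀ {k} → j ℕ.≤′ k → reachIn S G u j v ≡ true → reachIn S G u k v ≡ true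
      go (ℕ.≤′-reflexive refl) r = r
      go (ℕ.≤′-step {k} le)    r = reachIn-mono k v (go le r)

    reachIn-sound : ∀ k v → reachIn S G u k v ≡ true → S u ≡ true × S v ≡ true × Path S G u v
    reachIn-sound zero    v eq with ∧-sound {S u} eq
    ... | su , e with refl ← ==-sound {i = u} {v} e = su , su , ε
    reachIn-sound (suc k) v eq with reachIn-suc k v eq
    ... | inj₁ r = reachIn-sound k v r
    ... | inj₂ (w , r , sv , g) = let su , sw , path = reachIn-sound k w r in su , sv , path ◅◅ ((sw , sv , g) ◅ ε)

    private
      Stable : ℕ → Set
      Stable k = ∀ v → reachIn S G u (suc k) v ≡ true → reachIn S G u k v ≡ true

      stable? : ∀ k → Dec (Stable k)
      stable? k = Finₚ.all? (λ v → (reachIn S G u (suc k) v Boolₚ.≟ true) →-dec (reachIn S G u k v Boolₚ.≟ true))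

      fresh : ∀ k → ¬ Stable k → ∃ λ v → reachIn S G u (suc k) v ≡ true × ¬ (reachIn S G u k v ≡ true)
      fresh k ¬st with Finₚ.¬∀⟶∃¬ n _ (λ v → (reachIn S G u (suc k) v Boolₚ.≟ true) →-dec (reachIn S G u k v Boolₚ.≟ true)) ¬st
      ... | v , ne with reachIn S G u (suc k) v Boolₚ.≟ true
      ...   | yes r = v , r , λ h → ne (λ _ → h)
      ...   | no ¬r = contradiction (λ r → contradiction r ¬r) ne

    -- Otherwise each of the n stages reaches a new vertex: n + 1 distinct vertices with u.
    reachIn-stabilises : S u ≡ true → ∃ λ k → k ≤ n × Stable k
    reachIn-stabilises su with Finₚ.any? {n} (λ k → stable? (toℕ k))
    ... | yes (k , st) = toℕ k , ℕₚ.<⇒≤ (Finₚ.toℕ<n k) , st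
    ... | no ¬st = let i , j , i<j , e = Finₚ.pigeonhole (ℕₚ.n<1+n n) vertex in contradiction e (late i j i<j)
      where
      new : (k : Fin n) → ∃ λ v → reachIn S G u (suc (toℕ k)) v ≡ true × ¬ (reachIn S G u (toℕ k) v ≡ true)
      new k = fresh (toℕ k) (λ st → ¬st (k , st))
      vertex : Fin (suc n) → Fin n
      vertex zero    = u
      vertex (suc k) = proj₁ (new k)
      reached : ∀ i j → toℕ i ≤ j → reachIn S G u j (vertex i) ≡ true
      reached zero    j le = reachIn-mono-≤ 0 j u z≤n (∧-complete su (==-complete {i = u} refl))
      reached (suc k) j le = reachIn-mono-≤ (suc (toℕ k)) j _ le (proj₁ (proj₂ (new k)))
      late : ∀ i j → toℕ i < toℕ j → vertex i ≢ vertex j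
      late i (suc j) i<j e = proj₂ (proj₂ (new j)) (subst (λ v → reachIn S G u (toℕ j) v ≡ true) e (reached i (toℕ j) (ℕₚ.≤-pred i<j)))

    reachIn-complete : ∀ v → S u ≡ true → Path S G u v → reachIn S G u n v ≡ true
    reachIn-complete v su path with reachIn-stabilises su
    ... | k , k≤n , st = reachIn-mono-≤ k n v k≤n (go path (reachIn-mono-≤ 0 k u z≤n (∧-complete su (==-complete {i = u} refl))))
      where
      go : ∀ {x} → Path S G x v → reachIn S G u k x ≡ true → reachIn S G u k v ≡ true
      go ε                  r = r
      go ((_ , sy , g) ◅ p) r = go p (st _ (reachIn-step k _ _ r sy g))

  ConnectedOn : (Fin n → Bool) → Graph n → Set
  ConnectedOn S G = ∀ u v → S u ≡ true → S v ≡ true → Path S G u v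

  connectedOn-sound : (S : Fin n → Bool) (G : Graph n) → connectedOn S G ≡ true → ConnectedOn S G
  connectedOn-sound {n} S G eq u v su sv =
    proj₂ (proj₂ (reachIn-sound S G u n v (⇒-sound {S u ∧ S v} (allB-sound n (allB-sound n eq u) v) (∧-complete su sv))))

  connectedOn-complete : (S : Fin n → Bool) (G : Graph n) → ConnectedOn S G → connectedOn S G ≡ true
  connectedOn-complete {n} S G conn = allB-complete n (λ u → allB-complete n (λ v →
    ⇒-complete {S u ∧ S v} (λ s → let su , sv = ∧-sound {S u} s in reachIn-complete S G u v su (conn u v su sv))))

  connectedOn? : (S : Fin n → Bool) (G : Graph n) → Dec (ConnectedOn S G)
  connectedOn? S G = map′ (connectedOn-sound S G) (connectedOn-complete S G) (connectedOn S G Boolₚ.≟ true)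

  everything : Fin n → Bool
  everything _ = true

  Connected : Graph n → Set
  Connected G = ConnectedOn everything G

  others : Fin n → Fin n → Bool
  others v u = not (u ==ᶠ v)

  others-sound : (v u : Fin n) → others v u ≡ true → u ≢ v
  others-sound v u eq e = not-sound eq (==-complete e)

  others-complete : (v u : Fin n) → u ≢ v → others v u ≡ true
  others-complete v u ne = not-complete (ne ∘ ==-sound)

  -- Outerplanarity

  NoCrossing : (Fin n → ℕ) → Graph n → Set
  NoCrossing κ G = ∀ a b c d → G a b ≡ true → G c d ≡ true → κ a < κ c → κ c < κ b → κ b < κ d → Data.Empty.⊥

  -- Outerplanarity with an arbitrary injective key instead of positions 0, …, n − 1.
  record Outerplanar (G : Graph n) : Set where
    constructor outer
    field
      key       : Fin n → ℕ
      injective : ∀ {i j} → key i ≡ key j → i ≡ j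
      noCross   : NoCrossing key G

  <ᵇ-sound : ∀ a b → (a <ᵇ b) ≡ true → a < b
  <ᵇ-sound a b eq = ℕₚ.<ᵇ⇒< a b (subst Data.Bool.T (sym eq) _)

  <ᵇ-complete : ∀ a b → a < b → (a <ᵇ b) ≡ true
  <ᵇ-complete a b lt with a <ᵇ b | ℕₚ.<⇒<ᵇ lt
  ... | true | _ = refl

  noCrossB-sound : (p : Fin n → Fin n) (G : Graph n) → noCrossB p G ≡ true → NoCrossing (toℕ ∘ p) G
  noCrossB-sound {n} p G eq a b c d gab gcd l₁ l₂ l₃ =
    not-sound (allB-sound n (allB-sound n (allB-sound n (allB-sound n eq a) b) c) d)
      (∧-complete gab (∧-complete gcd (∧-complete (<ᵇ-complete _ _ l₁) (∧-complete (<ᵇ-complete _ _ l₂) (<ᵇ-complete _ _ l₃)))))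

  noCrossB-complete : (p : Fin n → Fin n) (G : Graph n) → NoCrossing (toℕ ∘ p) G → noCrossB p G ≡ true
  noCrossB-complete {n} p G nc = allB-complete n (λ a → allB-complete n (λ b → allB-complete n (λ c → allB-complete n (λ d →
    not-complete (λ e → let e₁ , e = ∧-sound {G a b} e
                            e₂ , e = ∧-sound {G c d} e
                            e₃ , e = ∧-sound {toℕ (p a) <ᵇ toℕ (p c)} e
                            e₄ , e₅ = ∧-sound {toℕ (p c) <ᵇ toℕ (p b)} e in
      nc a b c d e₁ e₂ (<ᵇ-sound _ _ e₃) (<ᵇ-sound _ _ e₄) (<ᵇ-sound _ _ e₅))))))

  outerplanarB-sound : (G : Graph n) → outerplanarB G ≡ true → Outerplanar G
  outerplanarB-sound {n} G eq = let p , inj , e = anyL-perms-sound n eq in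
    outer (toℕ ∘ p) (inj ∘ Finₚ.toℕ-injective) (noCrossB-sound p G e)

  noCrossing-cong : {p q : Fin n → ℕ} {G H : Graph n} → (∀ i → p i ≡ q i) → G ≗₂ H → NoCrossing p G → NoCrossing q H
  noCrossing-cong {p = p} {q} eq e nc a b c d gab gcd l₁ l₂ l₃ =
    nc a b c d (trans (e a b) gab) (trans (e c d) gcd)
      (subst₂ _<_ (sym (eq a)) (sym (eq c)) l₁) (subst₂ _<_ (sym (eq c)) (sym (eq b)) l₂) (subst₂ _<_ (sym (eq b)) (sym (eq d)) l₃)

  module Rank (key : Fin n → ℕ) (injective : ∀ {i j} → key i ≡ key j → i ≡ j) where

    below : Fin n → Fin n → Bool
    below i j = key j <ᵇ key i

    count-below : ∀ i → count n (below i) < n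
    count-below i = subst (count n (below i) <_) (count-true n) (count-⊂ n (λ _ _ → refl)
      (i , Boolₚ.¬-not (λ e → ℕₚ.<-irrefl refl (<ᵇ-sound (key i) (key i) e)) , refl))

    rank : Fin n → Fin n
    rank i = fromℕ< (count-below i)

    rank-mono : ∀ {i j} → key i < key j → toℕ (rank i) < toℕ (rank j)
    rank-mono {i} {j} lt rewrite Finₚ.toℕ-fromℕ< (count-below i) | Finₚ.toℕ-fromℕ< (count-below j) = count-⊂ n
      (λ x e → <ᵇ-complete _ _ (ℕₚ.<-trans (<ᵇ-sound (key x) (key i) e) lt))
      (i , Boolₚ.¬-not (λ e → ℕₚ.<-irrefl refl (<ᵇ-sound (key i) (key i) e)) , <ᵇ-complete _ _ lt)

    rank-cancel : ∀ {i j} → toℕ (rank i) < toℕ (rank j) → key i < key j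
    rank-cancel {i} {j} lt with ℕₚ.<-cmp (key i) (key j)
    ... | tri< l _ _ = l
    ... | tri≈ _ e _ with refl ← injective e = contradiction lt (ℕₚ.<-irrefl refl)
    ... | tri> _ _ g = contradiction (rank-mono g) (ℕₚ.<-asym lt)

    rank-injective : Injection rank
    rank-injective {i} {j} e with ℕₚ.<-cmp (key i) (key j)
    ... | tri< l _ _ = contradiction (rank-mono l) (ℕₚ.<-irrefl (cong toℕ e))
    ... | tri≈ _ e′ _ = injective e′
    ... | tri> _ _ g = contradiction (rank-mono g) (ℕₚ.<-irrefl (cong toℕ (sym e)))

  outerplanarB-complete : (G : Graph n) → Outerplanar G → outerplanarB G ≡ true
  outerplanarB-complete {n} G (outer key injective noCross) = anyL-perms n
    (λ {p} {q} e → bool-ext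
      (λ h → noCrossB-complete q G (noCrossing-cong (cong toℕ ∘ e) (λ _ _ → refl) (noCrossB-sound p G h)))
      (λ h → noCrossB-complete p G (noCrossing-cong (cong toℕ ∘ sym ∘ e) (λ _ _ → refl) (noCrossB-sound q G h))))
    rank rank-injective
    (noCrossB-complete rank G (λ a b c d gab gcd l₁ l₂ l₃ → noCross a b c d gab gcd (rank-cancel l₁) (rank-cancel l₂) (rank-cancel l₃)))
    where open Rank key injective

  outerplanar? : (G : Graph n) → Dec (Outerplanar G)
  outerplanar? G = map′ (outerplanarB-sound G) (outerplanarB-complete G) (outerplanarB G Boolₚ.≟ true)

  outerplanar-restrict : ∀ {m n} {G : Graph n} {H : Graph m} (f : Fin m → Fin n) → Injection f →
    (∀ x y → H x y ≡ true → G (f x) (f y) ≡ true) → Outerplanar G → Outerplanar H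
  outerplanar-restrict f inj sub (outer key injective noCross) =
    outer (key ∘ f) (inj ∘ injective) (λ a b c d gab gcd → noCross _ _ _ _ (sub a b gab) (sub c d gcd))

  record ConnectedOuterplanar (G : Graph n) : Set where
    field
      nonempty    : 1 ≤ n
      connected   : Connected G
      outerplanar : Outerplanar G

  -- K₂ is the case n = 2.
  record BlockGraph (G : Graph n) : Set where
    field
      size        : 2 ≤ n
      connected   : Connected G
      no-cut      : ∀ v → ConnectedOn (others v) G
      outerplanar : Outerplanar G

  ≤ᵇ-sound : ∀ a b → (a ℕ.≤ᵇ b) ≡ true → a ≤ b
  ≤ᵇ-sound a b eq = ℕₚ.≤ᵇ⇒≤ a b (subst Data.Bool.T (sym eq) _)

  ≤ᵇ-complete : ∀ a b → a ≤ b → (a ℕ.≤ᵇ b) ≡ true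
  ≤ᵇ-complete a b le with a ℕ.≤ᵇ b | ℕₚ.≤⇒≤ᵇ le
  ... | true | _ = refl

  connectedB-sound : (G : Graph n) → connectedB G ≡ true → 1 ≤ n × Connected G
  connectedB-sound {n} G eq = let a , b = ∧-sound {1 ℕ.≤ᵇ n} eq in ≤ᵇ-sound 1 n a , connectedOn-sound everything G b

  connectedB-complete : (G : Graph n) → 1 ≤ n → Connected G → connectedB G ≡ true
  connectedB-complete {n} G le conn = ∧-complete (≤ᵇ-complete 1 n le) (connectedOn-complete everything G conn)

  𝒞-sound : (G : Graph n) → connectedB G ∧ outerplanarB G ≡ true → ConnectedOuterplanar G
  𝒞-sound G eq = let a , b = ∧-sound {connectedB G} eq
                     c , d = connectedB-sound G a in
    record { nonempty = c ; connected = d ; outerplanar = outerplanarB-sound G b }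

  𝒞-complete : (G : Graph n) → ConnectedOuterplanar G → connectedB G ∧ outerplanarB G ≡ true
  𝒞-complete G c = ∧-complete (connectedB-complete G nonempty connected) (outerplanarB-complete G outerplanar)
    where open ConnectedOuterplanar c

  connectedOuterplanar? : (G : Graph n) → Dec (ConnectedOuterplanar G)
  connectedOuterplanar? G = map′ (𝒞-sound G) (𝒞-complete G) (connectedB G ∧ outerplanarB G Boolₚ.≟ true)

  K₂-outerplanar : (G : Graph 2) → Outerplanar G
  K₂-outerplanar G = outer toℕ Finₚ.toℕ-injective (λ a b c d _ _ l₁ l₂ l₃ →
    ℕₚ.<⇒≱ (Finₚ.toℕ<n d) (ℕₚ.≤-trans (s≤s (ℕₚ.≤-trans (s≤s z≤n) l₂)) l₃))

  K₂-no-cut : (G : Graph 2) (v : Fin 2) → ConnectedOn (others v) G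
  K₂-no-cut G v zero       zero       su sw = ε
  K₂-no-cut G v (suc zero) (suc zero) su sw = ε
  K₂-no-cut G zero       zero       (suc zero) () sw
  K₂-no-cut G (suc zero) zero       (suc zero) su ()
  K₂-no-cut G zero       (suc zero) zero       su ()
  K₂-no-cut G (suc zero) (suc zero) zero       () sw

  𝒟-sound : (G : Graph n) → dissectionB G ∨ singleEdgeB G ≡ true → BlockGraph G
  𝒟-sound {n} G eq with ∨-sound {dissectionB G} eq
  ... | inj₁ h = let o , t  = ∧-sound {outerplanarB G} h
                     l , t′ = ∧-sound {3 ℕ.≤ᵇ n} t
                     c , v  = ∧-sound {connectedB G} t′ in
    record { size = ℕₚ.≤-trans (ℕₚ.n≤1+n 2) (≤ᵇ-sound 3 n l) ; connected = proj₂ (connectedB-sound G c)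
           ; no-cut = λ u → connectedOn-sound (others u) G (allB-sound n v u) ; outerplanar = outerplanarB-sound G o }
  ... | inj₂ h with ∧-sound {n ≡ᵇ 2} h
  ...   | e , c with refl ← ≡ᵇ-sound n 2 e =
    record { size = s≤s (s≤s z≤n) ; connected = proj₂ (connectedB-sound G c) ; no-cut = K₂-no-cut G ; outerplanar = K₂-outerplanar G }

  𝒟-complete : (G : Graph n) → BlockGraph G → dissectionB G ∨ singleEdgeB G ≡ true
  𝒟-complete {suc zero} G b with BlockGraph.size b
  ... | s≤s ()
  𝒟-complete {suc (suc zero)} G b = ∨-completeʳ {dissectionB G} (connectedB-complete G (s≤s z≤n) (BlockGraph.connected b))
  𝒟-complete {suc (suc (suc n))} G b = ∨-completeˡ (∧-complete (outerplanarB-complete G outerplanar)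
    (∧-complete (connectedB-complete G (s≤s z≤n) connected) (allB-complete _ (λ v → connectedOn-complete (others v) G (no-cut v)))))
    where open BlockGraph b

  blockGraph? : (G : Graph n) → Dec (BlockGraph G)
  blockGraph? G = map′ (𝒟-sound G) (𝒟-complete G) (dissectionB G ∨ singleEdgeB G Boolₚ.≟ true)

  path-cong : {S : Fin n → Bool} {G H : Graph n} → G ≗₂ H → ∀ {u v} → Path S G u v → Path S H u v
  path-cong e = gmap id (λ (a , b , g) → a , b , trans (sym (e _ _)) g)

  connectedOn-cong : {S : Fin n → Bool} {G H : Graph n} → G ≗₂ H → ConnectedOn S G → ConnectedOn S H
  connectedOn-cong e conn u v su sv = path-cong e (conn u v su sv)

  outerplanar-cong : {G H : Graph n} → G ≗₂ H → Outerplanar G → Outerplanar H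
  outerplanar-cong e = outerplanar-restrict id id (λ x y h → trans (e x y) h)

  connectedOuterplanar-cong : {G H : Graph n} → G ≗₂ H → ConnectedOuterplanar G → ConnectedOuterplanar H
  connectedOuterplanar-cong e c = record { nonempty = nonempty ; connected = connectedOn-cong e connected ; outerplanar = outerplanar-cong e outerplanar }
    where open ConnectedOuterplanar c

  blockGraph-cong : {G H : Graph n} → G ≗₂ H → BlockGraph G → BlockGraph H
  blockGraph-cong e b = record { size = size ; connected = connectedOn-cong e connected ; no-cut = λ v → connectedOn-cong e (no-cut v) ; outerplanar = outerplanar-cong e outerplanar }
    where open BlockGraph b

  𝒞B-cong : {G H : Graph n} → G ≗₂ H → connectedB G ∧ outerplanarB G ≡ connectedB H ∧ outerplanarB H
  𝒞B-cong {G = G} {H} e = bool-ext (𝒞-complete H ∘ connectedOuterplanar-cong e ∘ 𝒞-sound G) (𝒞-complete G ∘ connectedOuterplanar-cong (λ i j → sym (e i j)) ∘ 𝒞-sound H)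

  𝒟B-cong : {G H : Graph n} → G ≗₂ H → dissectionB G ∨ singleEdgeB G ≡ dissectionB H ∨ singleEdgeB H
  𝒟B-cong {G = G} {H} e = bool-ext (𝒟-complete H ∘ blockGraph-cong e ∘ 𝒟-sound G) (𝒟-complete G ∘ blockGraph-cong (λ i j → sym (e i j)) ∘ 𝒟-sound H)

open GraphProperties

module Periods where

  open import Data.Nat using (_≤_; _<_; s≤s; z≤n; _+_; _*_; _≡ᵇ_)

  private variable
    n : ℕ

  iter-+ : (π : Fin n → Fin n) → ∀ a b i → iter π (a + b) i ≡ iter π a (iter π b i)
  iter-+ π zero    b i = refl
  iter-+ π (suc a) b i = cong π (iter-+ π a b i)

  iter-comm : (π : Fin n → Fin n) → ∀ a b i → iter π a (iter π b i) ≡ iter π b (iter π a i)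
  iter-comm π a b i = trans (sym (iter-+ π a b i)) (trans (cong (λ k → iter π k i) (ℕₚ.+-comm a b)) (iter-+ π b a i))

  iter-injective : (π : Fin n → Fin n) → Injection π → ∀ k → Injection (iter π k)
  iter-injective π inj zero    e = e
  iter-injective π inj (suc k) e = iter-injective π inj k (inj e)

  record Period (π : Fin n → Fin n) (i : Fin n) (j : ℕ) : Set where
    field
      positive : 1 ≤ j
      returns  : iter π j i ≡ i
      minimal  : ∀ k → 1 ≤ k → k < j → iter π k i ≢ i

  period-unique : {π : Fin n → Fin n} {i : Fin n} {j k : ℕ} → Period π i j → Period π i k → j ≡ k
  period-unique {j = j} {k} p q with ℕₚ.<-cmp j k
  ... | tri< l _ _ = contradiction (Period.returns p) (Period.minimal q j (Period.positive p) l)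
  ... | tri≈ _ e _ = e
  ... | tri> _ _ g = contradiction (Period.returns q) (Period.minimal p k (Period.positive q) g)

  module _ (π : Fin n → Fin n) (inj : Injection π) (i : Fin n) where

    some-return : ∃ λ h → 1 ≤ h × h ≤ n × iter π h i ≡ i
    some-return with Finₚ.pigeonhole (ℕₚ.n<1+n n) (λ t → iter π (toℕ t) i)
    ... | s , t , s<t , e with ℕₚ.m≤n⇒∃[o]m+o≡n (ℕₚ.<⇒≤ s<t)
    ...   | o , s+o≡t = o , positive , bound , iter-injective π inj (toℕ s) (trans (sym (iter-+ π (toℕ s) o i)) (trans (cong (λ k → iter π k i) s+o≡t) (sym e)))
      where
      positive : 1 ≤ o
      positive = ℕₚ.+-cancelˡ-< (toℕ s) 0 o (subst₂ _<_ (sym (ℕₚ.+-identityʳ _)) (sym s+o≡t) s<t)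
      bound : o ≤ n
      bound = ℕₚ.≤-trans (ℕₚ.m≤n+m o (toℕ s)) (subst (_≤ n) (sym s+o≡t) (Finₚ.toℕ≤pred[n] t))

    private
      search : ∀ f k h → 1 ≤ k → k ≤ h → h < k + f → iter π h i ≡ i → (∀ j → 1 ≤ j → j < k → iter π j i ≢ i) →
        Period π i (cycGo n π i f k) × cycGo n π i f k ≤ h
      search zero    k h 1≤k k≤h h<k ret min = contradiction k≤h (ℕₚ.<⇒≱ (subst (h <_) (ℕₚ.+-identityʳ k) h<k))
      search (suc f) k h 1≤k k≤h h<k ret min with iter π k i ==ᶠ i in eq
      ... | true  = record { positive = 1≤k ; returns = ==-sound eq ; minimal = min } , k≤h
      ... | false = search f (suc k) h (s≤s z≤n) (ℕₚ.≤∧≢⇒< k≤h λ { refl → not-here ret }) (subst (h <_) (ℕₚ.+-suc k f) h<k) ret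
          (λ j 1≤j j<1+k → case-≤ j 1≤j (ℕₚ.m≤n⇒m<n∨m≡n (ℕₚ.≤-pred j<1+k)))
        where
        not-here : iter π k i ≢ i
        not-here e = contradiction (trans (sym eq) (==-complete e)) λ ()
        case-≤ : ∀ j → 1 ≤ j → j < k ⊎ j ≡ k → iter π j i ≢ i
        case-≤ j 1≤j (inj₁ l)    = min j 1≤j l
        case-≤ j 1≤j (inj₂ refl) = not-here

    cycLen-period≤ : Period π i (cycLen π i) × cycLen π i ≤ n
    cycLen-period≤ = let h , 1≤h , h≤n , ret = some-return
                         p , le = search n 1 h (s≤s z≤n) 1≤h (s≤s h≤n) ret (λ { zero () _ ; (suc j) _ (s≤s ()) }) in
      subst (Period π i) (sym (unfold n π i)) p , ℕₚ.≤-trans (ℕₚ.≤-reflexive (unfold n π i)) (ℕₚ.≤-trans le h≤n)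
      where
      unfold : ∀ n (π : Fin n → Fin n) i → cycLen π i ≡ cycGo n π i n 1
      unfold (suc n) π i = cycLen-suc n π i

    cycLen-period : Period π i (cycLen π i)
    cycLen-period = proj₁ cycLen-period≤

    cycLen≤n : cycLen π i ≤ n
    cycLen≤n = proj₂ cycLen-period≤

    cycLen-unique : ∀ {j} → Period π i j → cycLen π i ≡ j
    cycLen-unique = period-unique cycLen-period

  iter-multiple : (π : Fin n → Fin n) (i : Fin n) → ∀ l → iter π l i ≡ i → ∀ q → iter π (q * l) i ≡ i
  iter-multiple π i l e zero    = refl
  iter-multiple π i l e (suc q) = trans (iter-+ π l (q * l) i) (trans (cong (iter π l) (iter-multiple π i l e q)) e)

  period-divides : {π : Fin n → Fin n} {i : Fin n} {l : ℕ} → Period π i l → ∀ k → iter π k i ≡ i → l ∣ k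
  period-divides {π = π} {i} {suc l} p k e with k % suc l in eq
  ... | zero  = divides (k / suc l) (trans (m≡m%n+[m/n]*n k (suc l)) (cong (_+ (k / suc l) * suc l) eq))
  ... | suc r = contradiction
          (trans (sym (trans (cong (λ z → iter π z i) (trans (m≡m%n+[m/n]*n k (suc l)) (cong (_+ (k / suc l) * suc l) eq)))
            (trans (iter-+ π (suc r) _ i) (cong (iter π (suc r)) (iter-multiple π i (suc l) (Period.returns p) (k / suc l)))))) e)
          (Period.minimal p (suc r) (s≤s z≤n) (subst (_< suc l) eq (m%n<n k (suc l))))

  period-iter : {π : Fin n → Fin n} → Injection π → ∀ {i l} t → Period π i l → Period π (iter π t i) l
  period-iter {π = π} inj {i} {l} t p = record
    { positive = positive
    ; returns  = trans (iter-comm π l t i) (cong (iter π t) returns)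
    ; minimal  = λ k 1≤k k<l e → minimal k 1≤k k<l (iter-injective π inj t (trans (iter-comm π t k i) e)) }
    where open Period p

  module Orbit (π : Fin n → Fin n) (inj : Injection π) (i : Fin n) where

    len : ℕ
    len = cycLen π i

    period : Period π i len
    period = cycLen-period π inj i

    open Period period

    InOrbit : Fin n → Set
    InOrbit x = ∃ λ (t : Fin len) → iter π (toℕ t) i ≡ x

    inOrbit? : ∀ x → Dec (InOrbit x)
    inOrbit? x = Finₚ.any? (λ t → iter π (toℕ t) i Finₚ.≟ x)

    orbit : Fin n → Bool
    orbit x = does (inOrbit? x)

    orbit-sound : ∀ x → orbit x ≡ true → InOrbit x
    orbit-sound x e with inOrbit? x
    ... | yes p = p

    orbit-complete : ∀ x → InOrbit x → orbit x ≡ true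
    orbit-complete x p with inOrbit? x
    ... | yes _ = refl
    ... | no ¬p = contradiction p ¬p

    distinct : ∀ a b → a < b → b < len → iter π a i ≢ iter π b i
    distinct a b a<b b<l e with ℕₚ.m≤n⇒∃[o]m+o≡n (ℕₚ.<⇒≤ a<b)
    ... | o , refl = minimal o (ℕₚ.+-cancelˡ-< a 0 o (subst (_< a + o) (sym (ℕₚ.+-identityʳ a)) a<b)) (ℕₚ.≤-<-trans (ℕₚ.m≤n+m o a) b<l)
          (sym (iter-injective π inj a (trans e (iter-+ π a o i))))

    iter-distinct : ∀ (s t : Fin len) → iter π (toℕ s) i ≡ iter π (toℕ t) i → s ≡ t
    iter-distinct s t e with ℕₚ.<-cmp (toℕ s) (toℕ t)
    ... | tri< l _ _  = contradiction e (distinct _ _ l (Finₚ.toℕ<n t))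
    ... | tri≈ _ e′ _ = Finₚ.toℕ-injective e′
    ... | tri> _ _ g  = contradiction (sym e) (distinct _ _ g (Finₚ.toℕ<n s))

    orbit-enumeration : Enumeration orbit len
    orbit-enumeration = record
      { at        = λ t → iter π (toℕ t) i
      ; injective = λ {s} {t} → iter-distinct s t
      ; sound     = λ t → orbit-complete _ (t , refl)
      ; complete  = orbit-sound }

    forward : ∀ x → InOrbit x → InOrbit (π x)
    forward x (t , e) with ℕₚ.m≤n⇒m<n∨m≡n (Finₚ.toℕ<n t)
    ... | inj₁ l = fromℕ< l , trans (cong (λ k → iter π k i) (Finₚ.toℕ-fromℕ< l)) (cong π e)
    ... | inj₂ l = fromℕ< positive , trans (cong (λ k → iter π k i) (Finₚ.toℕ-fromℕ< positive)) (trans (sym returns) (trans (cong (λ k → iter π k i) (sym l)) (cong π e)))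

    backward : ∀ x → InOrbit (π x) → InOrbit x
    backward x (t , e) = go (toℕ t) (Finₚ.toℕ<n t) e
      where
      last : ∀ l → 1 ≤ l → iter π l i ≡ i → ∃ λ m → suc m ≡ l × π (iter π m i) ≡ i
      last (suc m) _ e = m , refl , e
      go : ∀ k → k < len → iter π k i ≡ π x → InOrbit x
      go zero    k<l e = let m , m+1 , e′ = last len positive returns in
        fromℕ< (ℕₚ.≤-reflexive m+1) , trans (cong (λ k → iter π k i) (Finₚ.toℕ-fromℕ< (ℕₚ.≤-reflexive m+1))) (inj (trans e′ e))
      go (suc k) k<l e = fromℕ< (ℕₚ.<-trans (ℕₚ.n<1+n k) k<l) , trans (cong (λ k → iter π k i) (Finₚ.toℕ-fromℕ< (ℕₚ.<-trans (ℕₚ.n<1+n k) k<l))) (inj e)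

    orbit-stable : ∀ x → orbit (π x) ≡ orbit x
    orbit-stable x = bool-ext (λ e → orbit-complete x (backward x (orbit-sound (π x) e))) (λ e → orbit-complete (π x) (forward x (orbit-sound x e)))

    start∈orbit : orbit i ≡ true
    start∈orbit = orbit-complete i (fromℕ< positive , cong (λ k → iter π k i) (Finₚ.toℕ-fromℕ< positive))

    cycLen-orbit : ∀ x → orbit x ≡ true → cycLen π x ≡ len
    cycLen-orbit x e = let t , e′ = orbit-sound x e in cycLen-unique π inj x (subst (λ y → Period π y len) e′ (period-iter inj (toℕ t) period))

  Stable : (Fin n → Fin n) → (Fin n → Bool) → Set
  Stable π J = ∀ x → J (π x) ≡ J x

  _∖_ : (Fin n → Bool) → (Fin n → Bool) → Fin n → Bool
  (J ∖ I) x = J x ∧ not (I x)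

  module _ (π : Fin n → Fin n) (inj : Injection π) where

    stable-iter : ∀ {J} → Stable π J → ∀ t x → J (iter π t x) ≡ J x
    stable-iter st zero    x = refl
    stable-iter st (suc t) x = trans (st (iter π t x)) (stable-iter st t x)

    orbit⊆ : ∀ {J i} → Stable π J → J i ≡ true → ∀ x → Orbit.orbit π inj i x ≡ true → J x ≡ true
    orbit⊆ {J} {i} st ji x e = let t , e′ = Orbit.orbit-sound π inj i x e in subst (λ y → J y ≡ true) e′ (trans (stable-iter st (toℕ t) i) ji)

    ∖-stable : ∀ {J i} → Stable π J → Stable π (J ∖ Orbit.orbit π inj i)
    ∖-stable {i = i} st x = cong₂ (λ a b → a ∧ not b) (st x) (Orbit.orbit-stable π inj i x)

    cycle-induction : (P : (Fin n → Bool) → Set) →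
      (∀ J → (∀ x → J x ≡ false) → P J) →
      (∀ J i → Stable π J → J i ≡ true → P (J ∖ Orbit.orbit π inj i) → P J) →
      ∀ J → Stable π J → P J
    cycle-induction P base step J st = go (count n J) J st ℕₚ.≤-refl
      where
      go : ∀ c J → Stable π J → count n J ≤ c → P J
      go c J st le with Finₚ.any? (λ x → J x Boolₚ.≟ true)
      ... | no none = base J (λ x → Boolₚ.¬-not (λ e → none (x , e)))
      go zero    J st le | yes (i , ji) = contradiction (ℕₚ.≤-trans (subst (_< count n J) (count-false n {λ _ → false} (λ _ → refl)) (count-⊂ n (λ _ ()) (i , refl , ji))) le) λ ()
      go (suc c) J st le | yes (i , ji) = step J i st ji (go c (J ∖ Orbit.orbit π inj i) (∖-stable {i = i} st)
        (ℕₚ.≤-pred (ℕₚ.≤-trans (count-⊂ n (λ x e → proj₁ (∧-sound e)) (i , cong₂ (λ a b → a ∧ not b) ji (Orbit.start∈orbit π inj i) , ji)) le)))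

  count-split : ∀ n (p q : Fin n → Bool) → count n p ≡ count n (p ∖ q) + count n (λ x → p x ∧ q x)
  count-split zero    p q = refl
  count-split (suc n) p q with p zero | q zero | count-split n (p ∘ suc) (q ∘ suc)
  ... | false | _     | ih = ih
  ... | true  | false | ih = cong suc ih
  ... | true  | true  | ih = trans (cong suc ih) (sym (ℕₚ.+-suc _ _))

  profile : (Fin n → Fin n) → (Fin n → Bool) → ℕ → ℕ
  profile {n} π J j = count n (λ x → J x ∧ (cycLen π x ≡ᵇ j))

  record Cycles (π : Fin n → Fin n) (J : Fin n → Bool) (m : Mono) : Set where
    field
      ω-profile : ∀ j → ω m j ≡ profile π J j
      degree    : deg m ≡ count n J

  cycles-∅ : (π : Fin n → Fin n) (J : Fin n → Bool) → (∀ x → J x ≡ false) → Cycles π J []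
  cycles-∅ {n} π J e = record
    { ω-profile = λ j → trans (ω-[] j) (sym (count-false n (λ x → cong (_∧ (cycLen π x ≡ᵇ j)) (e x))))
    ; degree    = sym (count-false n e) }
    where
    ω-[] : ∀ j → ω [] j ≡ 0
    ω-[] zero    = refl
    ω-[] (suc j) = ℕₚ.*-zeroʳ j

  module _ (π : Fin n → Fin n) (inj : Injection π) (J : Fin n → Bool) (i : Fin n) (st : Stable π J) (ji : J i ≡ true) where

    open Orbit π inj i

    private
      orbit-in : ∀ x → J x ∧ orbit x ≡ orbit x
      orbit-in x = bool-ext (λ e → proj₂ (∧-sound {J x} e)) (λ e → ∧-complete (orbit⊆ π inj {J} {i} st ji x e) e)

      rearrange : ∀ a b c → (a ∧ b) ∧ not c ≡ (a ∧ not c) ∧ b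
      rearrange false b c = refl
      rearrange true false false = refl
      rearrange true false true = refl
      rearrange true true c = sym (Boolₚ.∧-identityʳ (not c))

      rearrange′ : ∀ a b c → (a ∧ b) ∧ c ≡ (a ∧ c) ∧ b
      rearrange′ false b c = refl
      rearrange′ true false false = refl
      rearrange′ true false true = refl
      rearrange′ true true c = sym (Boolₚ.∧-identityʳ c)

      profile-split : ∀ j → profile π J j ≡ profile π (J ∖ orbit) j + count n (λ x → orbit x ∧ (cycLen π x ≡ᵇ j))
      profile-split j = trans (count-split n _ orbit) (cong₂ _+_
        (count-cong n (λ x → rearrange (J x) (cycLen π x ≡ᵇ j) (orbit x)))
        (count-cong n (λ x → trans (rearrange′ (J x) (cycLen π x ≡ᵇ j) (orbit x)) (cong (_∧ (cycLen π x ≡ᵇ j)) (orbit-in x)))))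

      on-orbit : count n (λ x → orbit x ∧ (cycLen π x ≡ᵇ len)) ≡ len
      on-orbit = trans (count-cong n (λ x → bool-ext (λ e → proj₁ (∧-sound {orbit x} e))
        (λ e → ∧-complete e (subst (λ z → (z ≡ᵇ len) ≡ true) (sym (cycLen-orbit x e)) (≡ᵇ-refl len))))) (count-enumerated orbit-enumeration)

      off-orbit : ∀ j → len ≢ j → count n (λ x → orbit x ∧ (cycLen π x ≡ᵇ j)) ≡ 0
      off-orbit j ne = count-false n (λ x → Boolₚ.¬-not (λ e → let o , c = ∧-sound {orbit x} e in
        ne (trans (sym (cycLen-orbit x o)) (≡ᵇ-sound _ _ c))))

    cycles-step : ∀ m t → suc t ≡ len → Cycles π (J ∖ orbit) m → Cycles π J (inc t m)
    cycles-step m t l c = record { ω-profile = at ; degree = degree′ }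
      where
      open Cycles c
      at : ∀ j → ω (inc t m) j ≡ profile π J j
      at j with len ℕ.≟ j
      ... | yes refl = trans (cong (ω (inc t m)) (sym l)) (trans (ω-inc t m) (trans (cong₂ _+_ l (trans (cong (ω m) l) (ω-profile len)))
              (trans (ℕₚ.+-comm len _) (sym (trans (profile-split len) (cong (profile π (J ∖ orbit) len +_) on-orbit))))))
      ... | no ne = trans (ω-inc-≢ t m j (λ e → ne (trans (sym l) e))) (trans (ω-profile j)
              (sym (trans (profile-split j) (trans (cong (profile π (J ∖ orbit) j +_) (off-orbit j ne)) (ℕₚ.+-identityʳ _)))))
      degree′ : deg (inc t m) ≡ count n J
      degree′ = trans (deg-inc t m) (trans (cong₂ _+_ l degree) (trans (ℕₚ.+-comm len _)
        (sym (trans (count-split n J orbit) (cong (count n (J ∖ orbit) +_) (trans (count-cong n orbit-in) (count-enumerated orbit-enumeration)))))))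

  cycles : (π : Fin n → Fin n) → Injection π → ∃ (Cycles π everything)
  cycles {n} π inj = cycle-induction π inj (∃ ∘ Cycles π) (λ J e → [] , cycles-∅ π J e)
    (λ { J i st ji (m , c) → let t , l = pred-len i in inc t m , cycles-step π inj J i st ji m t l c }) everything (λ _ → refl)
    where
    pred-len : ∀ i → ∃ λ t → suc t ≡ cycLen π i
    pred-len i with cycLen π i | Period.positive (cycLen-period π inj i)
    ... | suc t | _ = t , refl

  countL-allFin : ∀ n (p : Fin n → Bool) → countL (allFin n) p ≡ count n p
  countL-allFin n p = go n id
    where
    go : ∀ k (f : Fin k → Fin n) → length (filterᵇ p (Data.List.tabulate f)) ≡ count k (p ∘ f)
    go zero    f = refl
    go (suc k) f with p (f zero)
    ... | true  = cong suc (go k (f ∘ suc))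
    ... | false = go k (f ∘ suc)

  cycType-≈ : (π : Fin n → Fin n) → Injection π → ∀ m → Cycles π everything m → cycType π ≈ m
  cycType-≈ {n} π inj m c t = trans (exponent-upTo n id t) (by (t ℕ.<? n))
    where
    open Cycles c
    f : ℕ → ℕ
    f k = divN (countL (allFin n) (λ i → cycLen π i ≡ᵇ k)) k
    exponent-upTo : ∀ k (g : ℕ → ℕ) t → exponent (map f (map suc (Data.List.applyUpTo g k))) t ≡ (if does (t ℕ.<? k) then f (suc (g t)) else 0)
    exponent-upTo zero    g t       = refl
    exponent-upTo (suc k) g zero    = refl
    exponent-upTo (suc k) g (suc t) = exponent-upTo k (g ∘ suc) t
    f-value : f (suc t) ≡ exponent m t
    f-value = trans (cong (_/ suc t) (trans (countL-allFin n _) (trans (sym (ω-profile (suc t))) (ℕₚ.*-comm (suc t) (exponent m t))))) (m*n/n≡m (exponent m t) (suc t))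
    by : (d : Dec (t < n)) → (if does d then f (suc t) else 0) ≡ exponent m t
    by (yes _)  = f-value
    by (no t≮n) = sym (ℕₚ.*-cancelˡ-≡ (exponent m t) 0 (suc t) (trans (ω-profile (suc t)) (trans
      (count-false n (λ x → Boolₚ.¬-not (λ e → t≮n (subst (_≤ n) (≡ᵇ-sound (cycLen π x) (suc t) e) (cycLen≤n π inj x)))))
      (sym (ℕₚ.*-zeroʳ t)))))

  cycles-cycType : (π : Fin n → Fin n) → Injection π → Cycles π everything (cycType π)
  cycles-cycType π inj = let m , c = cycles π inj
                             e = cycType-≈ π inj m c in record
    { ω-profile = λ j → trans (ω-cong (cycType π) m e j) (Cycles.ω-profile c j)
    ; degree    = trans (deg-resp (cycType π) m e) (Cycles.degree c) }

  deg-cycType : (π : Fin n → Fin n) → Injection π → deg (cycType π) ≡ n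
  deg-cycType {n} π inj = trans (Cycles.degree (cycles-cycType π inj)) (count-true n)

open Periods

module Blocks where

  open import Data.Nat using (_≤_; _<_; s≤s)

  private variable
    n : ℕ

  fixed : (Fin n → Fin n) → Fin n → Bool
  fixed p x = p x ==ᶠ x

  -- A block is represented by the gate map onto it: a retraction of the vertex set onto the vertices of the block
  -- such that every edge outside the block lies in a fibre.
  record Block (G : Graph n) (p : Fin n → Fin n) : Set where
    field
      idempotent : ∀ x → p (p x) ≡ p x
      edges      : ∀ x y → G x y ≡ true → p x ≡ p y ⊎ (p x ≡ x × p y ≡ y)
      two        : ∃ λ x → ∃ λ y → p x ≡ x × p y ≡ y × x ≢ y
      connected  : ConnectedOn (fixed p) G
      no-cut     : ∀ v → ConnectedOn (λ x → fixed p x ∧ others v x) G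

  block? : (G : Graph n) (p : Fin n → Fin n) → Dec (Block G p)
  block? G p = map′
    (λ (a , b , c , d , e) → record { idempotent = a ; edges = b ; two = c ; connected = d ; no-cut = e })
    (λ b → Block.idempotent b , Block.edges b , Block.two b , Block.connected b , Block.no-cut b)
    (Finₚ.all? (λ x → p (p x) Finₚ.≟ p x) ×-dec
     Finₚ.all? (λ x → Finₚ.all? (λ y → (G x y Boolₚ.≟ true) →-dec ((p x Finₚ.≟ p y) ⊎-dec ((p x Finₚ.≟ x) ×-dec (p y Finₚ.≟ y))))) ×-dec
     Finₚ.any? (λ x → Finₚ.any? (λ y → (p x Finₚ.≟ x) ×-dec (p y Finₚ.≟ y) ×-dec ¬? (x Finₚ.≟ y))) ×-dec
     connectedOn? (fixed p) G ×-dec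
     Finₚ.all? (λ v → connectedOn? (λ x → fixed p x ∧ others v x) G))

  path-mono : {S T : Fin n → Bool} {G : Graph n} → (∀ x → S x ≡ true → T x ≡ true) → ∀ {u v} → Path S G u v → Path T G u v
  path-mono sub = gmap id (λ (a , b , g) → sub _ a , sub _ b , g)

  path-reverse : {S : Fin n → Bool} {G : Graph n} → Simple G → ∀ {u v} → Path S G u v → Path S G v u
  path-reverse s = reverse (λ (a , b , g) → b , a , trans (Simple.symmetric s _ _) g)

  module _ {G : Graph n} {p : Fin n → Fin n} (b : Block G p) where
    open Block b

    -- A fibre can be left only through its gate.
    stay : {S : Fin n → Bool} → ∀ {a x y} → S a ≡ false → p x ≡ a → Path S G x y → p y ≡ a
    stay sa px ε = px
    stay {S} {a} {x} sa px ((sx , sz , g) ◅ path) with edges _ _ g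
    ... | inj₁ e = stay sa (trans (sym e) px) path
    ... | inj₂ (e , _) = contradiction (trans (sym sx) (trans (cong S (trans (sym e) px)) sa)) λ ()

    fibre-path : Connected G → ∀ x → Path (λ y → p y ==ᶠ p x) G x (p x)
    fibre-path conn x = go (conn x (p x) refl refl) refl
      where
      go : ∀ {y} → Path everything G y (p x) → p y ≡ p x → Path (λ y → p y ==ᶠ p x) G y (p x)
      go ε e = ε
      go {y} ((_ , _ , g) ◅ path) e with edges _ _ g
      ... | inj₁ e′ = (==-complete e , ==-complete (trans (sym e′) e) , g) ◅ go path (trans (sym e′) e)
      ... | inj₂ (e′ , _) = subst (λ z → Path (λ y → p y ==ᶠ p x) G z (p x)) (trans (sym e) e′) ε

  module _ {G : Graph n} (conn : Connected G) {p q : Fin n → Fin n} (bp : Block G p) (bq : Block G q) where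
    private
      module P = Block bp
      module Q = Block bq

    -- Two vertices of the block q with different gates in p are joined in q minus the first gate.
    separated⇒fixed : ∀ x y → q x ≡ x → q y ≡ y → p x ≢ p y → p x ≡ x
    separated⇒fixed x y qx qy ne with p x Finₚ.≟ x
    ... | yes e = e
    ... | no px≢x = contradiction (stay bp cut refl
            (Q.no-cut (p x) x y (∧-complete (==-complete qx) (others-complete (p x) x (px≢x ∘ sym)))
              (∧-complete (==-complete qy) (others-complete (p x) y (λ { refl → ne (sym (P.idempotent x)) })))))
            (ne ∘ sym)
      where
      cut : fixed q (p x) ∧ others (p x) (p x) ≡ false
      cut = Boolₚ.¬-not (λ e → others-sound (p x) (p x) (proj₂ (∧-sound {fixed q (p x)} e)) refl)

    separated⇒⊆ : ∀ x y → q x ≡ x → q y ≡ y → p x ≢ p y → ∀ z → q z ≡ z → p z ≡ z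
    separated⇒⊆ x y qx qy ne z qz with p z Finₚ.≟ p x
    ... | no pz≢px = separated⇒fixed z x qz qx pz≢px
    ... | yes pz≡px = separated⇒fixed z y qz qy (λ e → ne (trans (sym pz≡px) e))

  Fixed⊆ : (p q : Fin n → Fin n) → Set
  Fixed⊆ q p = ∀ z → q z ≡ z → p z ≡ z

  module _ {G : Graph n} (conn : Connected G) {p q : Fin n → Fin n} (bp : Block G p) (bq : Block G q) where
    private
      module P = Block bp
      module Q = Block bq

    same-fixed⇒≗ : Fixed⊆ q p → Fixed⊆ p q → ∀ x → p x ≡ q x
    same-fixed⇒≗ qp pq x = let s , _ , ps , _ = P.two in go (conn s x refl refl) (trans ps (sym (pq s ps)))
      where
      go : ∀ {s} → Path everything G s x → p s ≡ q s → p x ≡ q x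
      go ε e = e
      go ((_ , _ , g) ◅ path) e with P.edges _ _ g | Q.edges _ _ g
      ... | inj₁ e₁ | inj₁ e₂ = go path (trans (sym e₁) (trans e e₂))
      ... | inj₂ (_ , e₁) | _ = go path (trans e₁ (sym (pq _ e₁)))
      ... | _ | inj₂ (_ , e₂) = go path (trans (qp _ e₂) (sym e₂))

    block-dichotomy : (∀ x → p x ≡ q x) ⊎ (∀ x y → q x ≡ x → q y ≡ y → p x ≡ p y)
    block-dichotomy with Finₚ.any? (λ x → Finₚ.any? (λ y → (q x Finₚ.≟ x) ×-dec (q y Finₚ.≟ y) ×-dec ¬? (p x Finₚ.≟ p y)))
    ... | no none = inj₂ (λ x y qx qy → by x y qx qy (p x Finₚ.≟ p y))
      where
      by : ∀ x y → q x ≡ x → q y ≡ y → Dec (p x ≡ p y) → p x ≡ p y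
      by x y qx qy (yes e) = e
      by x y qx qy (no ne) = contradiction (x , y , qx , qy , ne) none
    ... | yes (x , y , qx , qy , ne) = inj₁ (same-fixed⇒≗ qp pq)
      where
      qp : Fixed⊆ q p
      qp = separated⇒⊆ conn bp bq x y qx qy ne
      pq : Fixed⊆ p q
      pq = let s , t , qs , qt , s≢t = Q.two in
        separated⇒⊆ conn bq bp s t (qp s qs) (qp t qt) (λ e → s≢t (trans (sym qs) (trans e qt)))

    parent-unique : ∀ v r → p v ≡ v → q v ≡ v → p r ≢ v → q r ≢ v → ∀ x → p x ≡ q x
    parent-unique v r pv qv pr qr with block-dichotomy
    ... | inj₁ e = e
    ... | inj₂ const with block-dichotomy′
      where
      block-dichotomy′ : Fixed⊆ p q ⊎ (∀ x → p x ≡ x → q x ≡ v)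
      block-dichotomy′ with Finₚ.any? (λ x → (p x Finₚ.≟ x) ×-dec ¬? (q x Finₚ.≟ v))
      ... | no none = inj₂ (λ x px → by x px (q x Finₚ.≟ v))
        where
        by : ∀ x → p x ≡ x → Dec (q x ≡ v) → q x ≡ v
        by x px (yes e) = e
        by x px (no ne) = contradiction (x , px , ne) none
      ... | yes (x , px , ne) = inj₁ (separated⇒⊆ conn bq bp x v px pv (λ e → ne (trans e qv)))
    ...   | inj₁ pq = contradiction (const s t (pq s ps) (pq t pt)) (λ e → s≢t (trans (sym ps) (trans e pt)))
      where
      s = proj₁ P.two
      t = proj₁ (proj₂ P.two)
      ps = proj₁ (proj₂ (proj₂ P.two))
      pt = proj₁ (proj₂ (proj₂ (proj₂ P.two)))
      s≢t = proj₂ (proj₂ (proj₂ (proj₂ P.two)))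
    ...   | inj₂ gate = contradiction (trans (along (fibre-path bp conn r)) (gate (p r) (P.idempotent r))) qr
      where
      along : ∀ {x y} → Path (λ y → p y ==ᶠ p r) G x y → q x ≡ q y
      along ε = refl
      along ((px , _ , g) ◅ path) with Q.edges _ _ g
      ... | inj₁ e = trans e (along path)
      ... | inj₂ (qx , _) = contradiction (trans (sym (==-sound px)) (trans (const _ v qx qv) pv)) pr

  -- Existence of the parent block

  path? : (S : Fin n → Bool) (G : Graph n) (u v : Fin n) → Dec (Path S G u v)
  path? {n} S G u v with S u Boolₚ.≟ true
  ... | yes su = map′ (λ r → proj₂ (proj₂ (reachIn-sound S G u n v r))) (reachIn-complete S G u v su) (reachIn S G u n v Boolₚ.≟ true)
  ... | no ¬su = map′ (λ { refl → ε }) (λ { ε → refl ; ((su , _) ◅ _) → contradiction su ¬su }) (u Finₚ.≟ v)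

  module _ {G : Graph n} (simple : Simple G) (conn : Connected G) where

    Inseparable : Fin n → Fin n → Set
    Inseparable x y = ∀ z → z ≢ x → z ≢ y → Path (others z) G x y

    inseparable? : ∀ x y → Dec (Inseparable x y)
    inseparable? x y = Finₚ.all? (λ z → ¬? (z Finₚ.≟ x) →-dec (¬? (z Finₚ.≟ y) →-dec path? (others z) G x y))

    separator : ∀ x y → ¬ Inseparable x y → ∃ λ z → z ≢ x × z ≢ y × ¬ Path (others z) G x y
    separator x y ns with Finₚ.any? (λ z → ¬? (z Finₚ.≟ x) ×-dec ¬? (z Finₚ.≟ y) ×-dec ¬? (path? (others z) G x y))
    ... | yes h = h
    ... | no none = contradiction (λ z zx zy → by z zx zy (path? (others z) G x y)) ns
      where
      by : ∀ z → z ≢ x → z ≢ y → Dec (Path (others z) G x y) → Path (others z) G x y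
      by z zx zy (yes h) = h
      by z zx zy (no ¬h) = contradiction (z , zx , zy , ¬h) none

    -- The block of the edge vw consists of the vertices inseparable from both v and w;
    -- the gate of y is the vertex where a walk from y first hits it.
    module EdgeBlock (v w : Fin n) (vw : G v w ≡ true) where

      v≢w : v ≢ w
      v≢w refl = contradiction (trans (sym vw) (Simple.irreflexive simple v)) λ ()

      Member : Fin n → Set
      Member x = Inseparable x v × Inseparable x w

      member? : ∀ x → Dec (Member x)
      member? x = inseparable? x v ×-dec inseparable? x w

      edge-inseparable : ∀ {x y} → G x y ≡ true → Inseparable x y
      edge-inseparable g z zx zy = (others-complete z _ (zx ∘ sym) , others-complete z _ (zy ∘ sym) , g) ◅ ε

      member-v : Member v
      member-v = (λ _ _ _ → ε) , edge-inseparable vw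

      member-w : Member w
      member-w = edge-inseparable (trans (Simple.symmetric simple w v) vw) , (λ _ _ _ → ε)

      clique : ∀ {x y} → Member x → Member y → Inseparable x y
      clique (xv , xw) (yv , yw) z zx zy with z Finₚ.≟ v
      ... | no zv    = xv z zx zv ◅◅ path-reverse simple (yv z zy zv)
      ... | yes refl = xw z zx v≢w ◅◅ path-reverse simple (yw z zy v≢w)

      data Hit : ℕ → Fin n → Fin n → Set where
        here : ∀ {s} → Member s → Hit 0 s s
        step : ∀ {k y z s} → ¬ Member y → G y z ≡ true → Hit k z s → Hit (suc k) y s

      hit-member : ∀ {k y s} → Hit k y s → Member s
      hit-member (here m)     = m
      hit-member (step _ _ h) = hit-member h

      hit-here : ∀ {k y s} → Member y → Hit k y s → y ≡ s
      hit-here m (here _)      = refl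
      hit-here m (step ¬m _ _) = contradiction m ¬m

      hit-through : ∀ {k y s} z → z ≢ y → Hit k y s → Path (others z) G y s ⊎ (∃ λ j → j < k × Hit j z s)
      hit-through z zy (here m) = inj₁ ε
      hit-through z zy (step {z = y′} ¬m g h) with z Finₚ.≟ y′
      ... | yes refl = inj₂ (_ , ℕₚ.n<1+n _ , h)
      ... | no zy′ with hit-through z zy′ h
      ...   | inj₁ path = inj₁ ((others-complete z _ (zy ∘ sym) , others-complete z _ (zy′ ∘ sym) , g) ◅ path)
      ...   | inj₂ (j , j<k , h′) = inj₂ (j , ℕₚ.<-trans j<k (ℕₚ.n<1+n _) , h′)

      non-member : ∀ y → ¬ Member y → ∃ λ u → Member u × ∃ λ z → z ≢ y × z ≢ u × ¬ Path (others z) G y u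
      non-member y ¬m with inseparable? y v | inseparable? y w
      ... | yes a | yes b = contradiction (a , b) ¬m
      ... | no ¬a | _     = v , member-v , separator y v ¬a
      ... | yes _ | no ¬b = w , member-w , separator y w ¬b

      -- A vertex z separating y from the block lies on each of the two walks from y, unless the walk ends in z.
      hit-unique : ∀ f {k l y s t} → k ≤ f → Hit k y s → Hit l y t → s ≡ t
      hit-unique f k≤f (here m) h′ = hit-here m h′
      hit-unique (suc f) {y = y} {s} {t} (s≤s k≤f) h@(step ¬m _ _) h′ with non-member y ¬m
      ... | u , mu , z , zy , zu , ¬path with hit-through z zy h | hit-through z zy h′
      ...   | inj₂ (j , j<k , hz) | inj₂ (_ , _ , hz′) = hit-unique f (ℕₚ.≤-trans (ℕₚ.≤-pred j<k) k≤f) hz hz′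
      ...   | inj₁ path | inj₁ path′ with z Finₚ.≟ s
      ...     | no zs = contradiction (path ◅◅ clique (hit-member h) mu z zs zu) ¬path
      ...     | yes refl with z Finₚ.≟ t
      ...       | yes e = e
      ...       | no zt = contradiction (path′ ◅◅ clique (hit-member h′) mu z zt zu) ¬path
      hit-unique (suc f) {s = s} {t} _ h@(step _ _ _) h′ | u , mu , z , zy , zu , ¬path | inj₁ path | inj₂ (_ , _ , hz′) with z Finₚ.≟ s
      ... | no zs = contradiction (path ◅◅ clique (hit-member h) mu z zs zu) ¬path
      ... | yes refl = hit-here (hit-member h) hz′
      hit-unique (suc f) {s = s} {t} _ h@(step _ _ _) h′ | u , mu , z , zy , zu , ¬path | inj₂ (_ , _ , hz) | inj₁ path′ with z Finₚ.≟ t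
      ... | no zt = contradiction (path′ ◅◅ clique (hit-member h′) mu z zt zu) ¬path
      ... | yes refl = sym (hit-here (hit-member h′) hz)

      hit : ∀ y → ∃ λ s → ∃ λ k → Hit k y s
      hit y = go (conn y v refl refl)
        where
        go : ∀ {y} → Path everything G y v → ∃ λ s → ∃ λ k → Hit k y s
        go ε = v , 0 , here member-v
        go {y} ((_ , _ , g) ◅ path) with member? y
        ... | yes m = y , 0 , here m
        ... | no ¬m = let s , k , h = go path in s , suc k , step ¬m g h

      gate : Fin n → Fin n
      gate y = proj₁ (hit y)

      gate-hit : ∀ {k y s} → Hit k y s → gate y ≡ s
      gate-hit {y = y} h = hit-unique _ ℕₚ.≤-refl (proj₂ (proj₂ (hit y))) h

      gate-member : ∀ {y} → Member y → gate y ≡ y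
      gate-member m = gate-hit (here m)

      member-gate : ∀ y → Member (gate y)
      member-gate y = hit-member (proj₂ (proj₂ (hit y)))

      gate-edges : ∀ x y → G x y ≡ true → gate x ≡ gate y ⊎ (gate x ≡ x × gate y ≡ y)
      gate-edges x y g with member? x | member? y
      ... | yes mx | yes my = inj₂ (gate-member mx , gate-member my)
      ... | no ¬mx | _      = inj₁ (gate-hit (step ¬mx g (proj₂ (proj₂ (hit y)))))
      ... | yes _  | no ¬my = inj₁ (sym (gate-hit (step ¬my (trans (Simple.symmetric simple y x) g) (proj₂ (proj₂ (hit x))))))

      fixed-member : ∀ x → fixed gate x ≡ true → Member x
      fixed-member x e = subst Member (==-sound e) (member-gate x)

      project : ∀ {S : Fin n → Bool} {x y} → S (gate x) ≡ true → Path S G x y → Path (λ z → fixed gate z ∧ S z) G (gate x) (gate y)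
      project s ε = ε
      project {S} s ((sx , sz , g) ◅ path) with gate-edges _ _ g
      ... | inj₁ e = subst (λ a → Path (λ z → fixed gate z ∧ S z) G a _) (sym e) (project (subst (λ a → S a ≡ true) e s) path)
      ... | inj₂ (ex , ez) = (∧-complete (idem _) s , ∧-complete (idem _) sz′ , subst₂ (λ a b → G a b ≡ true) (sym ex) (sym ez) g) ◅ project sz′ path
        where
        idem : ∀ x → fixed gate (gate x) ≡ true
        idem x = ==-complete (gate-member (member-gate x))
        sz′ = subst (λ a → S a ≡ true) (sym ez) sz

      gate-block : Block G gate
      gate-block = record
        { idempotent = λ x → gate-member (member-gate x)
        ; edges      = gate-edges
        ; two        = v , w , gate-member member-v , gate-member member-w , v≢w
        ; connected  = λ x y fx fy → path-mono (λ z e → proj₁ (∧-sound e))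
            (subst₂ (Path _ G) (==-sound fx) (==-sound fy) (project {everything} refl (conn x y refl refl)))
        ; no-cut     = λ c x y sx sy → let fx , cx = ∧-sound {fixed gate x} sx
                                           fy , cy = ∧-sound {fixed gate y} sy in
            subst₂ (Path _ G) (==-sound {i = gate x} {x} fx) (==-sound {i = gate y} {y} fy)
              (project {others c} {x} {y} (subst (λ a → others c a ≡ true) (sym (==-sound {i = gate x} {x} fx)) cx)
                (clique (fixed-member x fx) (fixed-member y fy) c (others-sound c x cx ∘ sym) (others-sound c y cy ∘ sym))) }

    arrival : ∀ {r v} → r ≢ v → Path everything G r v → ∃ λ w → Path (others v) G r w × G w v ≡ true
    arrival ne ε = contradiction refl ne
    arrival {r} {v} ne (_◅_ {j = z} (_ , _ , g) path) with z Finₚ.≟ v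
    ... | yes refl = r , ε , g
    ... | no zv = let w , path′ , e = arrival zv path in
      w , (others-complete v r ne , others-complete v z zv , g) ◅ path′ , e

    parent-exists : ∀ v r → r ≢ v → ∃ λ p → Block G p × p v ≡ v × p r ≢ v
    parent-exists v r ne with arrival ne (conn r v refl refl)
    ... | w , path , g = gate , gate-block , gate-member member-v ,
            (λ e → v≢w (trans (sym (stay gate-block (Boolₚ.¬-not (λ o → others-sound v v o refl)) e path)) (gate-member member-w)))
      where open EdgeBlock v w (trans (Simple.symmetric simple v w) g)

open Blocks

module Flags where


  private variable
    n : ℕ

  χ-¬ : {P : Set} (d : Dec P) → χ d +ℚ χ (¬? d) ≡ 1ℚ
  χ-¬ (yes _) = refl
  χ-¬ (no _)  = refl

  +-cancelʳ : ∀ c {a b} → a +ℚ c ≡ b +ℚ c → a ≡ b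
  +-cancelʳ c {a} {b} e = trans (sym (undo a)) (trans (cong (_-ℚ c) e) (undo b))
    where
    undo : ∀ a → (a +ℚ c) -ℚ c ≡ a
    undo a = trans (ℚₚ.+-assoc a c (-ℚ c)) (trans (cong (a +ℚ_) (ℚₚ.+-inverseʳ c)) (ℚₚ.+-identityʳ a))

  Automorphism : (Fin n → Fin n) → Graph n → Set
  Automorphism α G = ∀ i j → G (α i) (α j) ≡ G i j

  Commute : (p α : Fin n → Fin n) → Set
  Commute p α = ∀ x → p (α x) ≡ α (p x)

  commute? : (p α : Fin n → Fin n) → Dec (Commute p α)
  commute? p α = Finₚ.all? (λ x → p (α x) Finₚ.≟ α (p x))

  path-map : {m : ℕ} {S : Fin m → Bool} {T : Fin n → Bool} {G : Graph m} {H : Graph n} (f : Fin m → Fin n) →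
    (∀ x → S x ≡ true → T (f x) ≡ true) → (∀ x y → S x ≡ true → S y ≡ true → G x y ≡ true → H (f x) (f y) ≡ true) →
    ∀ {u v} → Path S G u v → Path T H (f u) (f v)
  path-map f s g = gmap f (λ (a , b , e) → s _ a , s _ b , g _ _ a b e)

  flag-cases : {P Q R : Set} (c : Dec P) (e : Dec Q) (d : Dec R) → (P → R → Q) → (Q → R) →
    χ c *ℚ χ e +ℚ (χ (¬? e) *ℚ χ (¬? d) +ℚ χ (¬? c) *ℚ χ d) ≡ 1ℚ
  flag-cases (yes c) (yes e) (yes d) f g = refl
  flag-cases (yes c) (yes e) (no ¬d) f g = refl
  flag-cases (yes c) (no ¬e) (yes d) f g = contradiction (f c d) ¬e
  flag-cases (yes c) (no ¬e) (no ¬d) f g = refl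
  flag-cases (no ¬c) (yes e) (yes d) f g = refl
  flag-cases (no ¬c) (yes e) (no ¬d) f g = contradiction (g e) ¬d
  flag-cases (no ¬c) (no ¬e) (yes d) f g = refl
  flag-cases (no ¬c) (no ¬e) (no ¬d) f g = refl

  rooted-cases : {Q R : Set} (e : Dec Q) (d : Dec R) → (Q → R) → χ (¬? e) *ℚ χ (¬? d) +ℚ 1ℚ *ℚ χ d ≡ 1ℚ
  rooted-cases (yes e) (yes d) g = refl
  rooted-cases (yes e) (no ¬d) g = contradiction (g e) ¬d
  rooted-cases (no ¬e) (yes d) g = refl
  rooted-cases (no ¬e) (no ¬d) g = refl

  module Dissymmetry {G : Graph n} (simple : Simple G) (conn : Connected G)
    (α : Fin n → Fin n) (inj : Injection α) (aut : Automorphism α G) where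

    private
      α⁻¹ = proj₁ (inverse α inj ℕₚ.≤-refl)
      αα⁻¹ = proj₁ (proj₂ (inverse α inj ℕₚ.≤-refl))
      α⁻¹α = proj₂ (proj₂ (inverse α inj ℕₚ.≤-refl))

      aut⁻¹ : ∀ i j → G (α⁻¹ i) (α⁻¹ j) ≡ G i j
      aut⁻¹ i j = trans (sym (aut _ _)) (cong₂ G (αα⁻¹ i) (αα⁻¹ j))

    conjugate : (Fin n → Fin n) → Fin n → Fin n
    conjugate p x = α (p (α⁻¹ x))

    conjugate-fixed : ∀ p x → p x ≡ x → conjugate p (α x) ≡ α x
    conjugate-fixed p x e = cong α (trans (cong p (α⁻¹α x)) e)

    fixed-conjugate : ∀ p x → conjugate p x ≡ x → p (α⁻¹ x) ≡ α⁻¹ x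
    fixed-conjugate p x e = trans (sym (α⁻¹α _)) (cong α⁻¹ e)

    block-conjugate : ∀ {p} → Block G p → Block G (conjugate p)
    block-conjugate {p} b = record
      { idempotent = λ x → cong α (trans (cong p (α⁻¹α _)) (idempotent _))
      ; edges      = λ x y g → edge x y (edges (α⁻¹ x) (α⁻¹ y) (trans (aut⁻¹ x y) g))
      ; two        = let x , y , px , py , ne = two in α x , α y , conjugate-fixed p x px , conjugate-fixed p y py , ne ∘ inj
      ; connected  = λ u v fu fv → transport (λ x e → back x e) (λ x e → forth x e) fu fv connected
      ; no-cut     = λ c u v fu fv → transport
          (λ x e → let f , o = ∧-sound {fixed (conjugate p) x} e in
            ∧-complete (back x f) (others-complete (α⁻¹ c) (α⁻¹ x) (λ e′ → others-sound c x o (trans (sym (αα⁻¹ x)) (trans (cong α e′) (αα⁻¹ c))))))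
          (λ x e → let f , o = ∧-sound {fixed p x} e in
            ∧-complete (forth x f) (others-complete c (α x) (λ e′ → others-sound (α⁻¹ c) x o (trans (sym (α⁻¹α x)) (cong α⁻¹ e′)))))
          fu fv (no-cut (α⁻¹ c)) }
      where
      open Block b
      back : ∀ x → fixed (conjugate p) x ≡ true → fixed p (α⁻¹ x) ≡ true
      back x e = ==-complete (fixed-conjugate p x (==-sound e))
      forth : ∀ x → fixed p x ≡ true → fixed (conjugate p) (α x) ≡ true
      forth x e = ==-complete (conjugate-fixed p x (==-sound e))
      edge : ∀ x y → p (α⁻¹ x) ≡ p (α⁻¹ y) ⊎ (p (α⁻¹ x) ≡ α⁻¹ x × p (α⁻¹ y) ≡ α⁻¹ y) →
        conjugate p x ≡ conjugate p y ⊎ (conjugate p x ≡ x × conjugate p y ≡ y)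
      edge x y (inj₁ e)        = inj₁ (cong α e)
      edge x y (inj₂ (e , e′)) = inj₂ (trans (cong α e) (αα⁻¹ x) , trans (cong α e′) (αα⁻¹ y))
      transport : ∀ {S T : Fin n → Bool} → (∀ x → T x ≡ true → S (α⁻¹ x) ≡ true) → (∀ x → S x ≡ true → T (α x) ≡ true) →
        ∀ {u v} → T u ≡ true → T v ≡ true → ConnectedOn S G → Path T G u v
      transport {S} {T} back forth {u} {v} tu tv c = subst₂ (Path T G) (αα⁻¹ u) (αα⁻¹ v)
        (path-map α forth (λ x y _ _ g → trans (aut x y) g) (c (α⁻¹ u) (α⁻¹ v) (back u tu) (back v tv)))

    commute⇔conjugate : ∀ p → (∀ x → p x ≡ conjugate p x) → Commute p α
    commute⇔conjugate p e x = trans (e (α x)) (cong (α ∘ p) (α⁻¹α x))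

    moved-block : ∀ {p} → Block G p → ¬ Commute p α → ∀ x y → p x ≡ x → p y ≡ y → p (α x) ≡ p (α y)
    moved-block {p} b nc x y px py with block-dichotomy conn b (block-conjugate b)
    ... | inj₁ e = contradiction (commute⇔conjugate p e) nc
    ... | inj₂ h = h (α x) (α y) (conjugate-fixed p x px) (conjugate-fixed p y py)

    moved-gate : ∀ {p} → Block G p → ¬ Commute p α →
      sum (fin n) (λ v → χ ((p v Finₚ.≟ v) ×-dec (p (α v) Finₚ.≟ v))) ≡ 1ℚ
    moved-gate {p} b nc = unique1 (fin n) (λ v → (p v Finₚ.≟ v) ×-dec (p (α v) Finₚ.≟ v)) g (idempotent (α s) , trans (moved-block b nc g s (idempotent (α s)) ps) refl)
      (λ { v (pv , pαv) → trans (sym pαv) (moved-block b nc v s pv ps) })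
      where
      open Block b
      s = proj₁ two
      ps = proj₁ (proj₂ (proj₂ two))
      g = p (α s)

    parents : ∀ v r → r ≢ v →
      sum (selfMaps n) (λ p → χ (block? G (lookup p) ×-dec (lookup p v Finₚ.≟ v) ×-dec ¬? (lookup p r Finₚ.≟ v))) ≡ 1ℚ
    parents v r ne = unique1 (selfMaps n) (λ q → block? G (lookup q) ×-dec (lookup q v Finₚ.≟ v) ×-dec ¬? (lookup q r Finₚ.≟ v)) (tabulate p) (block-cong (sym ∘ at) b , trans (at v) pv , (λ e → pr (trans (sym (at r)) e)))
      (λ { q (bq , qv , qr) → lookup-injective q (tabulate p) (λ x → trans (parent-unique conn bq b v r qv pv qr pr x) (sym (at x))) })
      where
      parent = parent-exists simple conn v r ne
      p = proj₁ parent
      b = proj₁ (proj₂ parent)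
      pv = proj₁ (proj₂ (proj₂ parent))
      pr = proj₂ (proj₂ (proj₂ parent))
      at : ∀ x → lookup (tabulate p) x ≡ p x
      at = Vecₚ.lookup∘tabulate p
      block-cong : ∀ {p q} → (∀ x → p x ≡ q x) → Block G p → Block G q
      block-cong {p} {q} e b = record
        { idempotent = λ x → trans (sym (e _)) (trans (cong p (sym (e x))) (trans (idempotent x) (e x)))
        ; edges      = λ x y g → Data.Sum.map (λ h → trans (sym (e x)) (trans h (e y))) (λ (h , h′) → trans (sym (e x)) h , trans (sym (e y)) h′) (edges x y g)
        ; two        = let x , y , px , py , ne = two in x , y , trans (sym (e x)) px , trans (sym (e y)) py , ne
        ; connected  = λ u v fu fv → path-mono (λ x f → trans (cong (_==ᶠ x) (sym (e x))) f) (connected u v (trans (cong (_==ᶠ u) (e u)) fu) (trans (cong (_==ᶠ v) (e v)) fv))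
        ; no-cut     = λ c u v fu fv → path-mono (λ x f → trans (cong (λ z → (z ==ᶠ x) ∧ others c x) (sym (e x))) f)
                         (no-cut c u v (trans (cong (λ z → (z ==ᶠ u) ∧ others c u) (e u)) fu) (trans (cong (λ z → (z ==ᶠ v) ∧ others c v) (e v)) fv)) }
        where open Block b

    private
      B C : Vec (Fin n) n → ℚ
      B p = χ (block? G (lookup p))
      C p = χ (commute? (lookup p) α)
      C̄ : Vec (Fin n) n → ℚ
      C̄ p = χ (¬? (commute? (lookup p) α))
      F : Vec (Fin n) n → Fin n → ℚ
      F p v = χ (lookup p v Finₚ.≟ v)
      E Ē : Fin n → ℚ
      E v = χ (α v Finₚ.≟ v)
      Ē v = χ (¬? (α v Finₚ.≟ v))
      D D̄ : Fin n → Vec (Fin n) n → Fin n → ℚ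
      D r p v = χ (lookup p r Finₚ.≟ v)
      D̄ r p v = χ (¬? (lookup p r Finₚ.≟ v))

      ps = selfMaps n
      vs = fin n

      -- A flag that is not fixed is either the first step of a moved vertex v towards α v,
      -- or the gate of a moved block towards its image, and never both.
      flag : ∀ p v → lookup p v ≡ v → C p *ℚ E v +ℚ (Ē v *ℚ D̄ (α v) p v +ℚ C̄ p *ℚ D (α v) p v) ≡ 1ℚ
      flag p v pv = flag-cases (commute? (lookup p) α) (α v Finₚ.≟ v) (lookup p (α v) Finₚ.≟ v)
        (λ c d → trans (cong α (sym pv)) (trans (sym (c v)) d)) (λ e → trans (cong (lookup p) e) pv)

      flags : (Vec (Fin n) n → Fin n → ℚ) → ℚ
      flags f = sum ps (λ p → B p *ℚ sum vs (λ v → F p v *ℚ f p v))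

      flags-cong : ∀ {f g} → (∀ p v → lookup p v ≡ v → f p v ≡ g p v) → flags f ≡ flags g
      flags-cong e = ∑-cong (elems ps) (λ p → cong (B p *ℚ_) (∑-cong (elems vs) (λ v → χ-guard (lookup p v Finₚ.≟ v) (e p v))))

      flags-+ : ∀ (f g : Vec (Fin n) n → Fin n → ℚ) → flags (λ p v → f p v +ℚ g p v) ≡ flags f +ℚ flags g
      flags-+ f g = trans (∑-cong (elems ps) (λ p → trans (cong (B p *ℚ_) (trans (∑-cong (elems vs) (λ v → ℚₚ.*-distribˡ-+ (F p v) _ _)) (∑-+ (elems vs) _ _))) (ℚₚ.*-distribˡ-+ (B p) _ _)))
        (∑-+ (elems ps) _ _)

      by-vertex : ∀ (f : Fin n → ℚ) (g : Vec (Fin n) n → Fin n → ℚ) → flags (λ p v → f v *ℚ g p v) ≡ sum vs (λ v → f v *ℚ sum ps (λ p → B p *ℚ (F p v *ℚ g p v)))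
      by-vertex f g = begin
        flags (λ p v → f v *ℚ g p v)
          ≡⟨ ∑-cong (elems ps) (λ p → sym (∑-*ˡ (elems vs) (B p) _)) ⟩
        _ ≡⟨ ∑-swap (elems ps) (elems vs) _ ⟩
        _ ≡⟨ ∑-cong (elems vs) (λ v → trans (∑-cong (elems ps) (λ p → trans (cong (B p *ℚ_) (swap*ˡ (F p v) (f v) _)) (swap*ˡ (B p) (f v) _))) (∑-*ˡ (elems ps) (f v) _)) ⟩
        _ ∎

      by-block : ∀ (f : Vec (Fin n) n → ℚ) (g : Vec (Fin n) n → Fin n → ℚ) → flags (λ p v → f p *ℚ g p v) ≡ sum ps (λ p → B p *ℚ (f p *ℚ sum vs (λ v → F p v *ℚ g p v)))
      by-block f g = ∑-cong (elems ps) (λ p → cong (B p *ℚ_) (trans (∑-cong (elems vs) (λ v → swap*ˡ (F p v) (f p) _)) (∑-*ˡ (elems vs) (f p) _)))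

      vertex-count : ∀ {P : Fin n → Set} (d : ∀ v → Dec (P v)) (r : Fin n → Fin n) → (∀ v → P v → r v ≢ v) →
        sum vs (λ v → χ (d v) *ℚ sum ps (λ p → B p *ℚ (F p v *ℚ D̄ (r v) p v))) ≡ sum vs (λ v → χ (d v))
      vertex-count d r ne = ∑-cong (elems vs) (λ v → trans (χ-guard (d v) (λ h → trans
        (∑-cong (elems ps) (λ p → trans (cong (B p *ℚ_) (sym (χ-× (lookup p v Finₚ.≟ v) (¬? (lookup p (r v) Finₚ.≟ v))))) (sym (χ-× (block? G (lookup p)) ((lookup p v Finₚ.≟ v) ×-dec ¬? (lookup p (r v) Finₚ.≟ v))))))
        (parents v (r v) (ne v h)))) (ℚₚ.*-identityʳ (χ (d v))))

    module _ (root : Fin n) where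

      private
        moved-vertices : flags (λ p v → Ē v *ℚ D̄ (α v) p v) ≡ sum vs Ē
        moved-vertices = trans (by-vertex Ē (λ p v → D̄ (α v) p v)) (vertex-count (λ v → ¬? (α v Finₚ.≟ v)) α (λ v h → h))

        moved-blocks : flags (λ p v → C̄ p *ℚ D (α v) p v) ≡ sum ps (λ p → B p *ℚ C̄ p)
        moved-blocks = trans (by-block C̄ (λ p v → D (α v) p v)) (∑-cong (elems ps) (λ p → χ-guard (block? G (lookup p)) (λ b →
          trans (χ-guard (¬? (commute? (lookup p) α)) (λ nc → trans
            (∑-cong (elems vs) (λ v → sym (χ-× (lookup p v Finₚ.≟ v) (lookup p (α v) Finₚ.≟ v)))) (moved-gate b nc)))
            (ℚₚ.*-identityʳ (C̄ p)))))

        far : flags (λ p v → χ (¬? (root Finₚ.≟ v)) *ℚ D̄ root p v) ≡ sum vs (λ v → χ (¬? (root Finₚ.≟ v)))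
        far = trans (by-vertex (λ v → χ (¬? (root Finₚ.≟ v))) (λ p v → D̄ root p v)) (vertex-count (λ v → ¬? (root Finₚ.≟ v)) (λ _ → root) (λ v h → h))

        near : flags (λ p v → 1ℚ *ℚ D root p v) ≡ sum ps (λ p → B p *ℚ 1ℚ)
        near = trans (by-block (λ _ → 1ℚ) (λ p v → D root p v)) (∑-cong (elems ps) (λ p → χ-guard (block? G (lookup p)) (λ b →
          trans (ℚₚ.*-identityˡ _) (trans (∑-cong (elems vs) (λ v → ℚₚ.*-comm (F p v) (D root p v)))
            (trans (∑-cong (elems vs) (λ v → cong (_*ℚ F p v) (χ-⇔ (lookup p root Finₚ.≟ v) (v Finₚ.≟ lookup p root) sym sym)))
              (trans (pick vs (lookup p root) (F p)) (χ-yes (lookup p (lookup p root) Finₚ.≟ lookup p root) (Block.idempotent b root))))))))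

        rooted-flag : ∀ p v → lookup p v ≡ v → χ (¬? (root Finₚ.≟ v)) *ℚ D̄ root p v +ℚ 1ℚ *ℚ D root p v ≡ 1ℚ
        rooted-flag p v pv = rooted-cases (root Finₚ.≟ v) (lookup p root Finₚ.≟ v) (λ e → trans (cong (lookup p) e) pv)

      dissymmetry : 1ℚ -ℚ sum vs E ≡ sum ps (λ p → B p *ℚ (C p *ℚ (1ℚ -ℚ sum vs (λ v → F p v *ℚ E v))))
      dissymmetry = begin
        1ℚ -ℚ f              ≡⟨ solve 3 (λ o f t → o :- f := (o :+ t) :- (f :+ t)) refl 1ℚ f T ⟩
        (1ℚ +ℚ T) -ℚ (f +ℚ T) ≡⟨ cong (_-ℚ (f +ℚ T)) (+-cancelʳ (M +ℚ N) {1ℚ +ℚ T} {S +ℚ f} balance) ⟩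
        (S +ℚ f) -ℚ (f +ℚ T) ≡⟨ solve 3 (λ s f t → (s :+ f) :- (f :+ t) := s :+ (:- con 1ℚ) :* t) refl S f T ⟩
        S +ℚ (-ℚ 1ℚ) *ℚ T    ≡⟨ cong (S +ℚ_) (sym (∑-*ˡ (elems ps) (-ℚ 1ℚ) _)) ⟩
        _                    ≡⟨ sym (∑-+ (elems ps) _ _) ⟩
        _                    ≡⟨ ∑-cong (elems ps) (λ p → solve 3 (λ b c s → b :* c :+ (:- con 1ℚ) :* (b :* (c :* s)) := b :* (c :* (con 1ℚ :- s))) refl (B p) (C p) _) ⟩
        _                    ∎
        where
        open +-*-Solver
        f T S M N : ℚ
        f = sum vs E
        S = sum ps (λ p → B p *ℚ C p)
        T = sum ps (λ p → B p *ℚ (C p *ℚ sum vs (λ v → F p v *ℚ E v)))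
        M = sum vs Ē
        N = sum ps (λ p → B p *ℚ C̄ p)
        vertices : f +ℚ M ≡ 1ℚ +ℚ sum vs (λ v → χ (¬? (root Finₚ.≟ v)))
        vertices = begin
          f +ℚ M ≡⟨ sym (∑-+ (elems vs) E Ē) ⟩
          _ ≡⟨ ∑-cong (elems vs) (λ v → trans (χ-¬ (α v Finₚ.≟ v)) (sym (χ-¬ (root Finₚ.≟ v)))) ⟩
          _ ≡⟨ ∑-+ (elems vs) _ _ ⟩
          _ ≡⟨ cong (_+ℚ sum vs (λ v → χ (¬? (root Finₚ.≟ v)))) (trans (∑-cong (elems vs) (λ v → χ-⇔ (root Finₚ.≟ v) (v Finₚ.≟ root) sym sym)) (Finite.once vs root)) ⟩
          _ ∎
        blocks : S +ℚ N ≡ sum ps (λ p → B p *ℚ 1ℚ)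
        blocks = trans (sym (∑-+ (elems ps) _ _)) (∑-cong (elems ps) (λ p → trans (sym (ℚₚ.*-distribˡ-+ (B p) (C p) (C̄ p))) (cong (B p *ℚ_) (χ-¬ (commute? (lookup p) α)))))
        total : T +ℚ (M +ℚ N) ≡ sum vs (λ v → χ (¬? (root Finₚ.≟ v))) +ℚ sum ps (λ p → B p *ℚ 1ℚ)
        total = begin
          T +ℚ (M +ℚ N)
            ≡⟨ cong₂ _+ℚ_ (sym (by-block C (λ p v → E v))) (cong₂ _+ℚ_ (sym moved-vertices) (sym moved-blocks)) ⟩
          _ ≡⟨ cong (flags (λ p v → C p *ℚ E v) +ℚ_) (sym (flags-+ _ _)) ⟩
          _ ≡⟨ sym (flags-+ _ _) ⟩
          _ ≡⟨ flags-cong (λ p v pv → trans (flag p v pv) (sym (rooted-flag p v pv))) ⟩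
          _ ≡⟨ flags-+ _ _ ⟩
          _ ≡⟨ cong₂ _+ℚ_ far near ⟩
          _ ∎
        balance : (1ℚ +ℚ T) +ℚ (M +ℚ N) ≡ (S +ℚ f) +ℚ (M +ℚ N)
        balance = begin
          (1ℚ +ℚ T) +ℚ (M +ℚ N)   ≡⟨ ℚₚ.+-assoc 1ℚ T (M +ℚ N) ⟩
          1ℚ +ℚ (T +ℚ (M +ℚ N))   ≡⟨ cong (1ℚ +ℚ_) total ⟩
          _                       ≡⟨ sym (ℚₚ.+-assoc 1ℚ (sum vs (λ v → χ (¬? (root Finₚ.≟ v)))) (sum ps (λ p → B p *ℚ 1ℚ))) ⟩
          _                       ≡⟨ cong₂ _+ℚ_ (sym vertices) (sym blocks) ⟩
          (f +ℚ M) +ℚ (S +ℚ N)    ≡⟨ solve 4 (λ f m s n → (f :+ m) :+ (s :+ n) := (s :+ f) :+ (m :+ n)) refl f M S N ⟩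
          (S +ℚ f) +ℚ (M +ℚ N)    ∎

open Flags

module Decomposition where

  open import Data.Nat using (_≤_; _<_; s≤s; z≤n; _+_; _*_; _<ᵇ_)

  private variable
    n : ℕ

  bounded : ∀ n (κ : Fin n → ℕ) → ∃ λ M → ∀ x → κ x < M
  bounded zero    κ = 0 , λ ()
  bounded (suc n) κ = let M , lt = bounded n (κ ∘ suc) in suc (κ zero) + M ,
    λ { zero → ℕₚ.m≤m+n _ M ; (suc x) → ℕₚ.≤-trans (lt x) (ℕₚ.m≤n+m M _) }

  module Lexicographic (f κ : Fin n → ℕ) (L : ℕ) (κ<L : ∀ x → κ x < L) where

    infix 4 _≺_
    _≺_ : Fin n → Fin n → Set
    x ≺ y = f x < f y ⊎ (f x ≡ f y × κ x < κ y)

    key : Fin n → ℕ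
    key x = f x * L + κ x

    key-mono : ∀ {x y} → f x < f y → key x < key y
    key-mono {x} {y} lt = ℕₚ.≤-trans (ℕₚ.+-monoʳ-< (f x * L) (κ<L x))
      (ℕₚ.≤-trans (ℕₚ.≤-reflexive (ℕₚ.+-comm (f x * L) L)) (ℕₚ.≤-trans (ℕₚ.*-monoˡ-≤ L lt) (ℕₚ.m≤m+n (f y * L) (κ y))))

    key-cancel : ∀ {x y} → key x < key y → x ≺ y
    key-cancel {x} {y} lt with ℕₚ.<-cmp (f x) (f y)
    ... | tri< l _ _ = inj₁ l
    ... | tri≈ _ e _ = inj₂ (e , ℕₚ.+-cancelˡ-< (f x * L) (κ x) (κ y) (subst (λ z → key x < z * L + κ y) (sym e) lt))
    ... | tri> _ _ g = contradiction (key-mono g) (ℕₚ.<-asym lt)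

    key-injective : (∀ {x y} → f x ≡ f y → κ x ≡ κ y → x ≡ y) → ∀ {x y} → key x ≡ key y → x ≡ y
    key-injective inj {x} {y} e with ℕₚ.<-cmp (f x) (f y)
    ... | tri< l _ _  = contradiction (key-mono l) (ℕₚ.<-irrefl e)
    ... | tri≈ _ e′ _ = inj e′ (ℕₚ.+-cancelˡ-≡ (f x * L) (κ x) (κ y) (trans e (cong (λ z → z * L + κ y) (sym e′))))
    ... | tri> _ _ g  = contradiction (key-mono g) (ℕₚ.<-irrefl (sym e))

    lexicographic : {G : Graph n} → (∀ {x y} → f x ≡ f y → κ x ≡ κ y → x ≡ y) →
      (∀ a b c d → G a b ≡ true → G c d ≡ true → a ≺ c → c ≺ b → b ≺ d → Data.Empty.⊥) → Outerplanar G
    lexicographic inj nc = outer key (key-injective inj)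
      (λ a b c d gab gcd l₁ l₂ l₃ → nc a b c d gab gcd (key-cancel l₁) (key-cancel l₂) (key-cancel l₃))

    ≺⇒≤ : ∀ {x y} → x ≺ y → f x ≤ f y
    ≺⇒≤ (inj₁ l)       = ℕₚ.<⇒≤ l
    ≺⇒≤ (inj₂ (e , _)) = ℕₚ.≤-reflexive e

    ≺-within : ∀ {x y} → f x ≡ f y → x ≺ y → κ x < κ y
    ≺-within e (inj₁ l)       = contradiction e (ℕₚ.<⇒≢ l)
    ≺-within e (inj₂ (_ , l)) = l

  -- Turning a circular drawing so that the vertices of key at least r come first.
  module Rotation (κ : Fin n → ℕ) (M : ℕ) (κ<M : ∀ x → κ x < M) where

    turn : ℕ → Fin n → ℕ
    turn r x = if κ x <ᵇ r then κ x + M else κ x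

    data Turned (r : ℕ) (x : Fin n) : ℕ → Set where
      kept  : r ≤ κ x → Turned r x (κ x)
      moved : κ x < r → Turned r x (κ x + M)

    turned : ∀ r x → Turned r x (turn r x)
    turned r x with κ x <ᵇ r in eq
    ... | true  = moved (<ᵇ-sound (κ x) r eq)
    ... | false = kept (ℕₚ.≮⇒≥ (λ lt → contradiction (trans (sym eq) (<ᵇ-complete (κ x) r lt)) λ ()))

    turn-bound : ∀ r x → turn r x < M + M
    turn-bound r x with turn r x | turned r x
    ... | _ | kept _  = ℕₚ.≤-trans (κ<M x) (ℕₚ.m≤m+n M M)
    ... | _ | moved _ = ℕₚ.+-monoˡ-< M (κ<M x)

    turn-least : ∀ r x → r ≤ M → r ≤ turn r x
    turn-least r x le with turn r x | turned r x
    ... | _ | kept l  = l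
    ... | _ | moved _ = ℕₚ.≤-trans le (ℕₚ.m≤n+m M (κ x))

    turn-root : ∀ x → turn (κ x) x ≡ κ x
    turn-root x with turn (κ x) x | turned (κ x) x
    ... | _ | kept _  = refl
    ... | _ | moved l = contradiction l (ℕₚ.<-irrefl refl)

    private
      wrapped : ∀ {x y} → κ x + M < κ y → Data.Empty.⊥
      wrapped {x} {y} lt = ℕₚ.<⇒≱ (ℕₚ.<-trans lt (κ<M y)) (ℕₚ.m≤n+m M (κ x))

      wrapped≡ : ∀ {x y} → κ x + M ≡ κ y → Data.Empty.⊥
      wrapped≡ {x} {y} e = ℕₚ.<⇒≱ (κ<M y) (subst (M ≤_) e (ℕₚ.m≤n+m M (κ x)))

    turn-injective : (∀ {x y} → κ x ≡ κ y → x ≡ y) → ∀ r {x y} → turn r x ≡ turn r y → x ≡ y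
    turn-injective inj r {x} {y} e with turn r x | turned r x | turn r y | turned r y
    ... | _ | kept _  | _ | kept _  = inj e
    ... | _ | moved _ | _ | moved _ = inj (ℕₚ.+-cancelʳ-≡ M (κ x) (κ y) e)
    ... | _ | kept _  | _ | moved _ = Data.Empty.⊥-elim (wrapped≡ {y} {x} (sym e))
    ... | _ | moved _ | _ | kept _  = Data.Empty.⊥-elim (wrapped≡ {x} {y} e)

    turn-noCross : {G : Graph n} → Simple G → NoCrossing κ G → ∀ r → NoCrossing (turn r) G
    turn-noCross {G} s nc r a b c d gab gcd l₁ l₂ l₃
      with turn r a | turned r a | turn r c | turned r c | turn r b | turned r b | turn r d | turned r d
    ... | _ | kept ra | _ | kept _  | _ | kept _  | _ | kept _  = nc a b c d gab gcd l₁ l₂ l₃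
    ... | _ | kept ra | _ | kept _  | _ | kept _  | _ | moved rd = nc d c a b (trans (Simple.symmetric s d c) gcd) gab (ℕₚ.<-≤-trans rd ra) l₁ l₂
    ... | _ | kept ra | _ | kept _  | _ | moved _ | _ | moved rd =
            nc b a d c (trans (Simple.symmetric s b a) gab) (trans (Simple.symmetric s d c) gcd) (ℕₚ.+-cancelʳ-< M (κ b) (κ d) l₃) (ℕₚ.<-≤-trans rd ra) l₁
    ... | _ | kept ra | _ | moved _ | _ | moved _ | _ | moved rd =
            nc c d b a gcd (trans (Simple.symmetric s b a) gab) (ℕₚ.+-cancelʳ-< M (κ c) (κ b) l₂) (ℕₚ.+-cancelʳ-< M (κ b) (κ d) l₃) (ℕₚ.<-≤-trans rd ra)
    ... | _ | moved _ | _ | moved _ | _ | moved _ | _ | moved _ =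
            nc a b c d gab gcd (ℕₚ.+-cancelʳ-< M (κ a) (κ c) l₁) (ℕₚ.+-cancelʳ-< M (κ c) (κ b) l₂) (ℕₚ.+-cancelʳ-< M (κ b) (κ d) l₃)
    ... | _ | moved _ | _ | kept _  | _ | _       | _ | _       = wrapped {a} {c} l₁
    ... | _ | _       | _ | moved _ | _ | kept _  | _ | _       = wrapped {c} {b} l₂
    ... | _ | _       | _ | _       | _ | moved _ | _ | kept _  = wrapped {b} {d} l₃

  -- Rooted connected outerplanar graphs on the fibres of π over J, permuted by α along σ; ρ marks the roots.
  record Assembly {k N : ℕ} (σ : Fin k → Fin k) (J : Fin k → Bool)
                  (π : Fin N → Fin k) (ρ : Fin N → Bool) (α : Fin N → Fin N) (G : Graph N) : Set where
    field
      simple      : Simple G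
      fibrewise   : ∀ x y → G x y ≡ true → π x ≡ π y
      joined      : ∀ x y → π x ≡ π y → Path everything G x y
      outerplanar : Outerplanar G
      injective   : Injection α
      aut         : Automorphism α G
      roots       : ∀ x → ρ (α x) ≡ ρ x
      equivariant : ∀ x → π (α x) ≡ σ (π x)
      over        : ∀ x → J (π x) ≡ true
      root        : ∀ j → J j ≡ true → ∃ λ x → π x ≡ j × ρ x ≡ true
      root-unique : ∀ x y → ρ x ≡ true → ρ y ≡ true → π x ≡ π y → x ≡ y

  automorphism? : (α : Fin n → Fin n) (G : Graph n) → Dec (Automorphism α G)
  automorphism? α G = Finₚ.all? (λ i → Finₚ.all? (λ j → G (α i) (α j) Boolₚ.≟ G i j))

  assembly? : ∀ {k N} σ J (π : Fin N → Fin k) ρ α G → Dec (Assembly σ J π ρ α G)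
  assembly? σ J π ρ α G = map′
    (λ (a , b , c , d , e , f , g , h , i , j , l) → record { simple = a ; fibrewise = b ; joined = c ; outerplanar = d ; injective = λ {_} {_} → e ; aut = f ; roots = g ; equivariant = h ; over = i ; root = j ; root-unique = l })
    (λ s → let open Assembly s in simple , fibrewise , joined , outerplanar , (λ {_} {_} → injective) , aut , roots , equivariant , over , root , root-unique)
    (simple? G ×-dec
     Finₚ.all? (λ x → Finₚ.all? (λ y → (G x y Boolₚ.≟ true) →-dec (π x Finₚ.≟ π y))) ×-dec
     Finₚ.all? (λ x → Finₚ.all? (λ y → (π x Finₚ.≟ π y) →-dec path? everything G x y)) ×-dec
     outerplanar? G ×-dec
     injection? α ×-dec
     automorphism? α G ×-dec
     Finₚ.all? (λ x → ρ (α x) Boolₚ.≟ ρ x) ×-dec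
     Finₚ.all? (λ x → π (α x) Finₚ.≟ σ (π x)) ×-dec
     Finₚ.all? (λ x → J (π x) Boolₚ.≟ true) ×-dec
     Finₚ.all? (λ j → (J j Boolₚ.≟ true) →-dec Finₚ.any? (λ x → (π x Finₚ.≟ j) ×-dec (ρ x Boolₚ.≟ true))) ×-dec
     Finₚ.all? (λ x → Finₚ.all? (λ y → (ρ x Boolₚ.≟ true) →-dec ((ρ y Boolₚ.≟ true) →-dec ((π x Finₚ.≟ π y) →-dec (x Finₚ.≟ y))))))

  record Pointed {k N : ℕ} (G : Graph N) (α p : Fin N → Fin N) (b : Fin k → Fin N) : Set where
    field
      simple    : Simple G
      good      : ConnectedOuterplanar G
      injective : Injection α
      aut       : Automorphism α G
      block     : Block G p
      commute   : Commute p α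
      labels    : Injection b
      sound     : ∀ i → p (b i) ≡ b i
      complete  : ∀ x → p x ≡ x → ∃ λ i → b i ≡ x

  record Decomposed {k N : ℕ} (K : Graph k) (σ : Fin k → Fin k)
                    (π : Fin N → Fin k) (ρ : Fin N → Bool) (α : Fin N → Fin N) (H : Graph N) : Set where
    field
      simple    : Simple K
      good      : BlockGraph K
      injective : Injection σ
      aut       : Automorphism σ K
      assembly  : Assembly σ everything π ρ α H

  reassemble : ∀ {k N} → Graph k → (Fin N → Fin k) → (Fin N → Bool) → Graph N → Graph N
  reassemble K π ρ H x y = if does (π x Finₚ.≟ π y) then H x y else ρ x ∧ ρ y ∧ K (π x) (π y)

  record Matches {k N : ℕ} (G : Graph N) (α p : Fin N → Fin N) (b : Fin k → Fin N)
                 (K : Graph k) (σ : Fin k → Fin k) (π : Fin N → Fin k) (ρ : Fin N → Bool) (α′ : Fin N → Fin N) (H : Graph N) : Set where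
    field
      same   : ∀ x → α x ≡ α′ x
      center : ∀ i j → K i j ≡ G (b i) (b j)
      action : ∀ i → α (b i) ≡ b (σ i)
      gates  : ∀ x → b (π x) ≡ p x
      marks  : ∀ x → ρ x ≡ fixed p x
      pieces : ∀ x y → H x y ≡ G x y ∧ (p x ==ᶠ p y)
      whole  : ∀ x y → G x y ≡ reassemble K π ρ H x y

  two-labels : ∀ {k} (i j : Fin k) → i ≢ j → 2 ≤ k
  two-labels {suc zero} zero zero ne = contradiction refl ne
  two-labels {suc (suc k)} _ _ _ = s≤s (s≤s z≤n)

  module _ {k N : ℕ} {G : Graph N} {α p : Fin N → Fin N} {b : Fin k → Fin N}
           {K : Graph k} {σ : Fin k → Fin k} {π : Fin N → Fin k} {ρ : Fin N → Bool} {α′ : Fin N → Fin N} {H : Graph N} where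

    decompose : Pointed G α p b → Matches G α p b K σ π ρ α′ H → Decomposed K σ π ρ α′ H
    decompose P M = record
      { simple    = record { symmetric = λ i j → trans (center i j) (trans (Simple.symmetric simple _ _) (sym (center j i)))
                           ; irreflexive = λ i → trans (center i i) (Simple.irreflexive simple _) }
      ; good      = record
        { size        = let x , y , px , py , ne = Block.two block in two-labels (π x) (π y) (λ e → ne (trans (sym px) (trans (sym (gates x)) (trans (cong b e) (trans (gates y) py)))))
        ; connected   = λ i j _ _ → subst₂ (Path everything K) (πb i) (πb j)
            (path-map π (λ _ _ → refl) (λ x y fx fy → center-edge x y fx fy) (Block.connected block (b i) (b j) (at-fixed i) (at-fixed j)))
        ; no-cut      = λ c i j oi oj → subst₂ (Path (others c) K) (πb i) (πb j)
            (path-map π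
              (λ x e → let f , o = ∧-sound {fixed p x} e in others-complete c (π x) (λ e′ → others-sound (b c) x o (trans (sym (==-sound f)) (trans (sym (gates x)) (cong b e′)))))
              (λ x y fx fy → center-edge x y (proj₁ (∧-sound fx)) (proj₁ (∧-sound fy)))
              (Block.no-cut block (b c) (b i) (b j)
                (∧-complete (at-fixed i) (others-complete (b c) (b i) (others-sound c i oi ∘ labels)))
                (∧-complete (at-fixed j) (others-complete (b c) (b j) (others-sound c j oj ∘ labels)))))
        ; outerplanar = outerplanar-restrict b labels (λ x y e → trans (sym (center x y)) e) (ConnectedOuterplanar.outerplanar good) }
      ; injective = λ {i} {j} e → labels (injective (trans (action i) (trans (cong b e) (sym (action j)))))
      ; aut       = λ i j → trans (center _ _) (trans (cong₂ G (sym (action i)) (sym (action j))) (trans (aut (b i) (b j)) (sym (center i j))))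
      ; assembly  = record
        { simple      = record
          { symmetric   = λ x y → trans (pieces x y) (trans (cong₂ _∧_ (Simple.symmetric simple x y) (==-sym (p x) (p y))) (sym (pieces y x)))
          ; irreflexive = λ x → trans (pieces x x) (cong (_∧ (p x ==ᶠ p x)) (Simple.irreflexive simple x)) }
        ; fibrewise   = λ x y e → labels (trans (gates x) (trans (==-sound (proj₂ (∧-sound {G x y} (trans (sym (pieces x y)) e)))) (sym (gates y))))
        ; joined      = λ x y e → within x ◅◅ subst (λ z → Path everything H z y) (trans (sym (gates y)) (trans (cong b (sym e)) (gates x)))
                          (path-reverse simpleH (within y))
        ; outerplanar = outerplanar-restrict id id (λ x y e → proj₁ (∧-sound (trans (sym (pieces x y)) e))) (ConnectedOuterplanar.outerplanar good)
        ; injective   = λ {x} {y} e → injective (trans (same x) (trans e (sym (same y))))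
        ; aut         = λ x y → trans (pieces _ _) (trans (cong₂ _∧_
                          (trans (cong₂ G (sym (same x)) (sym (same y))) (aut x y))
                          (trans (cong₂ _==ᶠ_ (trans (cong p (sym (same x))) (commute x)) (trans (cong p (sym (same y))) (commute y))) (==-injective (p x) (p y)))) (sym (pieces x y)))
        ; roots       = λ x → trans (marks _) (trans (cong (fixed p) (sym (same x))) (trans (trans (cong (_==ᶠ α x) (commute x)) (==-injective (p x) x)) (sym (marks x))))
        ; equivariant = λ x → labels (trans (gates _) (trans (cong p (sym (same x))) (trans (commute x) (trans (cong α (sym (gates x))) (action _)))))
        ; over        = λ _ → refl
        ; root        = λ j _ → b j , πb j , trans (marks (b j)) (at-fixed j)
        ; root-unique = λ x y rx ry e → trans (sym (at-root x rx)) (trans (sym (gates x)) (trans (cong b e) (trans (gates y) (at-root y ry)))) } }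
      where
      open Pointed P
      open Matches M
      πb : ∀ i → π (b i) ≡ i
      πb i = labels (trans (gates (b i)) (sound i))
      at-fixed : ∀ i → fixed p (b i) ≡ true
      at-fixed i = ==-complete (sound i)
      at-root : ∀ x → ρ x ≡ true → p x ≡ x
      at-root x e = ==-sound (trans (sym (marks x)) e)
      center-edge : ∀ x y → fixed p x ≡ true → fixed p y ≡ true → G x y ≡ true → K (π x) (π y) ≡ true
      center-edge x y fx fy g = trans (center _ _) (trans (cong₂ G (trans (gates x) (==-sound fx)) (trans (gates y) (==-sound fy))) g)
      ==-sym : ∀ {n} (x y : Fin n) → (x ==ᶠ y) ≡ (y ==ᶠ x)
      ==-sym x y = bool-ext (λ e → ==-complete {i = y} {x} (sym (==-sound {i = x} {y} e))) (λ e → ==-complete {i = x} {y} (sym (==-sound {i = y} {x} e)))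
      ==-injective : ∀ x y → (α x ==ᶠ α y) ≡ (x ==ᶠ y)
      ==-injective x y = bool-ext (λ e → ==-complete {i = x} {y} (injective (==-sound {i = α x} {α y} e))) (λ e → ==-complete {i = α x} {α y} (cong α (==-sound {i = x} {y} e)))
      simpleH : Simple H
      simpleH = record
          { symmetric   = λ x y → trans (pieces x y) (trans (cong₂ _∧_ (Simple.symmetric simple x y) (==-sym (p x) (p y))) (sym (pieces y x)))
          ; irreflexive = λ x → trans (pieces x x) (cong (_∧ (p x ==ᶠ p x)) (Simple.irreflexive simple x)) }
      within : ∀ x → Path everything H x (p x)
      within x = path-map id (λ _ _ → refl)
        (λ y z ey ez g → trans (pieces y z) (∧-complete g (==-complete {i = p y} {p z} (trans (==-sound {i = p y} {p x} ey) (sym (==-sound {i = p z} {p x} ez))))))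
        (fibre-path block (ConnectedOuterplanar.connected good) x)

    module _ (D : Decomposed K σ π ρ α′ H) (M : Matches G α p b K σ π ρ α′ H) where

      private
        open Decomposed D
        module A = Assembly assembly
        module C = BlockGraph good
        open Matches M

        b-root : ∀ i → π (b i) ≡ i × ρ (b i) ≡ true
        b-root i with A.root i refl
        ... | x , e , rx = trans (cong π bi≡x) e , trans (cong ρ bi≡x) rx
          where
          bi≡x : b i ≡ x
          bi≡x = trans (cong b (sym e)) (trans (gates x) (==-sound (trans (sym (marks x)) rx)))

        πb : ∀ i → π (b i) ≡ i
        πb i = proj₁ (b-root i)

        at-root : ∀ x → ρ x ≡ true → p x ≡ x
        at-root x e = ==-sound (trans (sym (marks x)) e)

        b-fixed : ∀ i → p (b i) ≡ b i
        b-fixed i = at-root (b i) (proj₂ (b-root i))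

        edge : ∀ x y → G x y ≡ true → (π x ≡ π y × H x y ≡ true) ⊎ (π x ≢ π y × ρ x ≡ true × ρ y ≡ true × K (π x) (π y) ≡ true)
        edge x y g with π x Finₚ.≟ π y | trans (sym (whole x y)) g
        ... | yes e | h = inj₁ (e , h)
        ... | no ne | h = let r , h = ∧-sound {ρ x} h ; r′ , h = ∧-sound {ρ y} h in inj₂ (ne , r , r′ , h)

        H⊆G : ∀ x y → H x y ≡ true → G x y ≡ true
        H⊆G x y h = proj₁ (∧-sound (trans (sym (pieces x y)) h))

        K⊆G : ∀ i j → K i j ≡ true → G (b i) (b j) ≡ true
        K⊆G i j h = trans (sym (center i j)) h

        reassemble-sym : ∀ x y → reassemble K π ρ H x y ≡ reassemble K π ρ H y x
        reassemble-sym x y with π x Finₚ.≟ π y | π y Finₚ.≟ π x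
        ... | yes _ | yes _ = Simple.symmetric A.simple x y
        ... | yes e | no ne = contradiction (sym e) ne
        ... | no ne | yes e = contradiction (sym e) ne
        ... | no _  | no _  = trans (cong (λ z → ρ x ∧ ρ y ∧ z) (Simple.symmetric simple _ _))
          (trans (sym (Boolₚ.∧-assoc (ρ x) (ρ y) _)) (trans (cong (_∧ K (π y) (π x)) (Boolₚ.∧-comm (ρ x) (ρ y))) (Boolₚ.∧-assoc (ρ y) (ρ x) _)))

        reassemble-irreflexive : ∀ x → reassemble K π ρ H x x ≡ false
        reassemble-irreflexive x with π x Finₚ.≟ π x
        ... | yes _ = Simple.irreflexive A.simple x
        ... | no ne = contradiction refl ne

        reassemble-aut : ∀ x y → reassemble K π ρ H (α′ x) (α′ y) ≡ reassemble K π ρ H x y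
        reassemble-aut x y with π (α′ x) Finₚ.≟ π (α′ y) | π x Finₚ.≟ π y
        ... | yes _ | yes _ = A.aut x y
        ... | no _  | no _  = cong₂ _∧_ (A.roots x) (cong₂ _∧_ (A.roots y) (trans (cong₂ K (A.equivariant x) (A.equivariant y)) (aut (π x) (π y))))
        ... | yes e | no ne = contradiction (injective (trans (sym (A.equivariant x)) (trans e (A.equivariant y)))) ne
        ... | no ne | yes e = contradiction (trans (A.equivariant x) (trans (cong σ e) (sym (A.equivariant y)))) ne

        simpleG : Simple G
        simpleG = record { symmetric = λ x y → trans (whole x y) (trans (reassemble-sym x y) (sym (whole y x)))
                         ; irreflexive = λ x → trans (whole x x) (reassemble-irreflexive x) }

        home : ∀ x → Path everything G x (p x)
        home x = path-map id (λ _ _ → refl) (λ y z _ _ → H⊆G y z)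
          (A.joined x (p x) (trans (sym (πb (π x))) (cong π (gates x))))

        connectedG : Connected G
        connectedG x y _ _ = home x ◅◅ subst₂ (Path everything G) (gates x) (gates y)
            (path-map b (λ _ _ → refl) (λ i j _ _ → K⊆G i j) (C.connected (π x) (π y) refl refl)) ◅◅ path-reverse simpleG (home y)

        -- Each fibre is drawn in the place of its root, turned so that the root comes first.
        module Draw where
          open Outerplanar A.outerplanar renaming (key to κ; injective to κ-injective; noCross to κ-noCross)
          module KO = Outerplanar C.outerplanar
          M′ = proj₁ (bounded N κ)
          open Rotation κ M′ (proj₂ (bounded N κ))

          turned-key : Fin N → ℕ
          turned-key x = turn (κ (b (π x))) x

          open Lexicographic (KO.key ∘ π) turned-key (M′ + M′) (λ x → turn-bound (κ (b (π x))) x)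

          same-fibre : ∀ {x y} → KO.key (π x) ≡ KO.key (π y) → π x ≡ π y
          same-fibre = KO.injective

          inj : ∀ {x y} → KO.key (π x) ≡ KO.key (π y) → turned-key x ≡ turned-key y → x ≡ y
          inj {x} {y} e e′ = turn-injective κ-injective (κ (b (π x)))
            (trans e′ (cong (λ i → turn (κ (b i)) y) (sym (same-fibre e))))

          root-first : ∀ {x y} → ρ y ≡ true → π x ≡ π y → x ≺ y → Data.Empty.⊥
          root-first {x} {y} ry e lt = ℕₚ.<⇒≱ (≺-within (cong KO.key e) lt)
            (ℕₚ.≤-trans (ℕₚ.≤-reflexive (trans (cong (λ z → turn (κ z) y) (trans (gates y) (at-root y ry))) (trans (turn-root y) (cong κ (sym (trans (cong b e) (trans (gates y) (at-root y ry))))))))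
              (turn-least (κ (b (π x))) x (ℕₚ.<⇒≤ (proj₂ (bounded N κ) (b (π x))))))

          squeeze : ∀ {x y z} → π x ≡ π z → x ≺ y → y ≺ z → π x ≡ π y
          squeeze {x} {y} {z} e l₁ l₂ = same-fibre (ℕₚ.≤-antisym (≺⇒≤ l₁) (ℕₚ.≤-trans (≺⇒≤ l₂) (ℕₚ.≤-reflexive (cong KO.key (sym e)))))

          cross : ∀ a b′ c d → G a b′ ≡ true → G c d ≡ true → a ≺ c → c ≺ b′ → b′ ≺ d → Data.Empty.⊥
          cross a b′ c d gab gcd l₁ l₂ l₃ with edge a b′ gab | edge c d gcd
          ... | inj₁ (e , _) | inj₂ (_ , rc , _ , _) = root-first rc (squeeze e l₁ l₂) l₁
          ... | inj₂ (_ , _ , rb , _) | inj₁ (e , _) = root-first rb (squeeze e l₂ l₃) l₂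
          ... | inj₁ (e , hab) | inj₁ (e′ , hcd) =
              turn-noCross A.simple κ-noCross (κ (b (π a))) a b′ c d hab hcd
                (align refl ac (≺-within (cong KO.key ac) l₁)) (align ac (trans (sym ac) e) (≺-within (cong KO.key (trans (sym ac) e)) l₂)) (align e bd (≺-within (cong KO.key bd) l₃))
            where
            ac : π a ≡ π c
            ac = squeeze e l₁ l₂
            bd : π b′ ≡ π d
            bd = trans (sym e) (trans ac e′)
            align : ∀ {x y} → π a ≡ π x → π x ≡ π y → turned-key x < turned-key y → turn (κ (b (π a))) x < turn (κ (b (π a))) y
            align {x} {y} ax xy lt = subst₂ _<_ (cong (λ i → turn (κ (b i)) x) (sym ax)) (cong (λ i → turn (κ (b i)) y) (sym (trans ax xy))) lt
          ... | inj₂ (nab , ra , rb , kab) | inj₂ (ncd , rc , rd , kcd) =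
              KO.noCross (π a) (π b′) (π c) (π d) kab kcd (strict ra rc l₁) (strict rc rb l₂) (strict rb rd l₃)
            where
            strict : ∀ {x y} → ρ x ≡ true → ρ y ≡ true → x ≺ y → KO.key (π x) < KO.key (π y)
            strict rx ry (inj₁ l) = l
            strict {x} {y} rx ry lt@(inj₂ (e , _)) = Data.Empty.⊥-elim (root-first ry (same-fibre e) lt)

          outerplanarG : Outerplanar G
          outerplanarG = lexicographic inj cross

      compose-pieces : Pointed G α p b
      compose-pieces = record
        { simple    = simpleG
        ; good      = record { nonempty = nonempty N (b (first C.size)) ; connected = connectedG ; outerplanar = Draw.outerplanarG }
        ; injective = λ {x} {y} e → A.injective (trans (sym (same x)) (trans e (same y)))
        ; aut       = λ x y → trans (whole _ _) (trans (cong₂ (reassemble K π ρ H) (same x) (same y)) (trans (reassemble-aut x y) (sym (whole x y))))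
        ; block     = record
          { idempotent = λ x → trans (cong p (sym (gates x))) (trans (b-fixed (π x)) (gates x))
          ; edges      = λ x y g → Data.Sum.map (λ (e , _) → trans (sym (gates x)) (trans (cong b e) (gates y))) (λ (_ , rx , ry , _) → at-root x rx , at-root y ry) (edge x y g)
          ; two        = b (first C.size) , b (second C.size) , b-fixed _ , b-fixed _ , (λ e → first≢second C.size (trans (sym (πb _)) (trans (cong π e) (πb _))))
          ; connected  = λ u v fu fv → subst₂ (Path (fixed p) G) (trans (gates u) (==-sound fu)) (trans (gates v) (==-sound fv))
              (path-map b (λ i _ → ==-complete (b-fixed i)) (λ i j _ _ → K⊆G i j) (C.connected (π u) (π v) refl refl))
          ; no-cut     = no-cutG }
        ; commute   = λ x → trans (sym (gates _)) (trans (cong (b ∘ π) (same x)) (trans (cong b (A.equivariant x)) (trans (sym (action (π x))) (cong α (gates x)))))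
        ; labels    = λ {i} {j} e → trans (sym (πb i)) (trans (cong π e) (πb j))
        ; sound     = b-fixed
        ; complete  = λ x e → π x , trans (gates x) e }
        where
        nonempty : ∀ m → Fin m → 1 ≤ m
        nonempty (suc m) _ = s≤s z≤n
        first : ∀ {k} → 2 ≤ k → Fin k
        first (s≤s (s≤s _)) = zero
        second : ∀ {k} → 2 ≤ k → Fin k
        second (s≤s (s≤s _)) = suc zero
        first≢second : ∀ {k} (le : 2 ≤ k) → first le ≢ second le
        first≢second (s≤s (s≤s _)) ()
        no-cutG : ∀ c → ConnectedOn (λ x → fixed p x ∧ others c x) G
        no-cutG c u v su sv with ∧-sound {fixed p u} su | ∧-sound {fixed p v} sv | p c Finₚ.≟ c
        ... | fu , ou | fv , ov | yes pc = subst₂ (Path (λ x → fixed p x ∧ others c x) G) (trans (gates u) (==-sound fu)) (trans (gates v) (==-sound fv))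
              (path-map b (λ i oi → ∧-complete (==-complete (b-fixed i)) (others-complete c (b i) (λ e → others-sound (π c) i oi (trans (sym (πb i)) (cong π e)))))
                (λ i j _ _ → K⊆G i j)
                (C.no-cut (π c) (π u) (π v) (away u fu ou) (away v fv ov)))
          where
          away : ∀ u → fixed p u ≡ true → others c u ≡ true → others (π c) (π u) ≡ true
          away u fu ou = others-complete (π c) (π u) (λ e → others-sound c u ou (trans (sym (==-sound fu)) (trans (sym (gates u)) (trans (cong b e) (trans (gates c) pc)))))
        ... | fu , ou | fv , ov | no ¬pc = subst₂ (Path (λ x → fixed p x ∧ others c x) G) (trans (gates u) (==-sound fu)) (trans (gates v) (==-sound fv))
              (path-map b (λ i _ → ∧-complete (==-complete (b-fixed i)) (others-complete c (b i) (λ e → ¬pc (subst (λ z → p z ≡ z) e (b-fixed i)))))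
                (λ i j _ _ → K⊆G i j) (C.connected (π u) (π v) refl refl))

open Decomposition

module Enumerating where

  open import Data.Nat using (_≤_; _<_; s≤s)

  private variable
    A : Set
    n : ℕ

  ∑-pull : (xs : List A) (ks : List ℕ) (c : A → ℚ) (w : ℕ → ℚ) (h : ℕ → A → ℚ) →
    ∑ xs (λ x → c x *ℚ ∑ ks (λ k → w k *ℚ h k x)) ≡ ∑ ks (λ k → w k *ℚ ∑ xs (λ x → c x *ℚ h k x))
  ∑-pull xs ks c w h = begin
    _ ≡⟨ ∑-cong xs (λ x → sym (∑-*ˡ ks (c x) _)) ⟩
    _ ≡⟨ ∑-swap xs ks _ ⟩
    _ ≡⟨ ∑-cong ks (λ k → trans (∑-cong xs (λ x → swap*ˡ (c x) (w k) (h k x))) (∑-*ˡ xs (w k) _)) ⟩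
    _ ∎

  upto : ℕ → List ℕ
  upto D = upTo (suc D)

  ∑-upto : ∀ D c (f : ℕ → ℚ) → c ≤ D → (∀ k → k ≢ c → f k ≡ 0ℚ) → ∑ (upto D) f ≡ f c
  ∑-upto D c f c≤D z = go (suc D) id c (s≤s c≤D) refl (λ _ _ e → e)
    where
    go : ∀ m (g : ℕ → ℕ) t → t < m → g t ≡ c → (∀ s s′ → g s ≡ g s′ → s ≡ s′) → ∑ (Data.List.applyUpTo g m) f ≡ f c
    none : ∀ m (g : ℕ → ℕ) → (∀ s → g s ≢ c) → ∑ (Data.List.applyUpTo g m) f ≡ 0ℚ
    none zero    g ne = refl
    none (suc m) g ne = trans (cong₂ _+ℚ_ (z (g 0) (ne 0)) (none m (g ∘ suc) (ne ∘ suc))) (ℚₚ.+-identityʳ 0ℚ)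
    go (suc m) g zero    _        e inj = trans (cong₂ _+ℚ_ (cong f e) (none m (g ∘ suc) (λ s e′ → ℕₚ.1+n≢0 (inj _ _ (trans e′ (sym e)))))) (ℚₚ.+-identityʳ (f c))
    go (suc m) g (suc t) (s≤s lt) e inj = trans (cong₂ _+ℚ_ (z (g 0) (λ e′ → ℕₚ.0≢1+n (inj _ _ (trans e′ (sym e))))) (go m (g ∘ suc) t lt e (λ s s′ e′ → ℕₚ.suc-injective (inj _ _ e′))))
      (ℚₚ.+-identityˡ (f c))

  record Enumerates {n k} (S : Fin n → Bool) (b : Fin k → Fin n) : Set where
    field
      injective : Injection b
      sound     : ∀ i → S (b i) ≡ true
      complete  : ∀ x → S x ≡ true → ∃ λ i → b i ≡ x

  enumerates? : ∀ {n k} (S : Fin n → Bool) (b : Fin k → Fin n) → Dec (Enumerates S b)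
  enumerates? S b = map′ (λ (i , s , c) → record { injective = λ {_} {_} → i ; sound = s ; complete = c })
    (λ e → (λ {_} {_} → Enumerates.injective e) , Enumerates.sound e , Enumerates.complete e)
    (injection? b ×-dec Finₚ.all? (λ i → S (b i) Boolₚ.≟ true) ×-dec
     Finₚ.all? (λ x → (S x Boolₚ.≟ true) →-dec Finₚ.any? (λ i → b i Finₚ.≟ x)))

  enumerates-count : ∀ {n k} {S : Fin n → Bool} {b : Fin k → Fin n} → Enumerates S b → count n S ≡ k
  enumerates-count {b = b} e = count-enumerated (record { at = b ; injective = injective ; sound = sound ; complete = complete })
    where open Enumerates e

  enumerations : ∀ n k (S : Fin n → Bool) → ℚ
  enumerations n k S = sum (vec (fin n) k) (λ b → χ (enumerates? S (lookup b)))

  enumerations-count : ∀ n (S : Fin n → Bool) → enumerations n (count n S) S ≡ ι (length (perms (count n S)))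
  enumerations-count n S = trans (trans (∑-cong (elems (vec (fin n) c)) (λ b → sym (ℚₚ.*-identityʳ _)))
    (trans (bijection (vec (fin n) c) (selfMaps c) (λ b → enumerates? S (lookup b)) (λ t → injection? (lookup t))
      (λ b t → ∀ i → lookup b i ≡ at (lookup t i))
      (λ b e → let open Enumerates e
                   t = λ i → proj₁ (E.complete (lookup b i) (sound i))
                   te = λ i → proj₂ (E.complete (lookup b i) (sound i))
                   lt = Vecₚ.lookup∘tabulate t in
         tabulate t ,
         (λ {i} {j} h → injective (trans (sym (te i)) (trans (cong at (trans (sym (lt i)) (trans h (lt j)))) (te j)))) ,
         (λ i → trans (sym (te i)) (cong at (sym (lt i)))))
      (λ t inj → let lb = Vecₚ.lookup∘tabulate (at ∘ lookup t) in
         tabulate (at ∘ lookup t) ,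
         record { injective = λ {i} {j} h → inj (E.injective (trans (sym (lb i)) (trans h (lb j))))
                ; sound = λ i → trans (cong S (lb i)) (E.sound _)
                ; complete = λ x sx → let j , e = E.complete x sx ; i , e′ = surjective (lookup t) inj ℕₚ.≤-refl j in i , trans (lb i) (trans (cong at e′) e) } ,
         lb)
      (λ _ _ _ e e′ → lookup-injective _ _ (λ i → E.injective (trans (sym (e i)) (e′ i))))
      (λ _ _ _ e e′ → lookup-injective _ _ (λ i → trans (e i) (sym (e′ i))))
      (λ _ → 1ℚ) (λ _ → 1ℚ) (λ _ _ _ → refl))
    (∑-cong (elems (selfMaps c)) (λ t → ℚₚ.*-identityʳ _)))) (sym (ι-perms c))
    where
    c = count n S
    module E = Enumeration (enumeration n S)
    open E using (at)

  enumerations-weigh-1 : ∀ D n (S : Fin n → Bool) → n ≤ D → ∑ (upto D) (λ k → weight k *ℚ enumerations n k S) ≡ 1ℚ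
  enumerations-weigh-1 D n S n≤D = trans
    (∑-upto D (count n S) _ (ℕₚ.≤-trans c≤n n≤D) (λ k ne → trans (cong (weight k *ℚ_)
      (∑-vanish (elems (vec (fin n) k)) (λ b → χ-no (enumerates? S (lookup b)) (λ e → ne (sym (enumerates-count e)))))) (ℚₚ.*-zeroʳ (weight k))))
    (trans (cong (weight (count n S) *ℚ_) (enumerations-count n S)) (weight-ι (count n S)))
    where
    c≤n : count n S ≤ n
    c≤n = Finₚ.injective⇒≤ (Enumeration.injective (enumeration n S))

  -- Classes of unrooted graphs and their vertex-rooted versions

  fixedPoints : ∀ {n} → (Fin n → Fin n) → ℚ
  fixedPoints {n} α = sum (fin n) (λ v → χ (α v Finₚ.≟ v))

  pairSum : (∀ {n} → Graph n → Bool) → ∀ n → (Vec (Fin n) n → ℚ) → ℚ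
  pairSum c n f = sum (graphs n) (λ g → χ (simple? (app g)) *ℚ (χᵇ (c (app g)) *ℚ
    sum (selfMaps n) (λ a → χ (injection? (lookup a)) *ℚ (χ (automorphism? (lookup a) (app g)) *ℚ f a))))

  pairSum-cong : ∀ (c : ∀ {n} → Graph n → Bool) n {f f′ : Vec (Fin n) n → ℚ} → (∀ a → Injection (lookup a) → f a ≡ f′ a) →
    pairSum c n f ≡ pairSum c n f′
  pairSum-cong c n e = ∑-cong (elems (graphs n)) (λ g → cong (λ z → χ (simple? (app g)) *ℚ (χᵇ (c (app g)) *ℚ z))
    (∑-cong (elems (selfMaps n)) (λ a → χ-guard (injection? (lookup a)) (λ inj → cong (χ (automorphism? (lookup a) (app g)) *ℚ_) (e a inj)))))

  classSum-unrooted : (K : Class) (c : ∀ {n} → Graph n → Bool) → (∀ n (G : Graph n) → K n (G , nothing) ≡ c G) →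
    (∀ n (G : Graph n) r → K n (G , just r) ≡ false) → ∀ n (f : (Fin n → Fin n) → ℚ) →
    classSum K n f ≡ pairSum c n (f ∘ lookup)
  classSum-unrooted K c e₀ e₁ n f = ∑-cong (elems (graphs n)) (λ g → cong (χ (simple? (app g)) *ℚ_)
    (trans (cong₂ _+ℚ_ (cong₂ _*ℚ_ (cong χᵇ (e₀ n (app g)))
        (∑-cong (elems (selfMaps n)) (λ a → cong (λ z → χ (injection? (lookup a)) *ℚ (z *ℚ f (lookup a)))
          (χ-⇔ (iso? (lookup a) (app g , nothing) (app g , nothing)) (automorphism? (lookup a) (app g)) proj₁ (λ h → h , refl)))))
      (trans (∑-map just (elems (fin n)) _) (∑-vanish (elems (fin n)) (λ r → trans (cong (λ z → χᵇ z *ℚ autSum (app g , just r) f) (e₁ n (app g) r)) (ℚₚ.*-zeroˡ (autSum (app g , just r) f))))))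
    (ℚₚ.+-identityʳ _)))

  classSum-rooted′ : (K : Class) (c : ∀ {n} → Graph n → Bool) → (∀ n (G : Graph n) → K n (G , nothing) ≡ false) →
    (∀ n (G : Graph n) r → K n (G , just r) ≡ c G) → ∀ n (f : (Fin n → Fin n) → ℚ) →
    classSum K n f ≡ sum (graphs n) (λ g → χ (simple? (app g)) *ℚ (χᵇ (c (app g)) *ℚ sum (fin n) (λ r →
      sum (selfMaps n) (λ a → χ (injection? (lookup a)) *ℚ (χ (automorphism? (lookup a) (app g)) *ℚ (χ (lookup a r Finₚ.≟ r) *ℚ f (lookup a)))))))
  classSum-rooted′ K c e₀ e₁ n f = ∑-cong (elems (graphs n)) (λ g → cong (χ (simple? (app g)) *ℚ_)
    (trans (cong₂ _+ℚ_ (trans (cong (λ z → χᵇ z *ℚ autSum (app g , nothing) f) (e₀ n (app g))) (ℚₚ.*-zeroˡ (autSum (app g , nothing) f)))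
      (trans (∑-map just (elems (fin n)) _) (trans (∑-cong (elems (fin n)) (λ r → cong₂ _*ℚ_ (cong χᵇ (e₁ n (app g) r)) (roots g r)))
        (∑-*ˡ (elems (fin n)) (χᵇ (c (app g))) _))))
    (ℚₚ.+-identityˡ _)))
    where
    roots : ∀ g r → autSum (app g , just r) f ≡
      sum (selfMaps n) (λ a → χ (injection? (lookup a)) *ℚ (χ (automorphism? (lookup a) (app g)) *ℚ (χ (lookup a r Finₚ.≟ r) *ℚ f (lookup a))))
    roots g r = ∑-cong (elems (selfMaps n)) (λ a → cong (χ (injection? (lookup a)) *ℚ_)
      (trans (cong (_*ℚ f (lookup a)) (trans
        (χ-⇔ (iso? (lookup a) (app g , just r) (app g , just r)) (automorphism? (lookup a) (app g) ×-dec (lookup a r Finₚ.≟ r))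
          (λ (h , e) → h , Maybeₚ.just-injective e) (λ (h , e) → h , cong just e))
        (χ-× (automorphism? (lookup a) (app g)) (lookup a r Finₚ.≟ r))))
        (ℚₚ.*-assoc (χ (automorphism? (lookup a) (app g))) _ _)))

  classSum-rooted : (K : Class) (c : ∀ {n} → Graph n → Bool) → (∀ n (G : Graph n) → K n (G , nothing) ≡ false) →
    (∀ n (G : Graph n) r → K n (G , just r) ≡ c G) → ∀ n (f : (Fin n → Fin n) → ℚ) →
    classSum K n f ≡ pairSum c n (λ a → fixedPoints (lookup a) *ℚ f (lookup a))
  classSum-rooted K c e₀ e₁ n f = trans (classSum-rooted′ K c e₀ e₁ n f)
    (∑-cong (elems (graphs n)) (λ g → cong (λ z → χ (simple? (app g)) *ℚ (χᵇ (c (app g)) *ℚ z))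
      (trans (∑-swap (elems (fin n)) (elems (selfMaps n)) _) (∑-cong (elems (selfMaps n)) (λ a →
        trans (∑-*ˡ (elems (fin n)) (χ (injection? (lookup a))) _) (cong (χ (injection? (lookup a)) *ℚ_)
          (trans (∑-*ˡ (elems (fin n)) (χ (automorphism? (lookup a) (app g))) _) (cong (χ (automorphism? (lookup a) (app g)) *ℚ_)
            (∑-*ʳ (elems (fin n)) (f (lookup a)) _)))))))))

  pairSum-- : ∀ (c : ∀ {n} → Graph n → Bool) n (f f′ : Vec (Fin n) n → ℚ) →
    pairSum c n f -ℚ pairSum c n f′ ≡ pairSum c n (λ a → f a -ℚ f′ a)
  pairSum-- c n f f′ = trans (cong (pairSum c n f +ℚ_) (sym (negate f′))) (sym (add f (λ a → -ℚ f′ a)))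
    where
    gs = elems (graphs n)
    as = elems (selfMaps n)
    add : ∀ f h → pairSum c n (λ a → f a +ℚ h a) ≡ pairSum c n f +ℚ pairSum c n h
    add f h = trans (∑-cong gs (λ g → trans (cong (λ z → χ (simple? (app g)) *ℚ (χᵇ (c (app g)) *ℚ z)) (trans
        (∑-cong as (λ a → trans (cong (χ (injection? (lookup a)) *ℚ_) (ℚₚ.*-distribˡ-+ (χ (automorphism? (lookup a) (app g))) (f a) (h a)))
          (ℚₚ.*-distribˡ-+ (χ (injection? (lookup a))) _ _)))
        (∑-+ as _ _)))
        (trans (cong (χ (simple? (app g)) *ℚ_) (ℚₚ.*-distribˡ-+ (χᵇ (c (app g))) _ _)) (ℚₚ.*-distribˡ-+ (χ (simple? (app g))) _ _))))
      (∑-+ gs _ _)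
    neg : ∀ x → -ℚ x ≡ (-ℚ 1ℚ) *ℚ x
    neg x = trans (cong -ℚ_ (sym (ℚₚ.*-identityˡ x))) (ℚₚ.neg-distribˡ-* 1ℚ x)
    negate : ∀ f → pairSum c n (λ a → -ℚ f a) ≡ -ℚ pairSum c n f
    negate f = trans (∑-cong gs (λ g → trans (cong (λ z → χ (simple? (app g)) *ℚ (χᵇ (c (app g)) *ℚ z)) (trans
        (∑-cong as (λ a → trans (cong (λ z → χ (injection? (lookup a)) *ℚ (χ (automorphism? (lookup a) (app g)) *ℚ z)) (neg (f a)))
          (trans (cong (χ (injection? (lookup a)) *ℚ_) (swap*ˡ (χ (automorphism? (lookup a) (app g))) (-ℚ 1ℚ) (f a))) (swap*ˡ (χ (injection? (lookup a))) (-ℚ 1ℚ) _))))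
        (∑-*ˡ as (-ℚ 1ℚ) _)))
        (trans (cong (χ (simple? (app g)) *ℚ_) (swap*ˡ (χᵇ (c (app g))) (-ℚ 1ℚ) _)) (swap*ˡ (χ (simple? (app g))) (-ℚ 1ℚ) _))))
      (trans (∑-*ˡ gs (-ℚ 1ℚ) _) (sym (neg (pairSum c n f))))

  ⟪⟫-ZPoly : ∀ K D φ → ⟪ ZPoly K D , φ ⟫ ≡ ∑ (upto D) (λ n → ⟪ classTerms K n , φ ⟫)
  ⟪⟫-ZPoly K D φ = ∑-concatMap (classTerms K) (upto D) _

  -- Z(𝒦) − Z(𝒦̂), for a class 𝒦 and its vertex-rooted version.
  ⟪⟫-difference : (U R : Class) (c : ∀ {n} → Graph n → Bool) →
    (∀ n {G H : Graph n} → G ≗₂ H → c G ≡ c H) →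
    (∀ n (G : Graph n) → U n (G , nothing) ≡ c G) → (∀ n (G : Graph n) r → U n (G , just r) ≡ false) →
    (∀ n (G : Graph n) → R n (G , nothing) ≡ false) → (∀ n (G : Graph n) r → R n (G , just r) ≡ c G) →
    ∀ D φ → ⟪ ZPoly U D , φ ⟫ -ℚ ⟪ ZPoly R D , φ ⟫ ≡
    ∑ (upto D) (λ n → weight n *ℚ pairSum c n (λ a → (1ℚ -ℚ fixedPoints (lookup a)) *ℚ φ (cycType (lookup a))))
  ⟪⟫-difference U R c ext u₀ u₁ r₀ r₁ D φ = begin
    ⟪ ZPoly U D , φ ⟫ -ℚ ⟪ ZPoly R D , φ ⟫
      ≡⟨ cong₂ _-ℚ_ (⟪⟫-ZPoly U D φ) (⟪⟫-ZPoly R D φ) ⟩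
    ∑ ns (λ n → ⟪ classTerms U n , φ ⟫) -ℚ ∑ ns (λ n → ⟪ classTerms R n , φ ⟫)
      ≡⟨ cong₂ _-ℚ_
           (∑-cong ns (λ n → trans (⟪⟫-classTerms {n} U (extU {n}) φ) (cong (weight n *ℚ_) (classSum-unrooted U c u₀ u₁ n (φ ∘ cycType)))))
           (∑-cong ns (λ n → trans (⟪⟫-classTerms {n} R (extR {n}) φ) (cong (weight n *ℚ_) (classSum-rooted R c r₀ r₁ n (φ ∘ cycType))))) ⟩
    ∑ ns (λ n → weight n *ℚ pairSum c n (F n)) -ℚ ∑ ns (λ n → weight n *ℚ pairSum c n (F̂ n))
      ≡⟨ minus ns (λ n → weight n *ℚ pairSum c n (F n)) (λ n → weight n *ℚ pairSum c n (F̂ n)) ⟩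
    ∑ ns (λ n → weight n *ℚ pairSum c n (F n) -ℚ weight n *ℚ pairSum c n (F̂ n))
      ≡⟨ ∑-cong ns (λ n → trans (solve 3 (λ w x y → w :* x :- w :* y := w :* (x :- y)) refl (weight n) (pairSum c n (F n)) (pairSum c n (F̂ n)))
           (cong (weight n *ℚ_) (trans (pairSum-- c n (F n) (F̂ n)) (pairSum-cong c n (λ a _ →
             solve 2 (λ x y → y :- x :* y := (con 1ℚ :- x) :* y) refl (fixedPoints (lookup a)) (φ (cycType (lookup a)))))))) ⟩
    _ ∎
    where
    open +-*-Solver
    ns = upto D
    F F̂ : ∀ n → Vec (Fin n) n → ℚ
    F n a = φ (cycType (lookup a))
    F̂ n a = fixedPoints (lookup a) *ℚ φ (cycType (lookup a))
    extU : ∀ {n} {G H : Graph n} r → G ≗₂ H → U n (G , r) ≡ U n (H , r)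
    extU {n} nothing  e = trans (u₀ n _) (trans (ext n e) (sym (u₀ n _)))
    extU {n} (just r) e = trans (u₁ n _ r) (sym (u₁ n _ r))
    extR : ∀ {n} {G H : Graph n} r → G ≗₂ H → R n (G , r) ≡ R n (H , r)
    extR {n} nothing  e = trans (r₀ n _) (sym (r₀ n _))
    extR {n} (just r) e = trans (r₁ n _ r) (trans (ext n e) (sym (r₁ n _ r)))
    minus : ∀ (xs : List ℕ) (f g : ℕ → ℚ) → ∑ xs f -ℚ ∑ xs g ≡ ∑ xs (λ x → f x -ℚ g x)
    minus []       f g = refl
    minus (x ∷ xs) f g = trans (solve 4 (λ a b c d → (a :+ b) :- (c :+ d) := (a :- c) :+ (b :- d)) refl (f x) (∑ xs f) (g x) (∑ xs g)) (cong (f x -ℚ g x +ℚ_) (minus xs f g))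

open Enumerating

module BlockCounting where


  private variable
    n : ℕ

  cᶜ cᵈ : Graph n → Bool
  cᶜ G = connectedB G ∧ outerplanarB G
  cᵈ G = dissectionB G ∨ singleEdgeB G

  χ-cᶜ : (G : Graph n) → χᵇ (cᶜ G) ≡ χ (connectedOuterplanar? G)
  χ-cᶜ G = χᵇ-dec (cᶜ G) (connectedOuterplanar? G) (𝒞-sound G) (𝒞-complete G)

  χ-cᵈ : (G : Graph n) → χᵇ (cᵈ G) ≡ χ (blockGraph? G)
  χ-cᵈ G = χᵇ-dec (cᵈ G) (blockGraph? G) (𝒟-sound G) (𝒟-complete G)

  pointed? : ∀ {k N} (G : Graph N) (α p : Fin N → Fin N) (b : Fin k → Fin N) → Dec (Pointed G α p b)
  pointed? G α p b = map′ pack unpack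
    (simple? G ×-dec connectedOuterplanar? G ×-dec injection? α ×-dec automorphism? α G ×-dec
     block? G p ×-dec commute? p α ×-dec enumerates? (fixed p) b)
    where
    Parts : Set
    Parts = Simple G × ConnectedOuterplanar G × Injection α × Automorphism α G × Block G p × Commute p α × Enumerates (fixed p) b
    pack : Parts → Pointed G α p b
    pack (s , c , i , a , bl , co , e) = record
      { simple = s ; good = c ; injective = i ; aut = a ; block = bl ; commute = co
      ; labels = Enumerates.injective e ; sound = λ j → ==-sound (Enumerates.sound e j) ; complete = λ x h → Enumerates.complete e x (==-complete h) }
    unpack : Pointed G α p b → Parts
    unpack P = simple , good , injective , aut , block , commute ,
      record { injective = labels ; sound = λ j → ==-complete (sound j) ; complete = λ x h → complete x (==-sound h) }
      where open Pointed P

  decomposed? : ∀ {k N} (K : Graph k) (σ : Fin k → Fin k) (π : Fin N → Fin k) ρ α H → Dec (Decomposed K σ π ρ α H)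
  decomposed? K σ π ρ α H = map′
    (λ (s , b , i , a , as) → record { simple = s ; good = b ; injective = λ {_} {_} → i ; aut = a ; assembly = as })
    (λ D → let open Decomposed D in simple , good , (λ {_} {_} → injective) , aut , assembly)
    (simple? K ×-dec blockGraph? K ×-dec injection? σ ×-dec automorphism? σ K ×-dec assembly? σ everything π ρ α H)

  module _ {k N : ℕ} {G : Graph N} {α p : Fin N → Fin N} {b : Fin k → Fin N}
           {K : Graph k} {σ : Fin k → Fin k} {π : Fin N → Fin k} {ρ : Fin N → Bool} {α′ : Fin N → Fin N} {H : Graph N}
           (P : Pointed G α p b) (M : Matches G α p b K σ π ρ α′ H) where

    label-at : ∀ i → π (b i) ≡ i
    label-at i = Pointed.labels P (trans (Matches.gates M (b i)) (Pointed.sound P i))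

    label-root : ∀ i → ρ (b i) ≡ true
    label-root i = trans (Matches.marks M (b i)) (==-complete (Pointed.sound P i))

  pieces : ∀ k N → Finite (Vec (Vec Bool N) N × Vec (Fin N) N × Vec (Fin k) N × Vec Bool N)
  pieces k N = graphs N ⊗ selfMaps N ⊗ vec (fin k) N ⊗ vec bool N

  assemblySum : ∀ {k} → (Fin k → Fin k) → (Fin k → Bool) → ∀ N → (Vec (Fin N) N → ℚ) → ℚ
  assemblySum {k} σ J N f = sum (pieces k N) (λ (h , a , π , ρ) → χ (assembly? σ J (lookup π) (lookup ρ) (lookup a) (app h)) *ℚ f a)

  fixedFlags : (p α : Fin n → Fin n) → ℚ
  fixedFlags {n} p α = sum (fin n) (λ v → χ (p v Finₚ.≟ v) *ℚ χ (α v Finₚ.≟ v))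

  module _ (k N : ℕ) where

    private
      X = graphs N ⊗ selfMaps N ⊗ selfMaps N ⊗ vec (fin N) k
      Y = graphs k ⊗ selfMaps k ⊗ pieces k N

    fixedFlags-labels : ∀ {G : Graph N} {α p : Fin N → Fin N} {b : Fin k → Fin N} {σ : Fin k → Fin k} →
      Pointed G α p b → (∀ i → α (b i) ≡ b (σ i)) → fixedFlags p α ≡ fixedPoints σ
    fixedFlags-labels {α = α} {p} {b} {σ} P action = trans
      (∑-cong (elems (fin N)) (λ v → trans (sym (χ-× (p v Finₚ.≟ v) (α v Finₚ.≟ v))) (sym (ℚₚ.*-identityʳ _))))
      (trans (bijection (fin N) (fin k) (λ v → (p v Finₚ.≟ v) ×-dec (α v Finₚ.≟ v)) (λ i → σ i Finₚ.≟ i) (λ v i → b i ≡ v)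
        (λ v (pv , αv) → let i , e = complete v pv in i , labels (trans (sym (action i)) (trans (cong α e) (trans αv (sym e)))) , e)
        (λ i σi → b i , (sound i , trans (action i) (cong b σi)) , refl)
        (λ _ _ _ e e′ → labels (trans e (sym e′)))
        (λ _ _ _ e e′ → trans (sym e) e′)
        (λ _ → 1ℚ) (λ _ → 1ℚ) (λ _ _ _ → refl))
      (∑-cong (elems (fin k)) (λ i → ℚₚ.*-identityʳ _)))
      where open Pointed P

    block-decomposition : (Φ : (Fin N → Fin N) → ℚ) → Extensional Φ →
      sum X (λ (g , a , p , b) → χ (pointed? (app g) (lookup a) (lookup p) (lookup b)) *ℚ ((1ℚ -ℚ fixedFlags (lookup p) (lookup a)) *ℚ Φ (lookup a))) ≡
      sum Y (λ (κ , s , h , a , π , ρ) → χ (decomposed? (app κ) (lookup s) (lookup π) (lookup ρ) (lookup a) (app h)) *ℚ ((1ℚ -ℚ fixedPoints (lookup s)) *ℚ Φ (lookup a)))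
    block-decomposition Φ ext = bijection X Y
      (λ (g , a , p , b) → pointed? (app g) (lookup a) (lookup p) (lookup b))
      (λ (κ , s , h , a , π , ρ) → decomposed? (app κ) (lookup s) (lookup π) (lookup ρ) (lookup a) (app h))
      R to from (λ {x} {y} {y′} → functional {x} {y} {y′}) (λ {x} {x′} {y} → injective {x} {x′} {y})
      (λ (g , a , p , b) → (1ℚ -ℚ fixedFlags (lookup p) (lookup a)) *ℚ Φ (lookup a))
      (λ (κ , s , h , a , π , ρ) → (1ℚ -ℚ fixedPoints (lookup s)) *ℚ Φ (lookup a))
      (λ {x} {y} P _ M → cong₂ (λ t z → (1ℚ -ℚ t) *ℚ z) (fixedFlags-labels P (Matches.action M)) (ext (Matches.same M)))
      where
      XT = Vec (Vec Bool N) N × Vec (Fin N) N × Vec (Fin N) N × Vec (Fin N) k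
      YT = Vec (Vec Bool k) k × Vec (Fin k) k × Vec (Vec Bool N) N × Vec (Fin N) N × Vec (Fin k) N × Vec Bool N
      PX : XT → Set
      PX (g , a , p , b) = Pointed (app g) (lookup a) (lookup p) (lookup b)
      QY : YT → Set
      QY (κ , s , h , a , π , ρ) = Decomposed (app κ) (lookup s) (lookup π) (lookup ρ) (lookup a) (app h)
      R : XT → YT → Set
      R (g , a , p , b) (κ , s , h , a′ , π , ρ) = Matches (app g) (lookup a) (lookup p) (lookup b) (app κ) (lookup s) (lookup π) (lookup ρ) (lookup a′) (app h)
      to : ∀ x → PX x → ∃ λ y → QY y × R x y
      to (g , a , p , b) P = (mk K , tabulate σ , mk H , a , tabulate π , tabulate ρ) , decompose P M , M
        where
        open Pointed P
        G = app g
        at : ∀ x → ∃ λ i → lookup b i ≡ lookup p x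
        at x = complete (lookup p x) (Block.idempotent block x)
        act : ∀ i → ∃ λ j → lookup b j ≡ lookup a (lookup b i)
        act i = complete _ (trans (commute (lookup b i)) (cong (lookup a) (sound i)))
        K : Graph k
        K i j = G (lookup b i) (lookup b j)
        σ : Fin k → Fin k
        σ i = proj₁ (act i)
        π : Fin N → Fin k
        π x = proj₁ (at x)
        ρ : Fin N → Bool
        ρ = fixed (lookup p)
        H : Graph N
        H x y = G x y ∧ (lookup p x ==ᶠ lookup p y)
        π-gate : ∀ x → lookup b (lookup (tabulate π) x) ≡ lookup p x
        π-gate x = trans (cong (lookup b) (Vecₚ.lookup∘tabulate π x)) (proj₂ (at x))
        whole : ∀ x y → G x y ≡ reassemble (app (mk K)) (lookup (tabulate π)) (lookup (tabulate ρ)) (app (mk H)) x y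
        whole x y with lookup (tabulate π) x Finₚ.≟ lookup (tabulate π) y
        ... | yes e = sym (trans (app-mk H x y) (trans (cong (G x y ∧_) (==-complete {i = lookup p x} {lookup p y}
                (trans (sym (π-gate x)) (trans (cong (lookup b) e) (π-gate y))))) (Boolₚ.∧-identityʳ (G x y))))
        ... | no ne = bool-ext
                (λ g → case-edge (Block.edges block x y g) g)
                (λ e → let r , e = ∧-sound {lookup (tabulate ρ) x} e
                           r′ , e = ∧-sound {lookup (tabulate ρ) y} e in
                  trans (sym (cong₂ G (root-at x r) (root-at y r′))) (trans (sym (app-mk K _ _)) e))
          where
          root-at : ∀ x → lookup (tabulate ρ) x ≡ true → lookup b (lookup (tabulate π) x) ≡ x
          root-at x r = trans (π-gate x) (==-sound {i = lookup p x} {x} (trans (sym (Vecₚ.lookup∘tabulate ρ x)) r))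
          is-root : ∀ x → lookup p x ≡ x → lookup (tabulate ρ) x ≡ true
          is-root x e = trans (Vecₚ.lookup∘tabulate ρ x) (==-complete {i = lookup p x} {x} e)
          case-edge : lookup p x ≡ lookup p y ⊎ (lookup p x ≡ x × lookup p y ≡ y) → G x y ≡ true →
            lookup (tabulate ρ) x ∧ lookup (tabulate ρ) y ∧ app (mk K) (lookup (tabulate π) x) (lookup (tabulate π) y) ≡ true
          case-edge (inj₁ e) g = contradiction (labels (trans (π-gate x) (trans e (sym (π-gate y))))) ne
          case-edge (inj₂ (e , e′)) g = ∧-complete (is-root x e) (∧-complete (is-root y e′)
            (trans (app-mk K _ _) (trans (cong₂ G (trans (π-gate x) e) (trans (π-gate y) e′)) g)))
        M : R (g , a , p , b) (mk K , tabulate σ , mk H , a , tabulate π , tabulate ρ)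
        M = record
          { same   = λ _ → refl
          ; center = app-mk K
          ; action = λ i → sym (trans (cong (lookup b) (Vecₚ.lookup∘tabulate σ i)) (proj₂ (act i)))
          ; gates  = π-gate
          ; marks  = Vecₚ.lookup∘tabulate ρ
          ; pieces = app-mk H
          ; whole  = whole }
      from : ∀ y → QY y → ∃ λ x → PX x × R x y
      from (κ , s , h , a , π , ρ) D = (mk G , a , tabulate p , tabulate b) , compose-pieces D M , M
        where
        open Decomposed D
        module A = Assembly assembly
        b : Fin k → Fin N
        b i = proj₁ (A.root i refl)
        b-at : ∀ i → lookup π (b i) ≡ i
        b-at i = proj₁ (proj₂ (A.root i refl))
        b-root : ∀ i → lookup ρ (b i) ≡ true
        b-root i = proj₂ (proj₂ (A.root i refl))
        p : Fin N → Fin N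
        p x = b (lookup π x)
        G : Graph N
        G = reassemble (app κ) (lookup π) (lookup ρ) (app h)
        bl : ∀ i → lookup (tabulate b) i ≡ b i
        bl = Vecₚ.lookup∘tabulate b
        pl : ∀ x → lookup (tabulate p) x ≡ p x
        pl = Vecₚ.lookup∘tabulate p
        center : ∀ i j → app κ i j ≡ G (b i) (b j)
        center i j with lookup π (b i) Finₚ.≟ lookup π (b j)
        ... | no ne = sym (trans (cong₂ _∧_ (b-root i) (cong₂ _∧_ (b-root j) (cong₂ (app κ) (b-at i) (b-at j)))) refl)
        ... | yes e with trans (sym (b-at i)) (trans e (b-at j))
        ...   | refl = trans (Simple.irreflexive simple i) (sym (Simple.irreflexive A.simple (b i)))
        local : ∀ x y → app h x y ≡ G x y ∧ (p x ==ᶠ p y)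
        local x y with lookup π x Finₚ.≟ lookup π y
        ... | yes e = sym (trans (cong (app h x y ∧_) (==-complete {i = p x} {p y} (cong b e))) (Boolₚ.∧-identityʳ _))
        ... | no ne = bool-ext (λ e → contradiction (A.fibrewise x y e) ne)
                (λ e → contradiction (trans (sym (b-at _)) (trans (cong (lookup π) (==-sound {i = p x} {p y} (proj₂ (∧-sound {lookup ρ x ∧ _} e)))) (b-at _))) ne)
        M : R (mk G , a , tabulate p , tabulate b) (κ , s , h , a , π , ρ)
        M = record
          { same   = λ _ → refl
          ; center = λ i j → trans (center i j) (trans (sym (app-mk G _ _)) (sym (cong₂ (app (mk G)) (bl i) (bl j))))
          ; action = λ i → trans (cong (lookup a) (bl i)) (trans
              (A.root-unique _ _ (trans (A.roots (b i)) (b-root i)) (b-root _) (trans (A.equivariant (b i)) (trans (cong (lookup s) (b-at i)) (sym (b-at _)))))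
              (sym (bl _)))
          ; gates  = λ x → trans (bl _) (sym (pl x))
          ; marks  = λ x → bool-ext
              (λ r → ==-complete {i = lookup (tabulate p) x} {x} (trans (pl x) (A.root-unique _ _ (b-root _) r (b-at _))))
              (λ e → trans (cong (lookup ρ) (sym (trans (sym (pl x)) (==-sound {i = lookup (tabulate p) x} {x} e)))) (b-root _))
          ; pieces = λ x y → trans (local x y) (cong₂ _∧_ (sym (app-mk G x y)) (cong₂ _==ᶠ_ (sym (pl x)) (sym (pl y))))
          ; whole  = app-mk G }
      functional : ∀ {x y y′} → PX x → QY y → QY y′ → R x y → R x y′ → y ≡ y′
      functional {g , a , p , b} {κ , s , h , a₁ , π , ρ} {κ′ , s′ , h′ , a₁′ , π′ , ρ′} P _ _ M M′ = cong₂ _,_ (app-injective κ κ′ (λ i j → trans (M.center i j) (sym (M′.center i j))))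
        (cong₂ _,_ (lookup-injective s s′ (λ i → labels (trans (sym (M.action i)) (M′.action i))))
        (cong₂ _,_ (app-injective h h′ (λ x y → trans (M.pieces x y) (sym (M′.pieces x y))))
        (cong₂ _,_ (lookup-injective a₁ a₁′ (λ x → trans (sym (M.same x)) (M′.same x)))
        (cong₂ _,_ (lookup-injective π π′ (λ x → labels (trans (M.gates x) (sym (M′.gates x)))))
          (lookup-injective ρ ρ′ (λ x → trans (M.marks x) (sym (M′.marks x))))))))
        where
        open Pointed P
        module M = Matches M
        module M′ = Matches M′
      injective : ∀ {x x′ y} → QY y → PX x → PX x′ → R x y → R x′ y → x ≡ x′
      injective {g , a , p , b} {g′ , a′ , p′ , b′} {κ , s , h , _ , π , ρ} D P P′ M M′ = cong₂ _,_ (app-injective g g′ (λ x y → trans (M.whole x y) (sym (M′.whole x y))))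
        (cong₂ _,_ (lookup-injective a a′ (λ x → trans (M.same x) (sym (M′.same x))))
        (cong₂ _,_ (lookup-injective p p′ (λ x → trans (sym (M.gates x)) (trans (same-label (lookup π x)) (M′.gates x))))
          (lookup-injective b b′ same-label)))
        where
        module M = Matches M
        module M′ = Matches M′
        module A = Assembly (Decomposed.assembly D)
        same-label : ∀ i → lookup b i ≡ lookup b′ i
        same-label i = A.root-unique _ _ (label-root P M i) (label-root P′ M′ i) (trans (label-at P M i) (sym (label-at P′ M′ i)))

open BlockCounting

module Assemblies where

  open import Data.Nat using (_≤_; _<_; s≤s; z≤n; _+_; _*_)

  private variable
    n : ℕ

  aut-iter : {α : Fin n → Fin n} {G : Graph n} → Automorphism α G → ∀ t x y → G (iter α t x) (iter α t y) ≡ G x y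
  aut-iter aut zero    x y = refl
  aut-iter {α = α} aut (suc t) x y = trans (aut (iter α t x) (iter α t y)) (aut-iter aut t x y)

  path-lift : ∀ {m} {H : Graph m} {G : Graph n} (f : Fin m → Fin n) → (∀ u v → H u v ≡ G (f u) (f v)) →
    (∀ u y → G (f u) y ≡ true → ∃ λ v → f v ≡ y) → ∀ {x y} u → f u ≡ x → Path everything G x y → ∃ λ v → f v ≡ y × Path everything H u v
  path-lift f e closed u fu ε = u , fu , ε
  path-lift {G = G} f e closed {y = y} u fu (_◅_ {j = z} (_ , _ , g) path) =
    let g′ = subst (λ x → G x z ≡ true) (sym fu) g
        v , fv = closed u z g′
        w , fw , path′ = path-lift f e closed v fv path in
    w , fw , (refl , refl , trans (e u v) (trans (cong (G (f u)) fv) g′)) ◅ path′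

  path-lift-injective : ∀ {m} {H : Graph m} {G : Graph n} (f : Fin m → Fin n) → Injection f → (∀ u v → H u v ≡ G (f u) (f v)) →
    (∀ u y → G (f u) y ≡ true → ∃ λ v → f v ≡ y) → ∀ u v → Path everything G (f u) (f v) → Path everything H u v
  path-lift-injective {H = H} f inj e closed u v path = let w , fw , path′ = path-lift f e closed u refl path in
    subst (Path everything H u) (inj fw) path′

  record Piece {n : ℕ} (H : Graph n) (r : Fin n) (β : Fin n → Fin n) : Set where
    field
      simple    : Simple H
      good      : ConnectedOuterplanar H
      injective : Injection β
      aut       : Automorphism β H
      root      : β r ≡ r

  module Cycle {k : ℕ} (σ : Fin k → Fin k) (σ-inj : Injection σ) (J : Fin k → Bool) (st : Stable σ J)
    (i : Fin k) (ji : J i ≡ true) (l : ℕ) (len≡ : suc l ≡ cycLen σ i) where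

    open Orbit σ σ-inj i

    J′ : Fin k → Bool
    J′ = J ∖ orbit

    J′-stable : Stable σ J′
    J′-stable = ∖-stable σ σ-inj {J} {i} st

    spot : Fin (suc l) → Fin k
    spot t = iter σ (toℕ t) i

    <len : ∀ (t : Fin (suc l)) → toℕ t < len
    <len t = subst (toℕ t <_) len≡ (Finₚ.toℕ<n t)

    spot-orbit : ∀ t → orbit (spot t) ≡ true
    spot-orbit t = orbit-complete (spot t) (fromℕ< (<len t) , cong (λ s → iter σ s i) (Finₚ.toℕ-fromℕ< (<len t)))

    orbit-spot : ∀ j → orbit j ≡ true → ∃ λ t → spot t ≡ j
    orbit-spot j o = let t , e = orbit-sound j o
                         lt = subst (toℕ t <_) (sym len≡) (Finₚ.toℕ<n t) in
      fromℕ< lt , trans (cong (λ s → iter σ s i) (Finₚ.toℕ-fromℕ< lt)) e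

    spot-injective : ∀ s t → spot s ≡ spot t → s ≡ t
    spot-injective s t e with ℕₚ.<-cmp (toℕ s) (toℕ t)
    ... | tri< lt _ _ = contradiction e (distinct _ _ lt (<len t))
    ... | tri≈ _ e′ _ = Finₚ.toℕ-injective e′
    ... | tri> _ _ gt = contradiction (sym e) (distinct _ _ gt (<len s))

    σ-returns : iter σ (suc l) i ≡ i
    σ-returns = trans (cong (λ s → iter σ s i) len≡) (Period.returns period)

    J′-off : ∀ {j} → J′ j ≡ true → ∀ t → j ≢ spot t
    J′-off {j} e t refl = not-sound (proj₂ (∧-sound {J j} e)) (spot-orbit t)

    J′⊆J : ∀ {j} → J′ j ≡ true → J j ≡ true
    J′⊆J {j} e = proj₁ (∧-sound {J j} e)

    J-cases : ∀ j → J j ≡ true → J′ j ≡ true ⊎ (∃ λ t → spot t ≡ j)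
    J-cases j e with orbit j Boolₚ.≟ true
    ... | yes o = inj₂ (orbit-spot j o)
    ... | no ¬o = inj₁ (∧-complete e (not-complete ¬o))

    J-spot : ∀ t → J (spot t) ≡ true
    J-spot t = trans (stable-iter σ σ-inj {J} st (toℕ t) i) ji

    -- The cyclic successor on Fin (suc l); the flag records that the cycle has been closed.
    data Next (t : Fin (suc l)) : Fin (suc l) → Bool → Set where
      up   : ∀ {t′} → toℕ t′ ≡ suc (toℕ t) → Next t t′ false
      wrap : toℕ t ≡ l → Next t zero true

    next : Fin (suc l) → Fin (suc l) × Bool
    next t with toℕ t ℕ.<? l
    ... | yes lt = suc (fromℕ< lt) , false
    ... | no _   = zero , true

    next-view : ∀ t → Next t (proj₁ (next t)) (proj₂ (next t))
    next-view t with toℕ t ℕ.<? l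
    ... | yes lt = up (cong suc (Finₚ.toℕ-fromℕ< lt))
    ... | no ge  = wrap (ℕₚ.≤-antisym (ℕₚ.≤-pred (Finₚ.toℕ<n t)) (ℕₚ.≮⇒≥ ge))

    succ : Fin (suc l) → Fin (suc l)
    succ t = proj₁ (next t)

    succ-injective : ∀ s t → succ s ≡ succ t → s ≡ t
    succ-injective s t e with succ s | proj₂ (next s) | next-view s | succ t | proj₂ (next t) | next-view t
    ... | _ | _ | up e₁   | _ | _ | up e₂   = Finₚ.toℕ-injective (ℕₚ.suc-injective (trans (sym e₁) (trans (cong toℕ e) e₂)))
    ... | _ | _ | wrap e₁ | _ | _ | wrap e₂ = Finₚ.toℕ-injective (trans e₁ (sym e₂))
    ... | _ | _ | up e₁   | _ | _ | wrap e₂ = contradiction (trans (sym e₁) (cong toℕ e)) λ ()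
    ... | _ | _ | wrap e₁ | _ | _ | up e₂   = contradiction (trans (sym e₂) (cong toℕ (sym e))) λ ()

    spot-succ : ∀ t → spot (succ t) ≡ σ (spot t)
    spot-succ t with succ t | proj₂ (next t) | next-view t
    ... | _ | _ | up e   = cong (λ s → iter σ s i) e
    ... | _ | _ | wrap e = sym (trans (cong (λ s → σ (iter σ s i)) e) σ-returns)

    module Model {n₁ n₂ : ℕ} (π₁ : Fin n₁ → Fin k) (ρ₁ : Fin n₁ → Bool) (α₁ : Fin n₁ → Fin n₁) (G₁ : Graph n₁)
                 (H : Graph n₂) (r : Fin n₂) (β : Fin n₂ → Fin n₂) where

      T : Set
      T = Fin n₁ ⊎ (Fin (suc l) × Fin n₂)

      turn : Fin (suc l) → Fin n₂ → Fin n₂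
      turn t v = if proj₂ (next t) then β v else v

      αᴹ : T → T
      αᴹ (inj₁ u)       = inj₁ (α₁ u)
      αᴹ (inj₂ (t , v)) = inj₂ (succ t , turn t v)

      πᴹ : T → Fin k
      πᴹ (inj₁ u)       = π₁ u
      πᴹ (inj₂ (t , v)) = spot t

      ρᴹ : T → Bool
      ρᴹ (inj₁ u)       = ρ₁ u
      ρᴹ (inj₂ (t , v)) = v ==ᶠ r

      Gᴹ : T → T → Bool
      Gᴹ (inj₁ u)       (inj₁ u′)        = G₁ u u′
      Gᴹ (inj₂ (t , v)) (inj₂ (t′ , v′)) = (t ==ᶠ t′) ∧ H v v′
      Gᴹ _              _                = false

      record Glued {n : ℕ} (π : Fin n → Fin k) (ρ : Fin n → Bool) (α : Fin n → Fin n) (G : Graph n)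
                   (φ₁ : Fin n₁ → Fin n) (φ₂ : Fin n₂ → Fin n) (Φ : T → Fin n) : Set where
        field
          left   : ∀ u → φ₁ u ≡ Φ (inj₁ u)
          right  : ∀ v → φ₂ v ≡ Φ (inj₂ (zero , v))
          action : ∀ z → α (Φ z) ≡ Φ (αᴹ z)
          place  : ∀ z → π (Φ z) ≡ πᴹ z
          marks  : ∀ z → ρ (Φ z) ≡ ρᴹ z
          edges  : ∀ z z′ → G (Φ z) (Φ z′) ≡ Gᴹ z z′

      module Consequences {n : ℕ} {π : Fin n → Fin k} {ρ : Fin n → Bool} {α : Fin n → Fin n} {G : Graph n}
               {φ₁ : Fin n₁ → Fin n} {φ₂ : Fin n₂ → Fin n} {Φ : T → Fin n} (glued : Glued π ρ α G φ₁ φ₂ Φ) where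
        open Glued glued

        along : ∀ t v → Φ (inj₂ (t , v)) ≡ iter α (toℕ t) (Φ (inj₂ (zero , v)))
        along t v = go (toℕ t) t refl
          where
          go : ∀ s t → toℕ t ≡ s → Φ (inj₂ (t , v)) ≡ iter α s (Φ (inj₂ (zero , v)))
          go zero    zero    e = refl
          go (suc s) (suc t) e = trans (cong Φ (sym stepped)) (trans (sym (action (inj₂ (Data.Fin.inject₁ t , v))))
              (cong α (go s (Data.Fin.inject₁ t) (trans (Finₚ.toℕ-inject₁ t) (ℕₚ.suc-injective e)))))
            where
            stepped : αᴹ (inj₂ (Data.Fin.inject₁ t , v)) ≡ inj₂ (suc t , v)
            stepped with succ (Data.Fin.inject₁ t) | proj₂ (next (Data.Fin.inject₁ t)) | next-view (Data.Fin.inject₁ t)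
            ... | _ | _ | up e₁   = cong (λ t → inj₂ (t , v)) (Finₚ.toℕ-injective (trans e₁ (cong suc (Finₚ.toℕ-inject₁ t))))
            ... | _ | _ | wrap e₁ = contradiction (trans (sym (Finₚ.toℕ-inject₁ t)) e₁) (ℕₚ.<⇒≢ (Finₚ.toℕ<n t))

        around₀ : ∀ v → iter α (suc l) (Φ (inj₂ (zero , v))) ≡ Φ (inj₂ (zero , β v))
        around₀ v = trans (cong α (trans (cong (λ s → iter α s (Φ (inj₂ (zero , v)))) (sym (Finₚ.toℕ-fromℕ l))) (sym (along (Data.Fin.fromℕ l) v))))
            (trans (action (inj₂ (Data.Fin.fromℕ l , v))) (cong Φ stepped))
          where
          stepped : αᴹ (inj₂ (Data.Fin.fromℕ l , v)) ≡ inj₂ (zero , β v)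
          stepped with succ (Data.Fin.fromℕ l) | proj₂ (next (Data.Fin.fromℕ l)) | next-view (Data.Fin.fromℕ l)
          ... | t′ | _ | up e₁   = contradiction (subst (suc l ≤_) (sym e₁) (s≤s (ℕₚ.≤-reflexive (sym (Finₚ.toℕ-fromℕ l))))) (ℕₚ.<⇒≱ (Finₚ.toℕ<n t′))
          ... | _  | _ | wrap e₁ = refl

        around : ∀ t v → iter α (suc l) (Φ (inj₂ (t , v))) ≡ Φ (inj₂ (t , β v))
        around t v = trans (cong (iter α (suc l)) (along t v)) (trans (iter-comm α (suc l) (toℕ t) _)
          (trans (cong (iter α (toℕ t)) (around₀ v)) (sym (along t (β v)))))

        around* : ∀ q t v → iter α (q * suc l) (Φ (inj₂ (t , v))) ≡ Φ (inj₂ (t , iter β q v))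
        around* zero    t v = refl
        around* (suc q) t v = trans (iter-+ α (suc l) (q * suc l) _) (trans (cong (iter α (suc l)) (around* q t v)) (around t (iter β q v)))

        left* : ∀ q u → iter α q (Φ (inj₁ u)) ≡ Φ (inj₁ (iter α₁ q u))
        left* zero    u = refl
        left* (suc q) u = trans (cong α (left* q u)) (action (inj₁ (iter α₁ q u)))

        module Restrict (A : Assembly σ J π ρ α G)
               (E₁ : Enumerates (λ x → J′ (π x)) φ₁) (E₂ : Enumerates (λ x → π x ==ᶠ i) φ₂) where
          private
            module A = Assembly A
            module E₁ = Enumerates E₁
            module E₂ = Enumerates E₂

            Φ₁ : Fin n₁ → Fin n
            Φ₁ u = Φ (inj₁ u)
            Φ₂ : Fin n₂ → Fin n
            Φ₂ v = Φ (inj₂ (zero , v))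

            Φ₁-injective : Injection Φ₁
            Φ₁-injective e = E₁.injective (trans (left _) (trans e (sym (left _))))
            Φ₂-injective : Injection Φ₂
            Φ₂-injective e = E₂.injective (trans (right _) (trans e (sym (right _))))

            Φ₁-complete : ∀ x → J′ (π x) ≡ true → ∃ λ u → Φ₁ u ≡ x
            Φ₁-complete x e = let u , e′ = E₁.complete x e in u , trans (sym (left u)) e′
            Φ₂-complete : ∀ x → π x ≡ i → ∃ λ v → Φ₂ v ≡ x
            Φ₂-complete x e = let v , e′ = E₂.complete x (==-complete e) in v , trans (sym (right v)) e′

            Φ₁-sound : ∀ u → J′ (π₁ u) ≡ true
            Φ₁-sound u = trans (cong J′ (trans (sym (place (inj₁ u))) (cong π (sym (left u))))) (E₁.sound u)

            β-iter : ∀ v → Φ₂ (β v) ≡ iter α (suc l) (Φ₂ v)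
            β-iter v = sym (around₀ v)

            roots-iter : ∀ t x → ρ (iter α t x) ≡ ρ x
            roots-iter zero    x = refl
            roots-iter (suc t) x = trans (A.roots (iter α t x)) (roots-iter t x)

            π-iter : ∀ t x → π (iter α t x) ≡ iter σ t (π x)
            π-iter zero    x = refl
            π-iter (suc t) x = trans (A.equivariant (iter α t x)) (cong σ (π-iter t x))

          base : Assembly σ J′ π₁ ρ₁ α₁ G₁
          base = record
            { simple      = record { symmetric   = λ u v → trans (sym (edges (inj₁ u) (inj₁ v))) (trans (Simple.symmetric A.simple _ _) (edges (inj₁ v) (inj₁ u)))
                                   ; irreflexive = λ u → trans (sym (edges (inj₁ u) (inj₁ u))) (Simple.irreflexive A.simple _) }
            ; fibrewise   = λ u v e → trans (sym (place (inj₁ u))) (trans (A.fibrewise _ _ (trans (edges (inj₁ u) (inj₁ v)) e)) (place (inj₁ v)))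
            ; joined      = λ u v e → path-lift-injective Φ₁ Φ₁-injective (λ u v → sym (edges (inj₁ u) (inj₁ v)))
                              (λ u y g → Φ₁-complete y (trans (cong J′ (trans (sym (A.fibrewise _ _ g)) (place (inj₁ u)))) (Φ₁-sound u)))
                              u v (A.joined _ _ (trans (place (inj₁ u)) (trans e (sym (place (inj₁ v))))))
            ; outerplanar = outerplanar-restrict Φ₁ Φ₁-injective (λ u v e → trans (edges (inj₁ u) (inj₁ v)) e) A.outerplanar
            ; injective   = λ e → Φ₁-injective (A.injective (trans (action (inj₁ _)) (trans (cong Φ₁ e) (sym (action (inj₁ _))))))
            ; aut         = λ u v → trans (sym (edges (inj₁ _) (inj₁ _))) (trans (cong₂ G (sym (action (inj₁ u))) (sym (action (inj₁ v)))) (trans (A.aut _ _) (edges (inj₁ u) (inj₁ v))))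
            ; roots       = λ u → trans (sym (marks (inj₁ _))) (trans (cong ρ (sym (action (inj₁ u)))) (trans (A.roots _) (marks (inj₁ u))))
            ; equivariant = λ u → trans (sym (place (inj₁ _))) (trans (cong π (sym (action (inj₁ u)))) (trans (A.equivariant _) (cong σ (place (inj₁ u)))))
            ; over        = Φ₁-sound
            ; root        = λ j e → let x , πx , ρx = A.root j (J′⊆J e)
                                        u , ux = Φ₁-complete x (trans (cong J′ πx) e) in
                              u , trans (sym (place (inj₁ u))) (trans (cong π ux) πx) , trans (sym (marks (inj₁ u))) (trans (cong ρ ux) ρx)
            ; root-unique = λ u v ru rv e → Φ₁-injective (A.root-unique _ _ (trans (marks (inj₁ u)) ru) (trans (marks (inj₁ v)) rv) (trans (place (inj₁ u)) (trans e (sym (place (inj₁ v)))))) }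

          piece : Piece H r β
          piece = record
            { simple    = record { symmetric   = λ u v → trans (sym (edges₂ u v)) (trans (Simple.symmetric A.simple _ _) (edges₂ v u))
                                 ; irreflexive = λ u → trans (sym (edges₂ u u)) (Simple.irreflexive A.simple _) }
            ; good      = record
              { nonempty    = nonempty r
              ; connected   = λ u v _ _ → path-lift-injective Φ₂ Φ₂-injective (λ u v → sym (edges₂ u v))
                                (λ u y g → Φ₂-complete y (trans (sym (A.fibrewise _ _ g)) (place (inj₂ (zero , u)))))
                                u v (A.joined _ _ (trans (place (inj₂ (zero , u))) (sym (place (inj₂ (zero , v))))))
              ; outerplanar = outerplanar-restrict Φ₂ Φ₂-injective (λ u v e → trans (edges₂ u v) e) A.outerplanar }
            ; injective = λ {u} {v} e → Φ₂-injective (iter-injective α A.injective (suc l) (trans (sym (β-iter u)) (trans (cong Φ₂ e) (β-iter v))))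
            ; aut       = λ u v → trans (sym (edges₂ _ _)) (trans (cong₂ G (β-iter u) (β-iter v)) (trans (aut-iter {α = α} {G} A.aut (suc l) _ _) (edges₂ u v)))
            ; root      = ==-sound {i = β r} {r} (trans (sym (marks (inj₂ (zero , β r)))) (trans (cong ρ (β-iter r)) (trans (roots-iter (suc l) _) (trans (marks (inj₂ (zero , r))) (==-complete {i = r} refl))))) }
            where
            edges₂ : ∀ u v → G (Φ₂ u) (Φ₂ v) ≡ H u v
            edges₂ u v = edges (inj₂ (zero , u)) (inj₂ (zero , v))
            nonempty : ∀ {m} → Fin m → 1 ≤ m
            nonempty zero    = s≤s z≤n
            nonempty (suc _) = s≤s z≤n

          Φ-injective : ∀ z z′ → Φ z ≡ Φ z′ → z ≡ z′
          Φ-injective (inj₁ u) (inj₁ v) e = cong inj₁ (Φ₁-injective e)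
          Φ-injective (inj₁ u) (inj₂ (t , v)) e = contradiction (trans (sym (place (inj₁ u))) (trans (cong π e) (place (inj₂ (t , v))))) (J′-off (Φ₁-sound u) t)
          Φ-injective (inj₂ (t , v)) (inj₁ u) e = contradiction (trans (sym (place (inj₁ u))) (trans (cong π (sym e)) (place (inj₂ (t , v))))) (J′-off (Φ₁-sound u) t)
          Φ-injective (inj₂ (t , v)) (inj₂ (t′ , v′)) e
            with refl ← spot-injective t t′ (trans (sym (place (inj₂ (t , v)))) (trans (cong π e) (place (inj₂ (t′ , v′))))) =
            cong (λ v → inj₂ (t , v)) (Φ₂-injective (iter-injective α A.injective (toℕ t) (trans (sym (along t v)) (trans e (along t v′)))))

          Φ-surjective : ∀ x → ∃ λ z → Φ z ≡ x
          Φ-surjective x with J-cases (π x) (A.over x)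
          ... | inj₁ e = let u , e′ = Φ₁-complete x e in inj₁ u , e′
          ... | inj₂ (t , e) with surjective (iter α (toℕ t)) (iter-injective α A.injective (toℕ t)) ℕₚ.≤-refl x
          ...   | y , e′ = let v , vy = Φ₂-complete y (iter-injective σ σ-inj (toℕ t) (trans (sym (π-iter (toℕ t) y)) (trans (cong π e′) (sym e)))) in
                  inj₂ (t , v) , trans (along t v) (trans (cong (iter α (toℕ t)) vy) e′)

        module Extend (A : Assembly σ J′ π₁ ρ₁ α₁ G₁) (B : Piece H r β)
               (Φ-injective : ∀ z z′ → Φ z ≡ Φ z′ → z ≡ z′) (Φ-surjective : ∀ x → ∃ λ z → Φ z ≡ x) where
          private
            module A = Assembly A
            module B = Piece B
            module BG = ConnectedOuterplanar B.good

            Φ⁻¹ : Fin n → T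
            Φ⁻¹ x = proj₁ (Φ-surjective x)
            ΦΦ⁻¹ : ∀ x → Φ (Φ⁻¹ x) ≡ x
            ΦΦ⁻¹ x = proj₂ (Φ-surjective x)
            Φ⁻¹Φ : ∀ z → Φ⁻¹ (Φ z) ≡ z
            Φ⁻¹Φ z = Φ-injective _ _ (ΦΦ⁻¹ (Φ z))

            edges⁻¹ : ∀ x y → G x y ≡ Gᴹ (Φ⁻¹ x) (Φ⁻¹ y)
            edges⁻¹ x y = trans (cong₂ G (sym (ΦΦ⁻¹ x)) (sym (ΦΦ⁻¹ y))) (edges _ _)
            place⁻¹ : ∀ x → π x ≡ πᴹ (Φ⁻¹ x)
            place⁻¹ x = trans (cong π (sym (ΦΦ⁻¹ x))) (place _)
            marks⁻¹ : ∀ x → ρ x ≡ ρᴹ (Φ⁻¹ x)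
            marks⁻¹ x = trans (cong ρ (sym (ΦΦ⁻¹ x))) (marks _)
            action⁻¹ : ∀ x → Φ⁻¹ (α x) ≡ αᴹ (Φ⁻¹ x)
            action⁻¹ x = trans (cong Φ⁻¹ (trans (cong α (sym (ΦΦ⁻¹ x))) (action _))) (Φ⁻¹Φ _)
            Φ⁻¹-injective : ∀ {x y} → Φ⁻¹ x ≡ Φ⁻¹ y → x ≡ y
            Φ⁻¹-injective e = trans (sym (ΦΦ⁻¹ _)) (trans (cong Φ e) (ΦΦ⁻¹ _))

            Gᴹ-sym : ∀ z z′ → Gᴹ z z′ ≡ Gᴹ z′ z
            Gᴹ-sym (inj₁ u) (inj₁ v) = Simple.symmetric A.simple u v
            Gᴹ-sym (inj₁ u) (inj₂ _) = refl
            Gᴹ-sym (inj₂ _) (inj₁ u) = refl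
            Gᴹ-sym (inj₂ (t , v)) (inj₂ (t′ , v′)) = cong₂ _∧_
              (bool-ext (λ e → ==-complete {i = t′} {t} (sym (==-sound {i = t} {t′} e))) (λ e → ==-complete {i = t} {t′} (sym (==-sound {i = t′} {t} e))))
              (Simple.symmetric B.simple v v′)

            Gᴹ-irrefl : ∀ z → Gᴹ z z ≡ false
            Gᴹ-irrefl (inj₁ u) = Simple.irreflexive A.simple u
            Gᴹ-irrefl (inj₂ (t , v)) = trans (cong ((t ==ᶠ t) ∧_) (Simple.irreflexive B.simple v)) (Boolₚ.∧-zeroʳ (t ==ᶠ t))

            turn-injective : ∀ t {v v′} → turn t v ≡ turn t v′ → v ≡ v′
            turn-injective t e with proj₂ (next t)
            ... | true  = B.injective e
            ... | false = e

            turn-aut : ∀ t v v′ → H (turn t v) (turn t v′) ≡ H v v′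
            turn-aut t v v′ with proj₂ (next t)
            ... | true  = B.aut v v′
            ... | false = refl

            turn-root : ∀ t → turn t r ≡ r
            turn-root t with proj₂ (next t)
            ... | true  = B.root
            ... | false = refl

            αᴹ-injective : ∀ z z′ → αᴹ z ≡ αᴹ z′ → z ≡ z′
            αᴹ-injective (inj₁ u) (inj₁ v) e = cong inj₁ (A.injective (inj₁-injective e))
              where open import Data.Sum.Properties using (inj₁-injective)
            αᴹ-injective (inj₂ (t , v)) (inj₂ (t′ , v′)) e with inj₂-injective e
              where open import Data.Sum.Properties using (inj₂-injective)
            ... | e′ with refl ← succ-injective t t′ (cong proj₁ e′) = cong (λ v → inj₂ (t , v)) (turn-injective t (cong proj₂ e′))

            Gᴹ-aut : ∀ z z′ → Gᴹ (αᴹ z) (αᴹ z′) ≡ Gᴹ z z′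
            Gᴹ-aut (inj₁ u) (inj₁ v) = A.aut u v
            Gᴹ-aut (inj₁ u) (inj₂ _) = refl
            Gᴹ-aut (inj₂ _) (inj₁ u) = refl
            Gᴹ-aut (inj₂ (t , v)) (inj₂ (t′ , v′)) with t Finₚ.≟ t′
            ... | yes refl = cong₂ _∧_ (trans (==-complete {i = succ t} refl) (sym (==-complete {i = t} refl))) (turn-aut t v v′)
            ... | no ne    = trans (cong (_∧ H (turn t v) (turn t′ v′)) (Boolₚ.¬-not (λ e → ne (succ-injective t t′ (==-sound {i = succ t} {succ t′} e)))))
                               (sym (cong (_∧ H v v′) (Boolₚ.¬-not (λ e → ne (==-sound {i = t} {t′} e)))))

            fibrewiseᴹ : ∀ z z′ → Gᴹ z z′ ≡ true → πᴹ z ≡ πᴹ z′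
            fibrewiseᴹ (inj₁ u) (inj₁ v) e = A.fibrewise u v e
            fibrewiseᴹ (inj₂ (t , v)) (inj₂ (t′ , v′)) e = cong spot (==-sound {i = t} {t′} (proj₁ (∧-sound e)))

            joinedᴹ : ∀ z z′ → πᴹ z ≡ πᴹ z′ → Path everything G (Φ z) (Φ z′)
            joinedᴹ (inj₁ u) (inj₁ v) e = path-map (λ u → Φ (inj₁ u)) (λ _ _ → refl) (λ x y _ _ g → trans (edges (inj₁ x) (inj₁ y)) g) (A.joined u v e)
            joinedᴹ (inj₁ u) (inj₂ (t , v)) e = contradiction e (J′-off (A.over u) t)
            joinedᴹ (inj₂ (t , v)) (inj₁ u) e = contradiction (sym e) (J′-off (A.over u) t)
            joinedᴹ (inj₂ (t , v)) (inj₂ (t′ , v′)) e with refl ← spot-injective t t′ e =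
              path-map (λ v → Φ (inj₂ (t , v))) (λ _ _ → refl) (λ x y _ _ g → trans (edges (inj₂ (t , x)) (inj₂ (t , y))) (∧-complete (==-complete {i = t} refl) g)) (BG.connected v v′ refl refl)

            level : T → ℕ
            level (inj₁ u)       = 0
            level (inj₂ (t , v)) = suc (toℕ t)

            module O₁ = Outerplanar A.outerplanar
            module O₂ = Outerplanar BG.outerplanar
            M₁ = proj₁ (bounded n₁ O₁.key)
            M₂ = proj₁ (bounded n₂ O₂.key)

            height : T → ℕ
            height (inj₁ u)       = O₁.key u
            height (inj₂ (t , v)) = O₂.key v

            height-bound : ∀ z → height z < M₁ + M₂
            height-bound (inj₁ u)       = ℕₚ.≤-trans (proj₂ (bounded n₁ O₁.key) u) (ℕₚ.m≤m+n M₁ M₂)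
            height-bound (inj₂ (t , v)) = ℕₚ.≤-trans (proj₂ (bounded n₂ O₂.key) v) (ℕₚ.m≤n+m M₂ M₁)

            height-injective : ∀ z z′ → level z ≡ level z′ → height z ≡ height z′ → z ≡ z′
            height-injective (inj₁ u) (inj₁ v) _ e = cong inj₁ (O₁.injective e)
            height-injective (inj₂ (t , v)) (inj₂ (t′ , v′)) e e′ with refl ← Finₚ.toℕ-injective (ℕₚ.suc-injective e) = cong (λ v → inj₂ (t , v)) (O₂.injective e′)

            level-edge : ∀ z z′ → Gᴹ z z′ ≡ true → level z ≡ level z′
            level-edge (inj₁ u) (inj₁ v) e = refl
            level-edge (inj₂ (t , v)) (inj₂ (t′ , v′)) e = cong (suc ∘ toℕ) (==-sound {i = t} {t′} (proj₁ (∧-sound e)))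

            height-noCross : ∀ a b c d → Gᴹ a b ≡ true → Gᴹ c d ≡ true → level a ≡ level c →
              height a < height c → height c < height b → height b < height d → Data.Empty.⊥
            height-noCross (inj₁ a) (inj₁ b) (inj₁ c) (inj₁ d) gab gcd _ = O₁.noCross a b c d gab gcd
            height-noCross (inj₂ (_ , a)) (inj₂ (_ , b)) (inj₂ (_ , c)) (inj₂ (_ , d)) gab gcd _ = O₂.noCross a b c d (proj₂ (∧-sound gab)) (proj₂ (∧-sound gcd))

            open Lexicographic (level ∘ Φ⁻¹) (height ∘ Φ⁻¹) (M₁ + M₂) (λ x → height-bound (Φ⁻¹ x))

            cross : ∀ a b c d → G a b ≡ true → G c d ≡ true → a ≺ c → c ≺ b → b ≺ d → Data.Empty.⊥
            cross a b c d gab gcd l₁ l₂ l₃ = height-noCross (Φ⁻¹ a) (Φ⁻¹ b) (Φ⁻¹ c) (Φ⁻¹ d) eab ecd ac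
                (≺-within ac l₁) (≺-within (trans (sym ac) ab) l₂) (≺-within (trans (sym ab) (trans ac (level-edge _ _ ecd))) l₃)
              where
              eab = trans (sym (edges⁻¹ a b)) gab
              ecd = trans (sym (edges⁻¹ c d)) gcd
              ab = level-edge _ _ eab
              ac = ℕₚ.≤-antisym (≺⇒≤ l₁) (ℕₚ.≤-trans (≺⇒≤ l₂) (ℕₚ.≤-reflexive (sym ab)))

            rootsᴹ : ∀ z → ρᴹ (αᴹ z) ≡ ρᴹ z
            rootsᴹ (inj₁ u) = A.roots u
            rootsᴹ (inj₂ (t , v)) = bool-ext
              (λ e → ==-complete {i = v} {r} (turn-injective t (trans (==-sound {i = turn t v} {r} e) (sym (turn-root t)))))
              (λ e → ==-complete {i = turn t v} {r} (trans (cong (turn t) (==-sound {i = v} {r} e)) (turn-root t)))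

            equivariantᴹ : ∀ z → πᴹ (αᴹ z) ≡ σ (πᴹ z)
            equivariantᴹ (inj₁ u) = A.equivariant u
            equivariantᴹ (inj₂ (t , v)) = spot-succ t

            overᴹ : ∀ z → J (πᴹ z) ≡ true
            overᴹ (inj₁ u) = J′⊆J (A.over u)
            overᴹ (inj₂ (t , v)) = J-spot t

            rootᴹ : ∀ j → J j ≡ true → ∃ λ z → πᴹ z ≡ j × ρᴹ z ≡ true
            rootᴹ j e with J-cases j e
            ... | inj₁ e′ = let u , h , h′ = A.root j e′ in inj₁ u , h , h′
            ... | inj₂ (t , h) = inj₂ (t , r) , h , ==-complete {i = r} refl

            root-uniqueᴹ : ∀ z z′ → ρᴹ z ≡ true → ρᴹ z′ ≡ true → πᴹ z ≡ πᴹ z′ → z ≡ z′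
            root-uniqueᴹ (inj₁ u) (inj₁ v) e e′ h = cong inj₁ (A.root-unique u v e e′ h)
            root-uniqueᴹ (inj₁ u) (inj₂ (t , v)) e e′ h = contradiction h (J′-off (A.over u) t)
            root-uniqueᴹ (inj₂ (t , v)) (inj₁ u) e e′ h = contradiction (sym h) (J′-off (A.over u) t)
            root-uniqueᴹ (inj₂ (t , v)) (inj₂ (t′ , v′)) e e′ h with refl ← spot-injective t t′ h =
              cong (λ v → inj₂ (t , v)) (trans (==-sound {i = v} {r} e) (sym (==-sound {i = v′} {r} e′)))

          whole : Assembly σ J π ρ α G
          whole = record
            { simple      = record { symmetric   = λ x y → trans (edges⁻¹ x y) (trans (Gᴹ-sym (Φ⁻¹ x) (Φ⁻¹ y)) (sym (edges⁻¹ y x)))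
                                   ; irreflexive = λ x → trans (edges⁻¹ x x) (Gᴹ-irrefl (Φ⁻¹ x)) }
            ; fibrewise   = λ x y e → trans (place⁻¹ x) (trans (fibrewiseᴹ (Φ⁻¹ x) (Φ⁻¹ y) (trans (sym (edges⁻¹ x y)) e)) (sym (place⁻¹ y)))
            ; joined      = λ x y e → subst₂ (Path everything G) (ΦΦ⁻¹ x) (ΦΦ⁻¹ y) (joinedᴹ (Φ⁻¹ x) (Φ⁻¹ y) (trans (sym (place⁻¹ x)) (trans e (place⁻¹ y))))
            ; outerplanar = lexicographic (λ e e′ → Φ⁻¹-injective (height-injective _ _ e e′)) cross
            ; injective   = λ {x} {y} e → Φ⁻¹-injective (αᴹ-injective _ _ (trans (sym (action⁻¹ x)) (trans (cong Φ⁻¹ e) (action⁻¹ y))))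
            ; aut         = λ x y → trans (edges⁻¹ _ _) (trans (cong₂ Gᴹ (action⁻¹ x) (action⁻¹ y)) (trans (Gᴹ-aut (Φ⁻¹ x) (Φ⁻¹ y)) (sym (edges⁻¹ x y))))
            ; roots       = λ x → trans (marks⁻¹ _) (trans (cong ρᴹ (action⁻¹ x)) (trans (rootsᴹ (Φ⁻¹ x)) (sym (marks⁻¹ x))))
            ; equivariant = λ x → trans (place⁻¹ _) (trans (cong πᴹ (action⁻¹ x)) (trans (equivariantᴹ (Φ⁻¹ x)) (cong σ (sym (place⁻¹ x)))))
            ; over        = λ x → trans (cong J (place⁻¹ x)) (overᴹ (Φ⁻¹ x))
            ; root        = λ j e → let z , h , h′ = rootᴹ j e in Φ z , trans (place z) h , trans (marks z) h′
            ; root-unique = λ x y e e′ h → Φ⁻¹-injective (root-uniqueᴹ _ _ (trans (sym (marks⁻¹ x)) e) (trans (sym (marks⁻¹ y)) e′) (trans (sym (place⁻¹ x)) (trans h (place⁻¹ y)))) }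

          enumerates₁ : Enumerates (λ x → J′ (π x)) φ₁
          enumerates₁ = record
            { injective = λ {u} {v} e → left-injective (Φ-injective _ _ (trans (sym (left u)) (trans e (left v))))
            ; sound     = λ u → trans (cong J′ (trans (cong π (left u)) (place (inj₁ u)))) (A.over u)
            ; complete  = λ x e → preimage x (Φ⁻¹ x) (ΦΦ⁻¹ x) e }
            where
            left-injective : ∀ {u v : Fin n₁} → _≡_ {A = T} (inj₁ u) (inj₁ v) → u ≡ v
            left-injective refl = refl
            preimage : ∀ x z → Φ z ≡ x → J′ (π x) ≡ true → ∃ λ u → φ₁ u ≡ x
            preimage x (inj₁ u) h e = u , trans (left u) h
            preimage x (inj₂ (t , v)) h e = contradiction (trans (cong π (sym h)) (place (inj₂ (t , v)))) (J′-off e t)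

          enumerates₂ : Enumerates (λ x → π x ==ᶠ i) φ₂
          enumerates₂ = record
            { injective = λ {u} {v} e → right-injective (Φ-injective _ _ (trans (sym (right u)) (trans e (right v))))
            ; sound     = λ v → ==-complete (trans (cong π (right v)) (place (inj₂ (zero , v))))
            ; complete  = λ x e → preimage x (Φ⁻¹ x) (ΦΦ⁻¹ x) (==-sound {i = π x} {i} e) }
            where
            right-injective : ∀ {u v : Fin n₂} → _≡_ {A = T} (inj₂ (zero , u)) (inj₂ (zero , v)) → u ≡ v
            right-injective refl = refl
            preimage : ∀ x z → Φ z ≡ x → π x ≡ i → ∃ λ v → φ₂ v ≡ x
            preimage x (inj₁ u) h e = contradiction (trans (sym (place (inj₁ u))) (trans (cong π h) e)) (J′-off (A.over u) zero)
            preimage x (inj₂ (t , v)) h e with refl ← spot-injective t zero (trans (sym (place (inj₂ (t , v)))) (trans (cong π h) e)) = v , trans (right v) h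

          cycLen-left : ∀ u → cycLen α (Φ (inj₁ u)) ≡ cycLen α₁ u
          cycLen-left u = cycLen-unique α (Assembly.injective whole) (Φ (inj₁ u)) (record
            { positive = positive
            ; returns  = trans (left* (cycLen α₁ u) u) (cong (λ u → Φ (inj₁ u)) returns)
            ; minimal  = λ q 1≤q q< e → minimal q 1≤q q< (left-injective (Φ-injective _ _ (trans (sym (left* q u)) e))) })
            where
            open Period (cycLen-period α₁ A.injective u)
            left-injective : ∀ {u v : Fin n₁} → _≡_ {A = T} (inj₁ u) (inj₁ v) → u ≡ v
            left-injective refl = refl

          cycLen-right : ∀ t v → cycLen α (Φ (inj₂ (t , v))) ≡ suc l * cycLen β v
          cycLen-right t v = trans (cycLen-unique α (Assembly.injective whole) (Φ (inj₂ (t , v))) (record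
            { positive = ℕₚ.*-mono-≤ positive (s≤s (z≤n {l}))
            ; returns  = trans (around* (cycLen β v) t v) (cong (λ v → Φ (inj₂ (t , v))) returns)
            ; minimal  = minimal′ })) (ℕₚ.*-comm (cycLen β v) (suc l))
            where
            open Period (cycLen-period β B.injective v)
            right-injective : ∀ {u v : Fin n₂} → _≡_ {A = T} (inj₂ (t , u)) (inj₂ (t , v)) → u ≡ v
            right-injective refl = refl
            π-iter : ∀ q x → π (iter α q x) ≡ iter σ q (π x)
            π-iter zero    x = refl
            π-iter (suc q) x = trans (Assembly.equivariant whole (iter α q x)) (cong σ (π-iter q x))
            spot-period : Period σ (spot t) (suc l)
            spot-period = subst (Period σ (spot t)) (sym len≡) (period-iter σ-inj (toℕ t) period)
            minimal′ : ∀ q → 1 ≤ q → q < cycLen β v * suc l → iter α q (Φ (inj₂ (t , v))) ≢ Φ (inj₂ (t , v))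
            minimal′ q 1≤q q< e with period-divides spot-period q (trans (cong (iter σ q) (sym (place (inj₂ (t , v))))) (trans (sym (π-iter q _)) (trans (cong π e) (place (inj₂ (t , v))))))
            ... | divides zero    refl = contradiction 1≤q λ ()
            ... | divides (suc c) refl = minimal (suc c) (s≤s z≤n) (ℕₚ.*-cancelʳ-< (suc l) (suc c) (cycLen β v) q<)
                    (right-injective (Φ-injective _ _ (trans (sym (around* (suc c) t v)) e)))

open Assemblies

module GluingCount where

  open import Data.Nat using (_≤_; _+_; _*_; _≡ᵇ_)

  private variable
    n : ℕ

  count-+ : ∀ a b (p : Fin (a + b) → Bool) → count (a + b) p ≡ count a (p ∘ (_↑ˡ b)) + count b (p ∘ (a ↑ʳ_))
  count-+ zero    b p = refl
  count-+ (suc a) b p = trans (cong ((if p zero then 1 else 0) +_) (count-+ a b (p ∘ suc))) (sym (ℕₚ.+-assoc (if p zero then 1 else 0) _ _))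

  count-* : ∀ m n (p : Fin (m * n) → Bool) (q : Fin n → Bool) → (∀ (t : Fin m) v → p (combine t v) ≡ q v) → count (m * n) p ≡ m * count n q
  count-* zero    n p q e = refl
  count-* (suc m) n p q e = trans (count-+ n (m * n) p) (cong₂ _+_ (count-cong n (e zero)) (count-* m n _ q (e ∘ suc)))

  count-bijection : ∀ {m n} (f : Fin m → Fin n) → Injection f → n ≤ m → (p : Fin n → Bool) → count n p ≡ count m (p ∘ f)
  count-bijection f inj n≤m p = let g , fg , gf = inverse f inj n≤m in ℕₚ.≤-antisym
    (count-≤ g (λ x e → trans (cong p (fg x)) e) (λ _ _ e → trans (sym (fg _)) (trans (cong f e) (fg _))))
    (count-≤ f (λ _ e → e) (λ _ _ → inj))

  piece? : (H : Graph n) (r : Fin n) (β : Fin n → Fin n) → Dec (Piece H r β)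
  piece? H r β = map′ pack unpack (simple? H ×-dec connectedOuterplanar? H ×-dec injection? β ×-dec automorphism? β H ×-dec (β r Finₚ.≟ r))
    where
    Parts : Set
    Parts = Simple H × ConnectedOuterplanar H × Injection β × Automorphism β H × β r ≡ r
    pack : Parts → Piece H r β
    pack (s , c , i , a , e) = record { simple = s ; good = c ; injective = i ; aut = a ; root = e }
    unpack : Piece H r β → Parts
    unpack B = simple , good , injective , aut , root
      where open Piece B

  module Gluing {k : ℕ} (σ : Fin k → Fin k) (σ-inj : Injection σ) (J : Fin k → Bool) (st : Stable σ J)
    (i : Fin k) (ji : J i ≡ true) (l : ℕ) (len≡ : suc l ≡ cycLen σ i) (n₁ n₂ n : ℕ) where

    open Cycle σ σ-inj J st i ji l len≡
    open Orbit σ σ-inj i using (period)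

    size : ℕ
    size = n₁ + suc l * n₂

    Spots : Set
    Spots = Fin n₁ ⊎ (Fin (suc l) × Fin n₂)

    enc : Spots → Fin size
    enc (inj₁ u)       = u ↑ˡ (suc l * n₂)
    enc (inj₂ (t , v)) = n₁ ↑ʳ combine t v

    dec : Fin size → Spots
    dec z = Data.Sum.map₂ (remQuot n₂) (splitAt n₁ z)

    dec-enc : ∀ z → dec (enc z) ≡ z
    dec-enc (inj₁ u)       = cong (Data.Sum.map₂ (remQuot n₂)) (Finₚ.splitAt-↑ˡ n₁ u (suc l * n₂))
    dec-enc (inj₂ (t , v)) = trans (cong (Data.Sum.map₂ (remQuot n₂)) (Finₚ.splitAt-↑ʳ n₁ (suc l * n₂) (combine t v))) (cong inj₂ (Finₚ.remQuot-combine t v))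

    enc-dec : ∀ z → enc (dec z) ≡ z
    enc-dec z = trans (go (splitAt n₁ z)) (Finₚ.join-splitAt n₁ (suc l * n₂) z)
      where
      go : ∀ s → enc (Data.Sum.map₂ (remQuot n₂) s) ≡ join n₁ (suc l * n₂) s
      go (inj₁ u) = refl
      go (inj₂ w) = cong (n₁ ↑ʳ_) (Finₚ.combine-remQuot {suc l} n₂ w)

    XT YT : Set
    XT = (Vec (Vec Bool n) n × Vec (Fin n) n × Vec (Fin k) n × Vec Bool n) × Vec (Fin n) n₁ × Vec (Fin n) n₂
    YT = (Vec (Vec Bool n₁) n₁ × Vec (Fin n₁) n₁ × Vec (Fin k) n₁ × Vec Bool n₁) ×
         (Vec (Vec Bool n₂) n₂ × Fin n₂ × Vec (Fin n₂) n₂) × Vec (Fin n) size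

    X : Finite XT
    X = pieces k n ⊗ vec (fin n) n₁ ⊗ vec (fin n) n₂

    Y : Finite YT
    Y = pieces k n₁ ⊗ (graphs n₂ ⊗ fin n₂ ⊗ selfMaps n₂) ⊗ vec (fin n) size

    -- An assembly over J, with its part over J′ and its fibre over i labelled by φ₁ and φ₂, amounts to
    -- an assembly over J′, a rooted piece with an automorphism, and a labelling Φ of the model glued from them.
    P : XT → Set
    P ((h , a , π , ρ) , φ₁ , φ₂) = Assembly σ J (lookup π) (lookup ρ) (lookup a) (app h) ×
      Enumerates (λ x → J′ (lookup π x)) (lookup φ₁) × Enumerates (λ x → lookup π x ==ᶠ i) (lookup φ₂)

    P? : ∀ x → Dec (P x)
    P? ((h , a , π , ρ) , φ₁ , φ₂) = assembly? σ J (lookup π) (lookup ρ) (lookup a) (app h) ×-dec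
      enumerates? (λ x → J′ (lookup π x)) (lookup φ₁) ×-dec enumerates? (λ x → lookup π x ==ᶠ i) (lookup φ₂)

    Q : YT → Set
    Q ((h₁ , a₁ , π₁ , ρ₁) , (H , r , β) , Φ) = Assembly σ J′ (lookup π₁) (lookup ρ₁) (lookup a₁) (app h₁) ×
      Piece (app H) r (lookup β) × Injection (lookup Φ) × n ≤ size

    Q? : ∀ y → Dec (Q y)
    Q? ((h₁ , a₁ , π₁ , ρ₁) , (H , r , β) , Φ) = assembly? σ J′ (lookup π₁) (lookup ρ₁) (lookup a₁) (app h₁) ×-dec
      piece? (app H) r (lookup β) ×-dec injection? (lookup Φ) ×-dec (n ℕ.≤? size)

    R : XT → YT → Set
    R ((h , a , π , ρ) , φ₁ , φ₂) ((h₁ , a₁ , π₁ , ρ₁) , (H , r , β) , Φ) =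
      Model.Glued (lookup π₁) (lookup ρ₁) (lookup a₁) (app h₁) (app H) r (lookup β)
        (lookup π) (lookup ρ) (lookup a) (app h) (lookup φ₁) (lookup φ₂) (lookup Φ ∘ enc)

    module _ (Φ : Vec (Fin n) size) where

      enc-injective : Injection (lookup Φ) → ∀ z z′ → lookup Φ (enc z) ≡ lookup Φ (enc z′) → z ≡ z′
      enc-injective inj z z′ e = trans (sym (dec-enc z)) (trans (cong dec (inj e)) (dec-enc z′))

      enc-surjective : Injection (lookup Φ) → n ≤ size → ∀ x → ∃ λ z → lookup Φ (enc z) ≡ x
      enc-surjective inj le x = let y , e = surjective (lookup Φ) inj le x in dec y , trans (cong (lookup Φ) (enc-dec y)) e

      dec-injective : (∀ z z′ → lookup Φ (enc z) ≡ lookup Φ (enc z′) → z ≡ z′) → Injection (lookup Φ)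
      dec-injective inj {x} {y} e = trans (sym (enc-dec x)) (trans (cong enc (inj (dec x) (dec y)
        (trans (cong (lookup Φ) (enc-dec x)) (trans e (cong (lookup Φ) (sym (enc-dec y))))))) (enc-dec y))

      dec-surjective : (∀ x → ∃ λ z → lookup Φ (enc z) ≡ x) → n ≤ size
      dec-surjective surj = Finₚ.injective⇒≤ {f = λ x → enc (proj₁ (surj x))} (λ {x} {y} e →
        trans (sym (proj₂ (surj x))) (trans (cong (lookup Φ) e) (proj₂ (surj y))))

    to : ∀ x → P x → ∃ λ y → Q y × R x y
    to ((h , a , π , ρ) , φ₁ , φ₂) (asm , E₁ , E₂) =
      ((mk h₁ , tabulate a₁ , tabulate π₁ , tabulate ρ₁) , (mk H , r , tabulate β) , Φv) ,
      (base , piece , dec-injective Φv Φ-injective , dec-surjective Φv Φ-surjective) , glued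
      where
      module A = Assembly asm
      module E₁ = Enumerates E₁
      module E₂ = Enumerates E₂
      G = app h
      α = lookup a
      f₁ = lookup φ₁
      f₂ = lookup φ₂
      π-iter : ∀ t x → lookup π (iter α t x) ≡ iter σ t (lookup π x)
      π-iter zero    x = refl
      π-iter (suc t) x = trans (A.equivariant (iter α t x)) (cong σ (π-iter t x))
      ρ-iter : ∀ t x → lookup ρ (iter α t x) ≡ lookup ρ x
      ρ-iter zero    x = refl
      ρ-iter (suc t) x = trans (A.roots (iter α t x)) (ρ-iter t x)
      π-f₂ : ∀ v → lookup π (f₂ v) ≡ i
      π-f₂ v = ==-sound {i = lookup π (f₂ v)} {i} (E₂.sound v)
      returns : iter σ (suc l) i ≡ i
      returns = trans (cong (λ s → iter σ s i) len≡) (Period.returns period)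
      a₁-at : ∀ u → ∃ λ u′ → f₁ u′ ≡ α (f₁ u)
      a₁-at u = E₁.complete (α (f₁ u)) (trans (cong J′ (A.equivariant (f₁ u))) (trans (J′-stable (lookup π (f₁ u))) (E₁.sound u)))
      β-at : ∀ v → ∃ λ v′ → f₂ v′ ≡ iter α (suc l) (f₂ v)
      β-at v = E₂.complete (iter α (suc l) (f₂ v)) (==-complete (trans (π-iter (suc l) (f₂ v)) (trans (cong (iter σ (suc l)) (π-f₂ v)) returns)))
      h₁ : Graph n₁
      h₁ u v = G (f₁ u) (f₁ v)
      a₁ : Fin n₁ → Fin n₁
      a₁ u = proj₁ (a₁-at u)
      π₁ : Fin n₁ → Fin k
      π₁ u = lookup π (f₁ u)
      ρ₁ : Fin n₁ → Bool
      ρ₁ u = lookup ρ (f₁ u)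
      H : Graph n₂
      H u v = G (f₂ u) (f₂ v)
      rootᵢ = A.root i ji
      r-at : ∃ λ v → f₂ v ≡ proj₁ rootᵢ
      r-at = E₂.complete (proj₁ rootᵢ) (==-complete (proj₁ (proj₂ rootᵢ)))
      r = proj₁ r-at
      ρ-r : lookup ρ (f₂ r) ≡ true
      ρ-r = trans (cong (lookup ρ) (proj₂ r-at)) (proj₂ (proj₂ rootᵢ))
      β : Fin n₂ → Fin n₂
      β v = proj₁ (β-at v)
      Φ : Spots → Fin n
      Φ (inj₁ u)       = f₁ u
      Φ (inj₂ (t , v)) = iter α (toℕ t) (f₂ v)
      Φv : Vec (Fin n) size
      Φv = tabulate (Φ ∘ dec)
      Φ≡ : ∀ z → lookup Φv (enc z) ≡ Φ z
      Φ≡ z = trans (Vecₚ.lookup∘tabulate (Φ ∘ dec) (enc z)) (cong Φ (dec-enc z))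
      module M = Model (lookup (tabulate π₁)) (lookup (tabulate ρ₁)) (lookup (tabulate a₁)) (app (mk h₁)) (app (mk H)) r (lookup (tabulate β))
      action : ∀ z → α (Φ z) ≡ Φ (M.αᴹ z)
      action (inj₁ u) = trans (sym (proj₂ (a₁-at u))) (cong f₁ (sym (Vecₚ.lookup∘tabulate a₁ u)))
      action (inj₂ (t , v)) with succ t | proj₂ (next t) | next-view t
      ... | _ | _ | up e   = sym (cong (λ s → iter α s (f₂ v)) e)
      ... | _ | _ | wrap e = trans (cong (λ s → α (iter α s (f₂ v))) e) (trans (sym (proj₂ (β-at v))) (cong f₂ (sym (Vecₚ.lookup∘tabulate β v))))
      place : ∀ z → lookup π (Φ z) ≡ M.πᴹ z
      place (inj₁ u)       = sym (Vecₚ.lookup∘tabulate π₁ u)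
      place (inj₂ (t , v)) = trans (π-iter (toℕ t) (f₂ v)) (cong (iter σ (toℕ t)) (π-f₂ v))
      marks : ∀ z → lookup ρ (Φ z) ≡ M.ρᴹ z
      marks (inj₁ u)       = sym (Vecₚ.lookup∘tabulate ρ₁ u)
      marks (inj₂ (t , v)) = trans (ρ-iter (toℕ t) (f₂ v)) (bool-ext
        (λ e → ==-complete {i = v} {r} (E₂.injective (A.root-unique _ _ e ρ-r (trans (π-f₂ v) (sym (π-f₂ r))))))
        (λ e → trans (cong (lookup ρ ∘ f₂) (==-sound {i = v} {r} e)) ρ-r))
      off : ∀ u t v → lookup π (Φ (inj₁ u)) ≢ lookup π (Φ (inj₂ (t , v)))
      off u t v e = J′-off (E₁.sound u) t (trans e (place (inj₂ (t , v))))
      edges : ∀ z z′ → G (Φ z) (Φ z′) ≡ M.Gᴹ z z′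
      edges (inj₁ u) (inj₁ v) = sym (app-mk h₁ u v)
      edges (inj₁ u) (inj₂ (t , v)) = Boolₚ.¬-not (λ e → off u t v (A.fibrewise _ _ e))
      edges (inj₂ (t , v)) (inj₁ u) = Boolₚ.¬-not (λ e → off u t v (sym (A.fibrewise _ _ e)))
      edges (inj₂ (t , v)) (inj₂ (t′ , v′)) with t Finₚ.≟ t′
      ... | yes refl = trans (aut-iter {α = α} {G} A.aut (toℕ t) (f₂ v) (f₂ v′)) (trans (sym (app-mk H v v′)) (cong (_∧ app (mk H) v v′) (sym (==-complete {i = t} refl))))
      ... | no ne    = trans (Boolₚ.¬-not (λ e → ne (spot-injective t t′ (trans (sym (place (inj₂ (t , v)))) (trans (A.fibrewise _ _ e) (place (inj₂ (t′ , v′))))))))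
                         (cong (_∧ app (mk H) v v′) (sym (Boolₚ.¬-not (λ e → ne (==-sound {i = t} {t′} e)))))
      glued : M.Glued (lookup π) (lookup ρ) α G f₁ f₂ (lookup Φv ∘ enc)
      glued = record
        { left   = λ u → sym (Φ≡ (inj₁ u))
        ; right  = λ v → sym (Φ≡ (inj₂ (zero , v)))
        ; action = λ z → trans (cong α (Φ≡ z)) (trans (action z) (sym (Φ≡ (M.αᴹ z))))
        ; place  = λ z → trans (cong (lookup π) (Φ≡ z)) (place z)
        ; marks  = λ z → trans (cong (lookup ρ) (Φ≡ z)) (marks z)
        ; edges  = λ z z′ → trans (cong₂ G (Φ≡ z) (Φ≡ z′)) (edges z z′) }
      open M.Consequences glued
      open Restrict asm E₁ E₂

    from : ∀ y → Q y → ∃ λ x → P x × R x y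
    from ((h₁ , a₁ , π₁ , ρ₁) , (H , r , β) , Φ) (asm , B , inj , le) =
      ((mk G , tabulate α , tabulate π , tabulate ρ) , tabulate f₁ , tabulate f₂) , (whole , enumerates₁ , enumerates₂) , glued
      where
      module M = Model (lookup π₁) (lookup ρ₁) (lookup a₁) (app h₁) (app H) r (lookup β)
      surj = enc-surjective Φ inj le
      Φ⁻¹ : Fin n → Spots
      Φ⁻¹ x = proj₁ (surj x)
      Φ⁻¹Φ : ∀ z → Φ⁻¹ (lookup Φ (enc z)) ≡ z
      Φ⁻¹Φ z = enc-injective Φ inj _ _ (proj₂ (surj (lookup Φ (enc z))))
      G : Graph n
      G x y = M.Gᴹ (Φ⁻¹ x) (Φ⁻¹ y)
      α : Fin n → Fin n
      α x = lookup Φ (enc (M.αᴹ (Φ⁻¹ x)))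
      π : Fin n → Fin k
      π x = M.πᴹ (Φ⁻¹ x)
      ρ : Fin n → Bool
      ρ x = M.ρᴹ (Φ⁻¹ x)
      f₁ : Fin n₁ → Fin n
      f₁ u = lookup Φ (enc (inj₁ u))
      f₂ : Fin n₂ → Fin n
      f₂ v = lookup Φ (enc (inj₂ (zero , v)))
      glued : M.Glued (lookup (tabulate π)) (lookup (tabulate ρ)) (lookup (tabulate α)) (app (mk G)) (lookup (tabulate f₁)) (lookup (tabulate f₂)) (lookup Φ ∘ enc)
      glued = record
        { left   = Vecₚ.lookup∘tabulate f₁
        ; right  = Vecₚ.lookup∘tabulate f₂
        ; action = λ z → trans (Vecₚ.lookup∘tabulate α _) (cong (lookup Φ ∘ enc ∘ M.αᴹ) (Φ⁻¹Φ z))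
        ; place  = λ z → trans (Vecₚ.lookup∘tabulate π _) (cong M.πᴹ (Φ⁻¹Φ z))
        ; marks  = λ z → trans (Vecₚ.lookup∘tabulate ρ _) (cong M.ρᴹ (Φ⁻¹Φ z))
        ; edges  = λ z z′ → trans (app-mk G _ _) (cong₂ M.Gᴹ (Φ⁻¹Φ z) (Φ⁻¹Φ z′)) }
      open M.Consequences glued
      open Extend asm B (enc-injective Φ inj) surj

    functional : ∀ {x y y′} → P x → Q y → Q y′ → R x y → R x y′ → y ≡ y′
    functional {(h , a , π , ρ) , φ₁ , φ₂} {(h₁ , a₁ , π₁ , ρ₁) , (H , r , β) , Φ} {(h₁′ , a₁′ , π₁′ , ρ₁′) , (H′ , r′ , β′) , Φ′} _ (_ , _ , inj , _) _ g g′ =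
      cong₂ _,_
        (cong₂ _,_ (app-injective h₁ h₁′ (λ u v → trans (sym (g.edges (inj₁ u) (inj₁ v))) (trans (cong₂ (app h) (same (inj₁ u)) (same (inj₁ v))) (g′.edges (inj₁ u) (inj₁ v)))))
        (cong₂ _,_ (lookup-injective a₁ a₁′ (λ u → inj₁-injective (enc-injective Φ inj _ _
            (trans (sym (g.action (inj₁ u))) (trans (cong (lookup a) (same (inj₁ u))) (trans (g′.action (inj₁ u)) (sym (same (inj₁ _)))))))))
        (cong₂ _,_ (lookup-injective π₁ π₁′ (λ u → trans (sym (g.place (inj₁ u))) (trans (cong (lookup π) (same (inj₁ u))) (g′.place (inj₁ u)))))
          (lookup-injective ρ₁ ρ₁′ (λ u → trans (sym (g.marks (inj₁ u))) (trans (cong (lookup ρ) (same (inj₁ u))) (g′.marks (inj₁ u))))))))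
      (cong₂ _,_
        (cong₂ _,_ (app-injective H H′ (λ u v → trans (sym (g.edges (o u) (o v))) (trans (cong₂ (app h) (same (o u)) (same (o v))) (g′.edges (o u) (o v)))))
        (cong₂ _,_ (==-sound {i = r} {r′} (trans (sym (g′.marks (o r))) (trans (cong (lookup ρ) (sym (same (o r)))) (trans (g.marks (o r)) (==-complete {i = r} refl)))))
          (lookup-injective β β′ (λ v → o-injective (enc-injective Φ inj _ _
            (trans (sym (C.around₀ v)) (trans (cong (iter (lookup a) (suc l)) (same (o v))) (trans (C′.around₀ v) (sym (same (o _)))))))))))
        (lookup-injective Φ Φ′ (λ z → subst (λ z → lookup Φ z ≡ lookup Φ′ z) (enc-dec z) (same (dec z)))))
      where
      open import Data.Sum.Properties using (inj₁-injective)
      module g = Model.Glued g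
      module g′ = Model.Glued g′
      module C = Model.Consequences (lookup π₁) (lookup ρ₁) (lookup a₁) (app h₁) (app H) r (lookup β) g
      module C′ = Model.Consequences (lookup π₁′) (lookup ρ₁′) (lookup a₁′) (app h₁′) (app H′) r′ (lookup β′) g′
      o : Fin n₂ → Spots
      o v = inj₂ (zero , v)
      o-injective : ∀ {u v} → o u ≡ o v → u ≡ v
      o-injective refl = refl
      same : ∀ z → lookup Φ (enc z) ≡ lookup Φ′ (enc z)
      same (inj₁ u)       = trans (sym (g.left u)) (g′.left u)
      same (inj₂ (t , v)) = trans (C.along t v) (trans (cong (iter (lookup a) (toℕ t)) (trans (sym (g.right v)) (g′.right v))) (sym (C′.along t v)))

    injective : ∀ {x x′ y} → Q y → P x → P x′ → R x y → R x′ y → x ≡ x′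
    injective {(h , a , π , ρ) , φ₁ , φ₂} {(h′ , a′ , π′ , ρ′) , φ₁′ , φ₂′} {_ , _ , Φ} (_ , _ , inj , le) _ _ g g′ =
      cong₂ _,_
        (cong₂ _,_ (app-injective h h′ (λ x y → via₂ x y))
        (cong₂ _,_ (lookup-injective a a′ (via (λ x → lookup a x ≡ lookup a′ x) (λ z → trans (g.action z) (sym (g′.action z)))))
        (cong₂ _,_ (lookup-injective π π′ (via (λ x → lookup π x ≡ lookup π′ x) (λ z → trans (g.place z) (sym (g′.place z)))))
          (lookup-injective ρ ρ′ (via (λ x → lookup ρ x ≡ lookup ρ′ x) (λ z → trans (g.marks z) (sym (g′.marks z))))))))
      (cong₂ _,_ (lookup-injective φ₁ φ₁′ (λ u → trans (g.left u) (sym (g′.left u))))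
        (lookup-injective φ₂ φ₂′ (λ v → trans (g.right v) (sym (g′.right v)))))
      where
      module g = Model.Glued g
      module g′ = Model.Glued g′
      via : (C : Fin n → Set) → (∀ z → C (lookup Φ (enc z))) → ∀ x → C x
      via C f x = let z , e = enc-surjective Φ inj le x in subst C e (f z)
      via₂ : ∀ x y → app h x y ≡ app h′ x y
      via₂ x y = let z , e = enc-surjective Φ inj le x
                     z′ , e′ = enc-surjective Φ inj le y in
        subst₂ (λ x y → app h x y ≡ app h′ x y) e e′ (trans (g.edges z z′) (sym (g′.edges z z′)))

    glued-cycType : ∀ {x y} → Q y → R x y →
      let ((_ , a , _) , _) = x ; ((_ , a₁ , _) , (_ , _ , β) , _) = y in
      cycType (lookup a) ≈ addMono (cycType (lookup a₁)) (stretch (suc l) (cycType (lookup β)))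
    glued-cycType {(h , a , π , ρ) , φ₁ , φ₂} {(h₁ , a₁ , π₁ , ρ₁) , (H , r , β) , Φ} (asm , B , inj , le) g =
      ω-injective (cycType α) (addMono (cycType α₁) (stretch (suc l) (cycType β′))) (λ j → begin
        ω (cycType α) j
          ≡⟨ Cycles.ω-profile (cycles-cycType α (Assembly.injective whole)) j ⟩
        count n (λ x → cycLen α x ≡ᵇ j)
          ≡⟨ count-bijection (lookup Φ) inj le (λ x → cycLen α x ≡ᵇ j) ⟩
        count size (λ z → cycLen α (lookup Φ z) ≡ᵇ j)
          ≡⟨ count-+ n₁ (suc l * n₂) _ ⟩
        _ ≡⟨ cong₂ _+_ (count-cong n₁ (λ u → cong (_≡ᵇ j) (cycLen-left u)))
               (count-* (suc l) n₂ _ (λ v → (suc l * cycLen β′ v) ≡ᵇ j) (λ t v → cong (_≡ᵇ j) (cycLen-right t v))) ⟩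
        count n₁ (λ u → cycLen α₁ u ≡ᵇ j) + suc l * count n₂ (λ v → (suc l * cycLen β′ v) ≡ᵇ j)
          ≡⟨ cong₂ _+_ (sym (Cycles.ω-profile (cycles-cycType α₁ (Assembly.injective asm)) j)) (stretched j) ⟩
        ω (cycType α₁) j + ω (stretch (suc l) (cycType β′)) j
          ≡⟨ sym (ω-addMono (cycType α₁) (stretch (suc l) (cycType β′)) j) ⟩
        _ ∎)
      where
      α = lookup a
      α₁ = lookup a₁
      β′ = lookup β
      open Model.Consequences (lookup π₁) (lookup ρ₁) (lookup a₁) (app h₁) (app H) r (lookup β) g
      open Extend asm B (enc-injective Φ inj) (enc-surjective Φ inj le)
      open import Data.Nat.Divisibility using (_∣?_)
      stretched : ∀ j → suc l * count n₂ (λ v → (suc l * cycLen β′ v) ≡ᵇ j) ≡ ω (stretch (suc l) (cycType β′)) j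
      stretched j with suc l ∣? j
      ... | no ∤ = trans (trans (cong (suc l *_) (count-false n₂ (λ v → Boolₚ.¬-not (λ e → ∤ (divides (cycLen β′ v)
                     (trans (sym (≡ᵇ-sound (suc l * cycLen β′ v) j e)) (ℕₚ.*-comm (suc l) (cycLen β′ v)))))))) (ℕₚ.*-zeroʳ (suc l)))
                     (sym (ω-stretch-∤ l (cycType β′) j ∤))
      ... | yes (divides q j≡) = trans (cong (suc l *_) (trans (count-cong n₂ (λ v → bool-ext
                (λ e → subst (λ c → (cycLen β′ v ≡ᵇ c) ≡ true) (ℕₚ.*-cancelˡ-≡ (cycLen β′ v) q (suc l) (trans (≡ᵇ-sound _ _ e) j≡′)) (≡ᵇ-refl (cycLen β′ v)))
                (λ e → subst (λ c → ((suc l * cycLen β′ v) ≡ᵇ c) ≡ true) (trans (cong (suc l *_) (≡ᵇ-sound (cycLen β′ v) q e)) (sym j≡′)) (≡ᵇ-refl (suc l * cycLen β′ v)))))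
              (sym (Cycles.ω-profile (cycles-cycType β′ (Piece.injective B)) q))))
            (trans (sym (ω-stretch l (cycType β′) q)) (cong (ω (stretch (suc l) (cycType β′))) (sym j≡′)))
        where
        j≡′ : j ≡ suc l * q
        j≡′ = trans j≡ (ℕₚ.*-comm q (suc l))

    gluing : (φ : Mono → ℚ) → (∀ {a b} → a ≈ b → φ a ≡ φ b) →
      sum X (λ x → let ((_ , a , _) , _) = x in χ (P? x) *ℚ φ (cycType (lookup a))) ≡
      sum Y (λ y → let ((_ , a₁ , _) , (_ , _ , β) , _) = y in χ (Q? y) *ℚ φ (addMono (cycType (lookup a₁)) (stretch (suc l) (cycType (lookup β)))))
    gluing φ resp = bijection X Y P? Q? R to from (λ {x} {y} {y′} → functional {x} {y} {y′}) (λ {x} {x′} {y} → injective {x} {x′} {y})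
      _ _ (λ {x} {y} _ q g → resp (glued-cycType {x} {y} q g))

open GluingCount

module Substitution where

  open import Data.Nat using (_≤_; _<_; s≤s; z≤n; _+_; _*_)

  private variable
    Ω : Set
    n : ℕ

  ∑-upto-cong : ∀ D {f g : ℕ → ℚ} → (∀ n → n ≤ D → f n ≡ g n) → ∑ (upto D) f ≡ ∑ (upto D) g
  ∑-upto-cong D {f} {g} e = go (suc D) id (λ n n< → e n (ℕₚ.≤-pred n<))
    where
    go : ∀ m (h : ℕ → ℕ) → (∀ n → n < m → f (h n) ≡ g (h n)) → ∑ (Data.List.applyUpTo h m) f ≡ ∑ (Data.List.applyUpTo h m) g
    go zero    h e = refl
    go (suc m) h e = cong₂ _+ℚ_ (e 0 (s≤s z≤n)) (go m (h ∘ suc) (λ n n< → e (suc n) (s≤s n<)))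

  ∑-product : (xs : List Ω) (ks : List ℕ) (c : Ω → ℚ) (w : ℕ → ℚ) (e e′ : ℕ → Ω → ℚ) →
    ∑ ks (λ k → w k *ℚ ∑ ks (λ k′ → w k′ *ℚ ∑ xs (λ x → c x *ℚ (e k x *ℚ e′ k′ x)))) ≡
    ∑ xs (λ x → c x *ℚ (∑ ks (λ k → w k *ℚ e k x) *ℚ ∑ ks (λ k → w k *ℚ e′ k x)))
  ∑-product xs ks c w e e′ = begin
    _ ≡⟨ ∑-cong ks (λ k → cong (w k *ℚ_) (trans (∑-cong ks (λ k′ → cong (w k′ *ℚ_) (∑-cong xs (λ x → sym (ℚₚ.*-assoc (c x) (e k x) (e′ k′ x))))))
           (sym (∑-pull xs ks (λ x → c x *ℚ e k x) w e′)))) ⟩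
    ∑ ks (λ k → w k *ℚ ∑ xs (λ x → (c x *ℚ e k x) *ℚ F x))
      ≡⟨ ∑-cong ks (λ k → cong (w k *ℚ_) (∑-cong xs (λ x → trans (ℚₚ.*-assoc (c x) (e k x) (F x)) (trans (cong (c x *ℚ_) (ℚₚ.*-comm (e k x) (F x))) (sym (ℚₚ.*-assoc (c x) (F x) (e k x))))))) ⟩
    ∑ ks (λ k → w k *ℚ ∑ xs (λ x → (c x *ℚ F x) *ℚ e k x))
      ≡⟨ sym (∑-pull xs ks (λ x → c x *ℚ F x) w e) ⟩
    ∑ xs (λ x → (c x *ℚ F x) *ℚ ∑ ks (λ k → w k *ℚ e k x))
      ≡⟨ ∑-cong xs (λ x → trans (ℚₚ.*-assoc (c x) (F x) _) (cong (c x *ℚ_) (ℚₚ.*-comm (F x) _))) ⟩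
    _ ∎
    where
    F : _ → ℚ
    F x = ∑ ks (λ k → w k *ℚ e′ k x)

  pieceSum : ∀ n → (Vec (Fin n) n → ℚ) → ℚ
  pieceSum n f = sum (graphs n ⊗ fin n ⊗ selfMaps n) (λ (H , r , β) → χ (piece? (app H) r (lookup β)) *ℚ f β)

  ⟪⟫-rooted : ∀ n φ → ⟪ classTerms 𝒞̂ n , φ ⟫ ≡ weight n *ℚ pieceSum n (φ ∘ cycType ∘ lookup)
  ⟪⟫-rooted n φ = trans (⟪⟫-classTerms {n} 𝒞̂ (λ { nothing e → refl ; (just r) e → 𝒞B-cong e }) φ) (cong (weight n *ℚ_)
    (trans (classSum-rooted′ 𝒞̂ cᶜ (λ _ _ → refl) (λ _ _ _ → refl) n (φ ∘ cycType)) (sym pieces-sum)))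
    where
    f : Vec (Fin n) n → ℚ
    f = φ ∘ cycType ∘ lookup
    pieces-sum : pieceSum n f ≡ sum (graphs n) (λ g → χ (simple? (app g)) *ℚ (χᵇ (cᶜ (app g)) *ℚ sum (fin n) (λ r →
      sum (selfMaps n) (λ a → χ (injection? (lookup a)) *ℚ (χ (automorphism? (lookup a) (app g)) *ℚ (χ (lookup a r Finₚ.≟ r) *ℚ f a))))))
    pieces-sum = begin
      pieceSum n f
        ≡⟨ trans (sum-⊗ (graphs n) (fin n ⊗ selfMaps n) _) (∑-cong (elems (graphs n)) (λ g → sum-⊗ (fin n) (selfMaps n) _)) ⟩
      sum (graphs n) (λ g → sum (fin n) (λ r → sum (selfMaps n) (λ a → χ (piece? (app g) r (lookup a)) *ℚ f a)))
        ≡⟨ ∑-cong (elems (graphs n)) (λ g → ∑-cong (elems (fin n)) (λ r → ∑-cong (elems (selfMaps n)) (λ a → split g r a))) ⟩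
      sum (graphs n) (λ g → sum (fin n) (λ r → sum (selfMaps n) (λ a → S g *ℚ (C g *ℚ (χ (injection? (lookup a)) *ℚ (χ (automorphism? (lookup a) (app g)) *ℚ (χ (lookup a r Finₚ.≟ r) *ℚ f a)))))))
        ≡⟨ ∑-cong (elems (graphs n)) (λ g → trans (∑-cong (elems (fin n)) (λ r → trans (∑-*ˡ (elems (selfMaps n)) (S g) _) (cong (S g *ℚ_) (∑-*ˡ (elems (selfMaps n)) (C g) _))))
             (trans (∑-*ˡ (elems (fin n)) (S g) _) (cong (S g *ℚ_) (∑-*ˡ (elems (fin n)) (C g) _)))) ⟩
      _ ≡⟨ ∑-cong (elems (graphs n)) (λ g → cong (λ z → S g *ℚ (z *ℚ sum (fin n) (λ r →
             sum (selfMaps n) (λ a → χ (injection? (lookup a)) *ℚ (χ (automorphism? (lookup a) (app g)) *ℚ (χ (lookup a r Finₚ.≟ r) *ℚ f a)))))) (sym (χ-cᶜ (app g)))) ⟩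
      _ ∎
      where
      S C : Vec (Vec Bool n) n → ℚ
      S g = χ (simple? (app g))
      C g = χ (connectedOuterplanar? (app g))
      split : ∀ g r a → χ (piece? (app g) r (lookup a)) *ℚ f a ≡
        S g *ℚ (C g *ℚ (χ (injection? (lookup a)) *ℚ (χ (automorphism? (lookup a) (app g)) *ℚ (χ (lookup a r Finₚ.≟ r) *ℚ f a))))
      split g r a = sym (trans (cong (λ z → S g *ℚ (C g *ℚ z)) (trans (cong (χ (injection? (lookup a)) *ℚ_)
          (χ-×₂ (automorphism? (lookup a) (app g)) (lookup a r Finₚ.≟ r) (f a))) (χ-×₂ (injection? (lookup a)) (automorphism? (lookup a) (app g) ×-dec (lookup a r Finₚ.≟ r)) (f a))))
        (trans (cong (S g *ℚ_) (χ-×₂ (connectedOuterplanar? (app g)) (injection? (lookup a) ×-dec automorphism? (lookup a) (app g) ×-dec (lookup a r Finₚ.≟ r)) (f a)))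
          (χ-×₂ (simple? (app g)) (connectedOuterplanar? (app g) ×-dec injection? (lookup a) ×-dec automorphism? (lookup a) (app g) ×-dec (lookup a r Finₚ.≟ r)) (f a))))

  substMono-invariant : ∀ q a b φ → a ≈ b → ⟪ substMono q a , φ ⟫ ≡ ⟪ substMono q b , φ ⟫
  substMono-invariant q a b φ e = trans (cong (λ p → ⟪ p , φ ⟫) (substMono≡substGo q a)) (trans (go 1 a b φ e) (cong (λ p → ⟪ p , φ ⟫) (sym (substMono≡substGo q b))))
    where
    trivial : ∀ i m φ → [] ≈ m → ⟪ substGo q i m , φ ⟫ ≡ φ []
    trivial i []      φ e = ⟪⟫-oneP φ
    trivial i (x ∷ m) φ e with e 0
    ... | refl = trans (⟪⟫-mulP oneP (substGo q (suc i) m) φ) (trans (⟪⟫-oneP (λ a → ⟪ substGo q (suc i) m , (λ b → φ (addMono a b)) ⟫)) (trivial (suc i) m φ (e ∘ suc)))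
    go : ∀ i a b φ → a ≈ b → ⟪ substGo q i a , φ ⟫ ≡ ⟪ substGo q i b , φ ⟫
    go i []      b       φ e = trans (⟪⟫-oneP φ) (sym (trivial i b φ e))
    go i (x ∷ a) []      φ e = trans (trivial i (x ∷ a) φ (sym ∘ e)) (sym (⟪⟫-oneP φ))
    go i (x ∷ a) (y ∷ b) φ e with e 0
    ... | refl = trans (⟪⟫-mulP S (substGo q (suc i) a) φ) (trans (⟪⟫-cong S (λ c → go (suc i) a b _ (e ∘ suc))) (sym (⟪⟫-mulP S (substGo q (suc i) b) φ)))
      where S = powP (stretchP i q) x

  addMono-≈ : ∀ a b c → a ≈ b → addMono a c ≈ addMono b c
  addMono-≈ a b c e t = trans (exponent-addMono a c t) (trans (cong (_+ exponent c t) (e t)) (sym (exponent-addMono b c t)))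

  -- Z is truncated at degree D, so only monomials of degree at most D may be tested.
  record Admissible (D : ℕ) (φ : Mono → ℚ) : Set where
    field
      invariant   : ∀ {a b} → a ≈ b → φ a ≡ φ b
      vanish : ∀ m → D < deg m → φ m ≡ 0ℚ

  module Plethysm (D : ℕ) {k : ℕ} (σ : Fin k → Fin k) (σ-inj : Injection σ) where

    q : Poly
    q = ZPoly 𝒞̂ D

    ns : List ℕ
    ns = upto D

    S : (Fin k → Bool) → (Mono → ℚ) → ℚ
    S J φ = ∑ ns (λ n → weight n *ℚ assemblySum σ J n (φ ∘ cycType ∘ lookup))

    Substitutes : (Fin k → Bool) → Set
    Substitutes J = ∃ λ e → Cycles σ J e × (∀ φ → Admissible D φ → ⟪ substMono q e , φ ⟫ ≡ S J φ)

    empty : ∀ J → (∀ x → J x ≡ false) → Substitutes J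
    empty J none = [] , cycles-∅ σ J none , λ φ adm → trans (⟪⟫-oneP φ) (sym (trans
      (∑-upto D 0 _ z≤n (λ n n≢0 → trans (cong (weight n *ℚ_) (∑-vanish (elems (pieces k n)) (λ (h , a , π , ρ) →
        χ-vanish (assembly? σ J (lookup π) (lookup ρ) (lookup a) (app h)) (λ A → impossible n n≢0 π (Assembly.over A))))) (ℚₚ.*-zeroʳ (weight n))))
      (trans (ℚₚ.*-identityˡ (assemblySum σ J 0 (φ ∘ cycType ∘ lookup)))
        (unique (pieces k 0) (λ (h , a , π , ρ) → assembly? σ J (lookup π) (lookup ρ) (lookup a) (app h)) ([] , [] , [] , []) (λ (h , a , π , ρ) → φ (cycType (lookup a))) trivial
          (λ { ([] , [] , [] , []) _ → refl })))))
      where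
      impossible : ∀ n → n ≢ 0 → (π : Vec (Fin k) n) → (∀ x → J (lookup π x) ≡ true) → ∀ {x : ℚ} → x ≡ 0ℚ
      impossible zero    ne π h = contradiction refl ne
      impossible (suc n) ne π h = contradiction (trans (sym (none _)) (h zero)) λ ()
      trivial : Assembly σ J (lookup []) (lookup []) (lookup []) (app {A = Bool} {n = 0} [])
      trivial = record
        { simple = record { symmetric = λ () ; irreflexive = λ () } ; fibrewise = λ () ; joined = λ ()
        ; outerplanar = outer (λ ()) (λ {i} → λ _ → ⊥-elim (Finₚ.¬Fin0 i)) (λ ()) ; injective = λ {i} _ → ⊥-elim (Finₚ.¬Fin0 i) ; aut = λ () ; roots = λ () ; equivariant = λ ()
        ; over = λ () ; root = λ j e → contradiction (trans (sym (none j)) e) λ () ; root-unique = λ () }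

    module Step (J : Fin k → Bool) (i : Fin k) (st : Stable σ J) (ji : J i ≡ true) (l : ℕ) (len≡ : suc l ≡ cycLen σ i)
                (φ : Mono → ℚ) (adm : Admissible D φ) where

      open Admissible adm
      open Cycle σ σ-inj J st i ji l len≡ using (J′)

      φ′ : Mono → ℚ
      φ′ m = ⟪ stretchP (suc l) q , (λ m′ → φ (addMono m m′)) ⟫

      φ′-admissible : Admissible D φ′
      φ′-admissible = record
        { invariant   = λ {a} {b} e → ⟪⟫-cong (stretchP (suc l) q) (λ m → invariant (addMono-≈ a b m e))
        ; vanish = λ m D<m → ∑-vanish (stretchP (suc l) q) (λ (c , m′) → trans (cong (c *ℚ_) (vanish (addMono m m′)
            (ℚₚ≤ (deg-addMono m m′) D<m))) (ℚₚ.*-zeroʳ c)) }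
        where
        ℚₚ≤ : ∀ {a b c} → a ≡ b + c → D < b → D < a
        ℚₚ≤ {b = b} {c} refl lt = ℕₚ.≤-trans lt (ℕₚ.m≤m+n b c)

      ψ : ∀ {n₁ n₂} → Vec (Fin n₁) n₁ → Vec (Fin n₂) n₂ → ℚ
      ψ a₁ β = φ (addMono (cycType (lookup a₁)) (stretch (suc l) (cycType (lookup β))))

      φ′-pieces : ∀ {n₁} (a₁ : Vec (Fin n₁) n₁) → φ′ (cycType (lookup a₁)) ≡ ∑ ns (λ n₂ → weight n₂ *ℚ pieceSum n₂ (ψ a₁))
      φ′-pieces a₁ = trans (⟪⟫-stretchP (suc l) q _) (trans (⟪⟫-ZPoly 𝒞̂ D _) (∑-cong ns (λ n₂ → ⟪⟫-rooted n₂ _)))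

      private
        module G (n₁ n₂ n : ℕ) = Gluing σ σ-inj J st i ji l len≡ n₁ n₂ n

        XSum YSum : ℕ → ℕ → ℕ → ℚ
        XSum n₁ n₂ n = sum (G.X n₁ n₂ n) (λ x → let ((_ , a , _) , _) = x in χ (G.P? n₁ n₂ n x) *ℚ φ (cycType (lookup a)))
        YSum n₁ n₂ n = sum (G.Y n₁ n₂ n) (λ y → let ((_ , a₁ , _) , (_ , _ , β) , _) = y in χ (G.Q? n₁ n₂ n y) *ℚ ψ a₁ β)

      labelled : ∀ n → n ≤ D → assemblySum σ J n (φ ∘ cycType ∘ lookup) ≡ ∑ ns (λ n₁ → weight n₁ *ℚ ∑ ns (λ n₂ → weight n₂ *ℚ XSum n₁ n₂ n))
      labelled n n≤D = sym (begin
        ∑ ns (λ n₁ → weight n₁ *ℚ ∑ ns (λ n₂ → weight n₂ *ℚ XSum n₁ n₂ n))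
          ≡⟨ ∑-cong ns (λ n₁ → cong (weight n₁ *ℚ_) (∑-cong ns (λ n₂ → cong (weight n₂ *ℚ_) (factor n₁ n₂)))) ⟩
        ∑ ns (λ n₁ → weight n₁ *ℚ ∑ ns (λ n₂ → weight n₂ *ℚ sum (pieces k n) (λ s → c s *ℚ (e₁ n₁ s *ℚ e₂ n₂ s))))
          ≡⟨ ∑-product (elems (pieces k n)) ns c weight e₁ e₂ ⟩
        sum (pieces k n) (λ s → c s *ℚ (∑ ns (λ n₁ → weight n₁ *ℚ e₁ n₁ s) *ℚ ∑ ns (λ n₂ → weight n₂ *ℚ e₂ n₂ s)))
          ≡⟨ ∑-cong (elems (pieces k n)) (λ s → trans (cong (c s *ℚ_) (cong₂ _*ℚ_ (enumerations-weigh-1 D n (S₁ s) n≤D) (enumerations-weigh-1 D n (S₂ s) n≤D))) (ℚₚ.*-identityʳ (c s))) ⟩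
        assemblySum σ J n (φ ∘ cycType ∘ lookup) ∎)
        where
        ST = Vec (Vec Bool n) n × Vec (Fin n) n × Vec (Fin k) n × Vec Bool n
        A : (s : ST) → Dec _
        A (h , a , π , ρ) = assembly? σ J (lookup π) (lookup ρ) (lookup a) (app h)
        S₁ S₂ : ST → Fin n → Bool
        S₁ (h , a , π , ρ) x = J′ (lookup π x)
        S₂ (h , a , π , ρ) x = lookup π x ==ᶠ i
        f c : ST → ℚ
        f (h , a , π , ρ) = φ (cycType (lookup a))
        c s = χ (A s) *ℚ f s
        e₁ e₂ : ℕ → ST → ℚ
        e₁ n₁ s = enumerations n n₁ (S₁ s)
        e₂ n₂ s = enumerations n n₂ (S₂ s)
        factor : ∀ n₁ n₂ → XSum n₁ n₂ n ≡ sum (pieces k n) (λ s → c s *ℚ (e₁ n₁ s *ℚ e₂ n₂ s))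
        factor n₁ n₂ = trans (sum-⊗ (pieces k n) (vec (fin n) n₁ ⊗ vec (fin n) n₂) _) (∑-cong (elems (pieces k n)) (λ s → begin
          _ ≡⟨ sum-⊗ (vec (fin n) n₁) (vec (fin n) n₂) _ ⟩
          sum (vec (fin n) n₁) (λ φ₁ → sum (vec (fin n) n₂) (λ φ₂ → χ (A s ×-dec enumerates? (S₁ s) (lookup φ₁) ×-dec enumerates? (S₂ s) (lookup φ₂)) *ℚ f s))
            ≡⟨ ∑-cong (elems (vec (fin n) n₁)) (λ φ₁ → ∑-cong (elems (vec (fin n) n₂)) (λ φ₂ → begin
                 _ ≡⟨ cong (_*ℚ f s) (trans (χ-× (A s) (enumerates? (S₁ s) (lookup φ₁) ×-dec enumerates? (S₂ s) (lookup φ₂))) (cong (χ (A s) *ℚ_) (χ-× (enumerates? (S₁ s) (lookup φ₁)) (enumerates? (S₂ s) (lookup φ₂))))) ⟩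
                 (χ (A s) *ℚ (E₁ s φ₁ *ℚ E₂ s φ₂)) *ℚ f s
                   ≡⟨ trans (ℚₚ.*-assoc (χ (A s)) _ (f s)) (trans (cong (χ (A s) *ℚ_) (ℚₚ.*-comm _ (f s))) (sym (ℚₚ.*-assoc (χ (A s)) (f s) _))) ⟩
                 c s *ℚ (E₁ s φ₁ *ℚ E₂ s φ₂) ∎)) ⟩
          sum (vec (fin n) n₁) (λ φ₁ → sum (vec (fin n) n₂) (λ φ₂ → c s *ℚ (E₁ s φ₁ *ℚ E₂ s φ₂)))
            ≡⟨ ∑-cong (elems (vec (fin n) n₁)) (λ φ₁ → trans (∑-*ˡ (elems (vec (fin n) n₂)) (c s) _) (cong (c s *ℚ_) (∑-*ˡ (elems (vec (fin n) n₂)) (E₁ s φ₁) (E₂ s)))) ⟩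
          sum (vec (fin n) n₁) (λ φ₁ → c s *ℚ (E₁ s φ₁ *ℚ e₂ n₂ s))
            ≡⟨ trans (∑-*ˡ (elems (vec (fin n) n₁)) (c s) _) (cong (c s *ℚ_) (∑-*ʳ (elems (vec (fin n) n₁)) (e₂ n₂ s) (E₁ s))) ⟩
          c s *ℚ (e₁ n₁ s *ℚ e₂ n₂ s) ∎))
          where
          E₁ : ST → Vec (Fin n) n₁ → ℚ
          E₁ s φ₁ = χ (enumerates? (S₁ s) (lookup φ₁))
          E₂ : ST → Vec (Fin n) n₂ → ℚ
          E₂ s φ₂ = χ (enumerates? (S₂ s) (lookup φ₂))

      bijections : ℕ → ℕ → ℕ → ℚ
      bijections n₁ n₂ n = sum (vec (fin n) (G.size n₁ n₂ n)) (λ Φ → χ (injection? (lookup Φ) ×-dec (n ℕ.≤? G.size n₁ n₂ n)))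

      bijections-weigh-1 : ∀ n₁ n₂ → n₁ + suc l * n₂ ≤ D → ∑ ns (λ n → weight n *ℚ bijections n₁ n₂ n) ≡ 1ℚ
      bijections-weigh-1 n₁ n₂ le = trans
        (∑-upto D M _ le (λ n ne → trans (cong (weight n *ℚ_) (∑-vanish (elems (vec (fin n) M)) (λ Φ → χ-no (injection? (lookup Φ) ×-dec (n ℕ.≤? M))
          (λ (inj , n≤M) → ne (ℕₚ.≤-antisym n≤M (Finₚ.injective⇒≤ (λ {x} {y} → inj {x} {y}))))))) (ℚₚ.*-zeroʳ (weight n))))
        (trans (cong (weight M *ℚ_) (trans (∑-cong (elems (selfMaps M)) (λ Φ → χ-⇔ (injection? (lookup Φ) ×-dec (M ℕ.≤? M)) (injection? (lookup Φ)) proj₁ (λ inj → (λ {_} {_} → inj) , ℕₚ.≤-refl)))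
          (sym (ι-perms M)))) (weight-ι M))
        where M = n₁ + suc l * n₂

      baseSum : ∀ n₁ → (Vec (Fin n₁) n₁ → ℚ) → ℚ
      baseSum n₁ = assemblySum σ J′ n₁

      unlabelled : ∀ n₁ n₂ → ∑ ns (λ n → weight n *ℚ YSum n₁ n₂ n) ≡ baseSum n₁ (λ a₁ → pieceSum n₂ (ψ a₁))
      unlabelled n₁ n₂ = begin
        ∑ ns (λ n → weight n *ℚ YSum n₁ n₂ n)
          ≡⟨ ∑-cong ns (λ n → cong (weight n *ℚ_) (factor n)) ⟩
        ∑ ns (λ n → weight n *ℚ sum (pieces k n₁) (λ s → χ (A s) *ℚ sum B (λ b → χ (C b) *ℚ (f s b *ℚ bijections n₁ n₂ n))))
          ≡⟨ sym (∑-pull (elems (pieces k n₁)) ns (λ s → χ (A s)) weight (λ n s → sum B (λ b → χ (C b) *ℚ (f s b *ℚ bijections n₁ n₂ n)))) ⟩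
        sum (pieces k n₁) (λ s → χ (A s) *ℚ ∑ ns (λ n → weight n *ℚ sum B (λ b → χ (C b) *ℚ (f s b *ℚ bijections n₁ n₂ n))))
          ≡⟨ ∑-cong (elems (pieces k n₁)) (λ s → cong (χ (A s) *ℚ_) (sym (∑-pull (elems B) ns (λ b → χ (C b)) weight (λ n b → f s b *ℚ bijections n₁ n₂ n)))) ⟩
        sum (pieces k n₁) (λ s → χ (A s) *ℚ sum B (λ b → χ (C b) *ℚ ∑ ns (λ n → weight n *ℚ (f s b *ℚ bijections n₁ n₂ n))))
          ≡⟨ ∑-cong (elems (pieces k n₁)) (λ s → χ-guard (A s) (λ as → ∑-cong (elems B) (λ b → χ-guard (C b) (λ pc → total s b as pc)))) ⟩
        sum (pieces k n₁) (λ s → χ (A s) *ℚ sum B (λ b → χ (C b) *ℚ f s b)) ∎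
        where
        M = n₁ + suc l * n₂
        ST = Vec (Vec Bool n₁) n₁ × Vec (Fin n₁) n₁ × Vec (Fin k) n₁ × Vec Bool n₁
        BT = Vec (Vec Bool n₂) n₂ × Fin n₂ × Vec (Fin n₂) n₂
        B : Finite BT
        B = graphs n₂ ⊗ fin n₂ ⊗ selfMaps n₂
        A : (s : ST) → let (h , a , π , ρ) = s in Dec (Assembly σ J′ (lookup π) (lookup ρ) (lookup a) (app h))
        A (h , a , π , ρ) = assembly? σ J′ (lookup π) (lookup ρ) (lookup a) (app h)
        C : (b : BT) → let (H , r , β) = b in Dec (Piece (app H) r (lookup β))
        C (H , r , β) = piece? (app H) r (lookup β)
        f : ST → BT → ℚ
        f (h , a , π , ρ) (H , r , β) = ψ a β
        factor : ∀ n → YSum n₁ n₂ n ≡ sum (pieces k n₁) (λ s → χ (A s) *ℚ sum B (λ b → χ (C b) *ℚ (f s b *ℚ bijections n₁ n₂ n)))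
        factor n = trans (sum-⊗ (pieces k n₁) (B ⊗ vec (fin n) M) _) (∑-cong (elems (pieces k n₁)) (λ s → trans (sum-⊗ B (vec (fin n) M) _)
          (trans (∑-cong (elems B) (λ b → trans (∑-cong (elems (vec (fin n) M)) (λ Φ → rearrange s b Φ)) (trans (∑-*ˡ (elems (vec (fin n) M)) (χ (A s)) _)
              (cong (χ (A s) *ℚ_) (trans (∑-*ˡ (elems (vec (fin n) M)) (χ (C b)) _) (cong (χ (C b) *ℚ_) (∑-*ˡ (elems (vec (fin n) M)) (f s b) I)))))))
            (∑-*ˡ (elems B) (χ (A s)) _))))
          where
          I : Vec (Fin n) M → ℚ
          I Φ = χ (injection? (lookup Φ) ×-dec (n ℕ.≤? M))
          rearrange : ∀ s b Φ → χ (A s ×-dec C b ×-dec injection? (lookup Φ) ×-dec (n ℕ.≤? M)) *ℚ f s b ≡ χ (A s) *ℚ (χ (C b) *ℚ (f s b *ℚ I Φ))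
          rearrange s b Φ = trans (sym (χ-×₂ (A s) (C b ×-dec injection? (lookup Φ) ×-dec (n ℕ.≤? M)) (f s b)))
            (cong (χ (A s) *ℚ_) (trans (sym (χ-×₂ (C b) (injection? (lookup Φ) ×-dec (n ℕ.≤? M)) (f s b))) (cong (χ (C b) *ℚ_) (ℚₚ.*-comm (I Φ) (f s b)))))
        total : ∀ s b → (let (h , a , π , ρ) = s in Assembly σ J′ (lookup π) (lookup ρ) (lookup a) (app h)) →
          (let (H , r , β) = b in Piece (app H) r (lookup β)) → ∑ ns (λ n → weight n *ℚ (f s b *ℚ bijections n₁ n₂ n)) ≡ f s b
        total s@(h , a , π , ρ) b@(H , r , β) as pc = trans (∑-cong ns (λ n → swap*ˡ (weight n) (f s b) (bijections n₁ n₂ n))) (trans (∑-*ˡ ns (f s b) _) (by (M ℕ.≤? D)))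
          where
          degree : deg (addMono (cycType (lookup a)) (stretch (suc l) (cycType (lookup β)))) ≡ M
          degree = trans (deg-addMono (cycType (lookup a)) _) (cong₂ _+_ (deg-cycType (lookup a) (Assembly.injective as))
            (trans (deg-stretch l (cycType (lookup β))) (cong (suc l *_) (deg-cycType (lookup β) (Piece.injective pc)))))
          by : Dec (M ≤ D) → f s b *ℚ ∑ ns (λ n → weight n *ℚ bijections n₁ n₂ n) ≡ f s b
          by (yes le) = trans (cong (f s b *ℚ_) (bijections-weigh-1 n₁ n₂ le)) (ℚₚ.*-identityʳ (f s b))
          by (no gt)  = trans (cong (_*ℚ total-weight) zero′) (trans (ℚₚ.*-zeroˡ total-weight) (sym zero′))
            where
            total-weight : ℚ
            total-weight = ∑ ns (λ n → weight n *ℚ bijections n₁ n₂ n)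
            zero′ : f s b ≡ 0ℚ
            zero′ = vanish _ (subst (D <_) (sym degree) (ℕₚ.≰⇒> gt))

      peel : S J φ ≡ S J′ φ′
      peel = begin
        ∑ ns (λ n → weight n *ℚ assemblySum σ J n (φ ∘ cycType ∘ lookup))
          ≡⟨ ∑-upto-cong D (λ n n≤D → cong (weight n *ℚ_) (trans (labelled n n≤D)
               (∑-cong ns (λ n₁ → cong (weight n₁ *ℚ_) (∑-cong ns (λ n₂ → cong (weight n₂ *ℚ_) (G.gluing n₁ n₂ n φ invariant))))))) ⟩
        ∑ ns (λ n → weight n *ℚ ∑ ns (λ n₁ → weight n₁ *ℚ ∑ ns (λ n₂ → weight n₂ *ℚ YSum n₁ n₂ n)))
          ≡⟨ ∑-pull ns ns weight weight (λ n₁ n → ∑ ns (λ n₂ → weight n₂ *ℚ YSum n₁ n₂ n)) ⟩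
        ∑ ns (λ n₁ → weight n₁ *ℚ ∑ ns (λ n → weight n *ℚ ∑ ns (λ n₂ → weight n₂ *ℚ YSum n₁ n₂ n)))
          ≡⟨ ∑-cong ns (λ n₁ → cong (weight n₁ *ℚ_) (∑-pull ns ns weight weight (λ n₂ n → YSum n₁ n₂ n))) ⟩
        ∑ ns (λ n₁ → weight n₁ *ℚ ∑ ns (λ n₂ → weight n₂ *ℚ ∑ ns (λ n → weight n *ℚ YSum n₁ n₂ n)))
          ≡⟨ ∑-cong ns (λ n₁ → cong (weight n₁ *ℚ_) (∑-cong ns (λ n₂ → cong (weight n₂ *ℚ_) (unlabelled n₁ n₂)))) ⟩
        ∑ ns (λ n₁ → weight n₁ *ℚ ∑ ns (λ n₂ → weight n₂ *ℚ baseSum n₁ (λ a₁ → pieceSum n₂ (ψ a₁))))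
          ≡⟨ ∑-cong ns (λ n₁ → cong (weight n₁ *ℚ_) (sym (∑-pull (elems (pieces k n₁)) ns (λ (h , a , π , ρ) → χ (assembly? σ J′ (lookup π) (lookup ρ) (lookup a) (app h)))
               weight (λ n₂ (_ , a , _) → pieceSum n₂ (ψ a))))) ⟩
        ∑ ns (λ n₁ → weight n₁ *ℚ baseSum n₁ (λ a₁ → ∑ ns (λ n₂ → weight n₂ *ℚ pieceSum n₂ (ψ a₁))))
          ≡⟨ ∑-cong ns (λ n₁ → cong (weight n₁ *ℚ_) (∑-cong (elems (pieces k n₁)) (λ (h , a , π , ρ) →
               cong (χ (assembly? σ J′ (lookup π) (lookup ρ) (lookup a) (app h)) *ℚ_) (sym (φ′-pieces a))))) ⟩
        S J′ φ′ ∎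

    step : ∀ J i → Stable σ J → J i ≡ true → Substitutes (J ∖ Orbit.orbit σ σ-inj i) → Substitutes J
    step J i st ji (e , c , ih) = by (cycLen σ i) (Period.positive (cycLen-period σ σ-inj i)) refl
      where
      by : ∀ len → 1 ≤ len → len ≡ cycLen σ i → Substitutes J
      by (suc l) _ len≡ = inc l e , cycles-step σ σ-inj J i st ji e l len≡ c , λ φ adm →
        let open Step J i st ji l len≡ φ adm in
        trans (substMono-inc q l e φ) (trans (ih φ′ φ′-admissible) (sym peel))

    plethysm : ∀ φ → Admissible D φ → ⟪ substMono q (cycType σ) , φ ⟫ ≡ S everything φ
    plethysm φ adm = let e , c , h = cycle-induction σ σ-inj Substitutes empty step everything (λ _ → refl) in
      trans (substMono-invariant q (cycType σ) e φ (cycType-≈ σ σ-inj e c)) (h φ adm)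

open Substitution

module Conclusion where

  open import Data.Nat using (_≤_; s≤s)

  private variable
    n : ℕ

  module _ (c : ∀ {n} → Graph n → Bool) {Good : ∀ {n} → Graph n → Set} (good? : ∀ {n} (G : Graph n) → Dec (Good G))
           (c≡ : ∀ {n} (G : Graph n) → χᵇ (c G) ≡ χ (good? G)) where

    Valid : ∀ {n} → Vec (Vec Bool n) n × Vec (Fin n) n → Set
    Valid (g , a) = Simple (app g) × Good (app g) × Injection (lookup a) × Automorphism (lookup a) (app g)

    valid? : ∀ {n} (x : Vec (Vec Bool n) n × Vec (Fin n) n) → Dec (Valid x)
    valid? (g , a) = simple? (app g) ×-dec good? (app g) ×-dec injection? (lookup a) ×-dec automorphism? (lookup a) (app g)

    pairSum-flat : ∀ n (f : Vec (Fin n) n → ℚ) → pairSum c n f ≡ sum (graphs n ⊗ selfMaps n) (λ x → χ (valid? x) *ℚ f (proj₂ x))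
    pairSum-flat n f = sym (trans (sum-⊗ (graphs n) (selfMaps n) _) (∑-cong (elems (graphs n)) (λ g → begin
      _ ≡⟨ ∑-cong (elems (selfMaps n)) (λ a → trans (sym (χ-×₂ (simple? (app g)) (good? (app g) ×-dec injection? (lookup a) ×-dec automorphism? (lookup a) (app g)) (f a)))
             (cong (χ (simple? (app g)) *ℚ_) (trans (sym (χ-×₂ (good? (app g)) (injection? (lookup a) ×-dec automorphism? (lookup a) (app g)) (f a)))
               (cong (χ (good? (app g)) *ℚ_) (sym (χ-×₂ (injection? (lookup a)) (automorphism? (lookup a) (app g)) (f a))))))) ⟩
      sum (selfMaps n) (λ a → χ (simple? (app g)) *ℚ (χ (good? (app g)) *ℚ (χ (injection? (lookup a)) *ℚ (χ (automorphism? (lookup a) (app g)) *ℚ f a))))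
        ≡⟨ trans (∑-*ˡ (elems (selfMaps n)) (χ (simple? (app g))) _) (cong (χ (simple? (app g)) *ℚ_) (trans (∑-*ˡ (elems (selfMaps n)) (χ (good? (app g))) _)
             (cong (_*ℚ sum (selfMaps n) (λ a → χ (injection? (lookup a)) *ℚ (χ (automorphism? (lookup a) (app g)) *ℚ f a))) (sym (c≡ (app g)))))) ⟩
      _ ∎)))

  module Main (D : ℕ) (φ ψ : Mono → ℚ)
    (ψ-cycType : ∀ {k} (σ : Fin k → Fin k) → Injection σ →
      ψ (cycType σ) ≡ ∑ (upto D) (λ N → weight N *ℚ assemblySum σ everything N (φ ∘ cycType ∘ lookup))) where

    ns : List ℕ
    ns = upto D

    vᶜ? : ∀ {n} (x : Vec (Vec Bool n) n × Vec (Fin n) n) → Dec _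
    vᶜ? = valid? cᶜ connectedOuterplanar? χ-cᶜ

    vᵈ? : ∀ {n} (x : Vec (Vec Bool n) n × Vec (Fin n) n) → Dec _
    vᵈ? = valid? cᵈ blockGraph? χ-cᵈ

    pointedSum decomposedSum : ℕ → ℕ → ℚ
    pointedSum k N = sum (graphs N ⊗ selfMaps N ⊗ selfMaps N ⊗ vec (fin N) k)
      (λ (g , a , p , b) → χ (pointed? (app g) (lookup a) (lookup p) (lookup b)) *ℚ ((1ℚ -ℚ fixedFlags (lookup p) (lookup a)) *ℚ φ (cycType (lookup a))))
    decomposedSum k N = sum (graphs k ⊗ selfMaps k ⊗ pieces k N)
      (λ (κ , s , h , a , π , ρ) → χ (decomposed? (app κ) (lookup s) (lookup π) (lookup ρ) (lookup a) (app h)) *ℚ ((1ℚ -ℚ fixedPoints (lookup s)) *ℚ φ (cycType (lookup a))))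

    module Left (N : ℕ) (N≤D : N ≤ D) where
      private
        GA = Vec (Vec Bool N) N × Vec (Fin N) N
        ga : Finite GA
        ga = graphs N ⊗ selfMaps N
        ps = selfMaps N
        Φ : GA → ℚ
        Φ (g , a) = φ (cycType (lookup a))
        B : GA → Vec (Fin N) N → ℚ
        B (g , a) p = χ (block? (app g) (lookup p))
        C : GA → Vec (Fin N) N → ℚ
        C (g , a) p = χ (commute? (lookup p) (lookup a))
        V : GA → Vec (Fin N) N → ℚ
        V (g , a) p = (1ℚ -ℚ fixedFlags (lookup p) (lookup a)) *ℚ φ (cycType (lookup a))
        e : ℕ → Vec (Fin N) N → ℚ
        e k p = enumerations N k (fixed (lookup p))
        c : GA → Vec (Fin N) N → ℚ
        c x p = B x p *ℚ (C x p *ℚ V x p)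

      blocks : ∀ x → Valid cᶜ connectedOuterplanar? χ-cᶜ x →
        (1ℚ -ℚ fixedPoints (lookup (proj₂ x))) *ℚ Φ x ≡ ∑ ns (λ k → weight k *ℚ sum ps (λ p → c x p *ℚ e k p))
      blocks x@(g , a) (s , co , inj , aut) = begin
        (1ℚ -ℚ fixedPoints (lookup a)) *ℚ Φ x
          ≡⟨ cong (_*ℚ Φ x) (Dissymmetry.dissymmetry s (ConnectedOuterplanar.connected co) (lookup a) inj aut (root (ConnectedOuterplanar.nonempty co))) ⟩
        sum ps (λ p → B x p *ℚ (C x p *ℚ (1ℚ -ℚ fixedFlags (lookup p) (lookup a)))) *ℚ Φ x
          ≡⟨ sym (∑-*ʳ (elems ps) (Φ x) _) ⟩
        _ ≡⟨ ∑-cong (elems ps) (λ p → trans (ℚₚ.*-assoc (B x p) _ (Φ x)) (cong (B x p *ℚ_) (ℚₚ.*-assoc (C x p) _ (Φ x)))) ⟩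
        sum ps (c x)
          ≡⟨ ∑-cong (elems ps) (λ p → trans (sym (ℚₚ.*-identityʳ (c x p))) (cong (c x p *ℚ_) (sym (enumerations-weigh-1 D N (fixed (lookup p)) N≤D)))) ⟩
        sum ps (λ p → c x p *ℚ ∑ ns (λ k → weight k *ℚ e k p))
          ≡⟨ ∑-pull (elems ps) ns (c x) weight e ⟩
        _ ∎
        where
        root : ∀ {m} → 1 ≤ m → Fin m
        root (s≤s _) = zero

      flatten : ∀ k → sum ga (λ x → χ (vᶜ? x) *ℚ sum ps (λ p → c x p *ℚ e k p)) ≡ pointedSum k N
      flatten k = begin
        sum ga (λ x → χ (vᶜ? x) *ℚ sum ps (λ p → c x p *ℚ e k p))
          ≡⟨ sum-⊗ (graphs N) ps _ ⟩
        sum (graphs N) (λ g → sum ps (λ a → χ (vᶜ? (g , a)) *ℚ sum ps (λ p → c (g , a) p *ℚ e k p)))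
          ≡⟨ ∑-cong (elems (graphs N)) (λ g → ∑-cong (elems ps) (λ a → trans (sym (∑-*ˡ (elems ps) (χ (vᶜ? (g , a))) _))
               (∑-cong (elems ps) (λ p → trans (cong (χ (vᶜ? (g , a)) *ℚ_) (sym (∑-*ˡ (elems (vec (fin N) k)) (c (g , a) p) _)))
                 (trans (sym (∑-*ˡ (elems (vec (fin N) k)) (χ (vᶜ? (g , a))) _)) (∑-cong (elems (vec (fin N) k)) (λ b → merge g a p b))))))) ⟩
        sum (graphs N) (λ g → sum ps (λ a → sum ps (λ p → sum (vec (fin N) k) (λ b → χ (pointed? (app g) (lookup a) (lookup p) (lookup b)) *ℚ V (g , a) p))))
          ≡⟨ sym (trans (sum-⊗ (graphs N) (ps ⊗ ps ⊗ vec (fin N) k) _) (∑-cong (elems (graphs N)) (λ g →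
               trans (sum-⊗ ps (ps ⊗ vec (fin N) k) _) (∑-cong (elems ps) (λ a → sum-⊗ ps (vec (fin N) k) _))))) ⟩
        pointedSum k N ∎
        where
        merge : ∀ g a p b → χ (vᶜ? (g , a)) *ℚ (c (g , a) p *ℚ χ (enumerates? (fixed (lookup p)) (lookup b))) ≡
          χ (pointed? (app g) (lookup a) (lookup p) (lookup b)) *ℚ V (g , a) p
        merge g a p b = begin
          χ (d₁ ×-dec d₂ ×-dec d₃ ×-dec d₄) *ℚ ((χ d₅ *ℚ (χ d₆ *ℚ v)) *ℚ χ d₇)
            ≡⟨ cong (χ (d₁ ×-dec d₂ ×-dec d₃ ×-dec d₄) *ℚ_) (solve 4 (λ x y v z → (x :* (y :* v)) :* z := x :* (y :* (z :* v))) refl (χ d₅) (χ d₆) v (χ d₇)) ⟩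
          χ (d₁ ×-dec d₂ ×-dec d₃ ×-dec d₄) *ℚ (χ d₅ *ℚ (χ d₆ *ℚ (χ d₇ *ℚ v)))
            ≡⟨ cong (χ (d₁ ×-dec d₂ ×-dec d₃ ×-dec d₄) *ℚ_) (trans (cong (χ d₅ *ℚ_) (χ-×₂ d₆ d₇ v)) (χ-×₂ d₅ (d₆ ×-dec d₇) v)) ⟩
          χ (d₁ ×-dec d₂ ×-dec d₃ ×-dec d₄) *ℚ (χ (d₅ ×-dec d₆ ×-dec d₇) *ℚ v)
            ≡⟨ cong (_*ℚ (χ (d₅ ×-dec d₆ ×-dec d₇) *ℚ v)) (trans (χ-× d₁ (d₂ ×-dec d₃ ×-dec d₄)) (cong (χ d₁ *ℚ_) (trans (χ-× d₂ (d₃ ×-dec d₄)) (cong (χ d₂ *ℚ_) (χ-× d₃ d₄))))) ⟩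
          (χ d₁ *ℚ (χ d₂ *ℚ (χ d₃ *ℚ χ d₄))) *ℚ (χ (d₅ ×-dec d₆ ×-dec d₇) *ℚ v)
            ≡⟨ solve 5 (λ x y z t r → (x :* (y :* (z :* t))) :* r := x :* (y :* (z :* (t :* r)))) refl (χ d₁) (χ d₂) (χ d₃) (χ d₄) (χ (d₅ ×-dec d₆ ×-dec d₇) *ℚ v) ⟩
          χ d₁ *ℚ (χ d₂ *ℚ (χ d₃ *ℚ (χ d₄ *ℚ (χ (d₅ ×-dec d₆ ×-dec d₇) *ℚ v))))
            ≡⟨ cong (λ z → χ d₁ *ℚ (χ d₂ *ℚ z)) (trans (cong (χ d₃ *ℚ_) (χ-×₂ d₄ (d₅ ×-dec d₆ ×-dec d₇) v)) (χ-×₂ d₃ (d₄ ×-dec d₅ ×-dec d₆ ×-dec d₇) v)) ⟩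
          χ d₁ *ℚ (χ d₂ *ℚ (χ (d₃ ×-dec d₄ ×-dec d₅ ×-dec d₆ ×-dec d₇) *ℚ v))
            ≡⟨ trans (cong (χ d₁ *ℚ_) (χ-×₂ d₂ (d₃ ×-dec d₄ ×-dec d₅ ×-dec d₆ ×-dec d₇) v)) (χ-×₂ d₁ (d₂ ×-dec d₃ ×-dec d₄ ×-dec d₅ ×-dec d₆ ×-dec d₇) v) ⟩
          χ (pointed? (app g) (lookup a) (lookup p) (lookup b)) *ℚ v ∎
          where
          open +-*-Solver
          d₁ = simple? (app g)
          d₂ = connectedOuterplanar? (app g)
          d₃ = injection? (lookup a)
          d₄ = automorphism? (lookup a) (app g)
          d₅ = block? (app g) (lookup p)
          d₆ = commute? (lookup p) (lookup a)
          d₇ = enumerates? (fixed (lookup p)) (lookup b)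
          v = V (g , a) p

      left : pairSum cᶜ N (λ a → (1ℚ -ℚ fixedPoints (lookup a)) *ℚ φ (cycType (lookup a))) ≡ ∑ ns (λ k → weight k *ℚ pointedSum k N)
      left = begin
        _ ≡⟨ pairSum-flat cᶜ connectedOuterplanar? χ-cᶜ N _ ⟩
        _ ≡⟨ ∑-cong (elems ga) (λ x → χ-guard (vᶜ? x) (blocks x)) ⟩
        sum ga (λ x → χ (vᶜ? x) *ℚ ∑ ns (λ k → weight k *ℚ sum ps (λ p → c x p *ℚ e k p)))
          ≡⟨ ∑-pull (elems ga) ns (λ x → χ (vᶜ? x)) weight (λ k x → sum ps (λ p → c x p *ℚ e k p)) ⟩
        _ ≡⟨ ∑-cong ns (λ k → cong (weight k *ℚ_) (flatten k)) ⟩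
        _ ∎

    right : ∀ k → pairSum cᵈ k (λ s → (1ℚ -ℚ fixedPoints (lookup s)) *ℚ ψ (cycType (lookup s))) ≡ ∑ ns (λ N → weight N *ℚ decomposedSum k N)
    right k = begin
      _ ≡⟨ pairSum-flat cᵈ blockGraph? χ-cᵈ k _ ⟩
      _ ≡⟨ ∑-cong (elems ga) (λ x → trans (χ-guard (vᵈ? x) (λ (_ , _ , inj , _) → cong (f x *ℚ_) (ψ-cycType (lookup (proj₂ x)) inj))) (sym (ℚₚ.*-assoc (χ (vᵈ? x)) (f x) _))) ⟩
      sum ga (λ x → (χ (vᵈ? x) *ℚ f x) *ℚ ∑ ns (λ N → weight N *ℚ h N x))
        ≡⟨ ∑-pull (elems ga) ns (λ x → χ (vᵈ? x) *ℚ f x) weight h ⟩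
      ∑ ns (λ N → weight N *ℚ sum ga (λ x → (χ (vᵈ? x) *ℚ f x) *ℚ h N x))
        ≡⟨ ∑-cong ns (λ N → cong (weight N *ℚ_) (flatten N)) ⟩
      _ ∎
      where
      GA = Vec (Vec Bool k) k × Vec (Fin k) k
      ga : Finite GA
      ga = graphs k ⊗ selfMaps k
      f : GA → ℚ
      f (κ , s) = 1ℚ -ℚ fixedPoints (lookup s)
      h : ℕ → GA → ℚ
      h N (κ , s) = assemblySum (lookup s) everything N (φ ∘ cycType ∘ lookup)
      flatten : ∀ N → sum ga (λ x → (χ (vᵈ? x) *ℚ f x) *ℚ h N x) ≡ decomposedSum k N
      flatten N = begin
        sum ga (λ x → (χ (vᵈ? x) *ℚ f x) *ℚ h N x)
          ≡⟨ sum-⊗ (graphs k) (selfMaps k) _ ⟩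
        _ ≡⟨ ∑-cong (elems (graphs k)) (λ κ → ∑-cong (elems (selfMaps k)) (λ s → trans (sym (∑-*ˡ (elems (pieces k N)) (χ (vᵈ? (κ , s)) *ℚ f (κ , s)) _))
               (∑-cong (elems (pieces k N)) (λ z → merge κ s z)))) ⟩
        _ ≡⟨ sym (trans (sum-⊗ (graphs k) (selfMaps k ⊗ pieces k N) _) (∑-cong (elems (graphs k)) (λ κ → sum-⊗ (selfMaps k) (pieces k N) _))) ⟩
        decomposedSum k N ∎
        where
        ZT = Vec (Vec Bool N) N × Vec (Fin N) N × Vec (Fin k) N × Vec Bool N
        asm? : (s : Vec (Fin k) k) (z : ZT) → let (h , a , π , ρ) = z in Dec (Assembly (lookup s) everything (lookup π) (lookup ρ) (lookup a) (app h))
        asm? s (h , a , π , ρ) = assembly? (lookup s) everything (lookup π) (lookup ρ) (lookup a) (app h)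
        dec? : (κ : Vec (Vec Bool k) k) (s : Vec (Fin k) k) (z : ZT) → let (h , a , π , ρ) = z in Dec (Decomposed (app κ) (lookup s) (lookup π) (lookup ρ) (lookup a) (app h))
        dec? κ s (h , a , π , ρ) = decomposed? (app κ) (lookup s) (lookup π) (lookup ρ) (lookup a) (app h)
        Φ : ZT → ℚ
        Φ (h , a , π , ρ) = φ (cycType (lookup a))
        merge : ∀ κ s z → (χ (vᵈ? (κ , s)) *ℚ f (κ , s)) *ℚ (χ (asm? s z) *ℚ Φ z) ≡ χ (dec? κ s z) *ℚ (f (κ , s) *ℚ Φ z)
        merge κ s z = begin
          (χ (d₁ ×-dec d₂ ×-dec d₃ ×-dec d₄) *ℚ x) *ℚ (χ d₅ *ℚ y)
            ≡⟨ cong (λ w → (w *ℚ x) *ℚ (χ d₅ *ℚ y)) (trans (χ-× d₁ (d₂ ×-dec d₃ ×-dec d₄)) (cong (χ d₁ *ℚ_) (trans (χ-× d₂ (d₃ ×-dec d₄)) (cong (χ d₂ *ℚ_) (χ-× d₃ d₄))))) ⟩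
          ((χ d₁ *ℚ (χ d₂ *ℚ (χ d₃ *ℚ χ d₄))) *ℚ x) *ℚ (χ d₅ *ℚ y)
            ≡⟨ solve 7 (λ a b c d x e y → ((a :* (b :* (c :* d))) :* x) :* (e :* y) := a :* (b :* (c :* (d :* (e :* (x :* y)))))) refl (χ d₁) (χ d₂) (χ d₃) (χ d₄) x (χ d₅) y ⟩
          χ d₁ *ℚ (χ d₂ *ℚ (χ d₃ *ℚ (χ d₄ *ℚ (χ d₅ *ℚ (x *ℚ y)))))
            ≡⟨ cong (λ w → χ d₁ *ℚ (χ d₂ *ℚ w)) (trans (cong (χ d₃ *ℚ_) (χ-×₂ d₄ d₅ (x *ℚ y))) (χ-×₂ d₃ (d₄ ×-dec d₅) (x *ℚ y))) ⟩
          χ d₁ *ℚ (χ d₂ *ℚ (χ (d₃ ×-dec d₄ ×-dec d₅) *ℚ (x *ℚ y)))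
            ≡⟨ trans (cong (χ d₁ *ℚ_) (χ-×₂ d₂ (d₃ ×-dec d₄ ×-dec d₅) (x *ℚ y))) (χ-×₂ d₁ (d₂ ×-dec d₃ ×-dec d₄ ×-dec d₅) (x *ℚ y)) ⟩
          χ (dec? κ s z) *ℚ (x *ℚ y) ∎
          where
          open +-*-Solver
          d₁ = simple? (app κ)
          d₂ = blockGraph? (app κ)
          d₃ = injection? (lookup s)
          d₄ = automorphism? (lookup s) (app κ)
          d₅ = asm? s z
          x = f (κ , s)
          y = Φ z

    difference : (∀ N → Extensional (φ ∘ cycType {N})) → ⟪ ZPoly 𝒞 D , φ ⟫ -ℚ ⟪ ZPoly 𝒞̂ D , φ ⟫ ≡ ⟪ ZPoly 𝒟 D , ψ ⟫ -ℚ ⟪ ZPoly 𝒱 D , ψ ⟫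
    difference ext = begin
      _ ≡⟨ ⟪⟫-difference 𝒞 𝒞̂ cᶜ (λ n → 𝒞B-cong) (λ _ _ → refl) (λ _ _ _ → refl) (λ _ _ → refl) (λ _ _ _ → refl) D φ ⟩
      _ ≡⟨ ∑-upto-cong D (λ N N≤D → cong (weight N *ℚ_) (Left.left N N≤D)) ⟩
      ∑ ns (λ N → weight N *ℚ ∑ ns (λ k → weight k *ℚ pointedSum k N))
        ≡⟨ ∑-cong ns (λ N → cong (weight N *ℚ_) (∑-cong ns (λ k → cong (weight k *ℚ_) (block-decomposition k N (φ ∘ cycType) (ext N))))) ⟩
      ∑ ns (λ N → weight N *ℚ ∑ ns (λ k → weight k *ℚ decomposedSum k N))
        ≡⟨ ∑-pull ns ns weight weight decomposedSum ⟩
      ∑ ns (λ k → weight k *ℚ ∑ ns (λ N → weight N *ℚ decomposedSum k N))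
        ≡⟨ ∑-cong ns (λ k → cong (weight k *ℚ_) (sym (right k))) ⟩
      _ ≡⟨ sym (⟪⟫-difference 𝒟 𝒱 cᵈ (λ n → 𝒟B-cong) (λ _ _ → refl) (λ _ _ _ → refl) (λ _ _ → refl) (λ _ _ _ → refl) D ψ) ⟩
      _ ∎

open Conclusion

open import Data.Rational using (_+_; _-_)

theorem10 : (m : List ℕ) →
    Z 𝒞 m ≡ (Z 𝒞̂ m + Zsub 𝒟 𝒞̂ m) - Zsub 𝒱 𝒞̂ m
theorem10 m = begin
  Z 𝒞 m
    ≡⟨ ⟪⟫-coeff m (ZPoly 𝒞 D) ⟩
  ⟪ ZPoly 𝒞 D , φ ⟫
    ≡⟨ solve 2 (λ x y → x := y :+ (x :- y)) refl ⟪ ZPoly 𝒞 D , φ ⟫ ⟪ ZPoly 𝒞̂ D , φ ⟫ ⟩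
  ⟪ ZPoly 𝒞̂ D , φ ⟫ +ℚ (⟪ ZPoly 𝒞 D , φ ⟫ -ℚ ⟪ ZPoly 𝒞̂ D , φ ⟫)
    ≡⟨ cong (⟪ ZPoly 𝒞̂ D , φ ⟫ +ℚ_) (Main.difference D φ ψ (λ σ inj → Plethysm.plethysm D σ inj φ admissible) (λ N e → cong φ (cycType-cong e))) ⟩
  ⟪ ZPoly 𝒞̂ D , φ ⟫ +ℚ (⟪ ZPoly 𝒟 D , ψ ⟫ -ℚ ⟪ ZPoly 𝒱 D , ψ ⟫)
    ≡⟨ sym (ℚₚ.+-assoc ⟪ ZPoly 𝒞̂ D , φ ⟫ ⟪ ZPoly 𝒟 D , ψ ⟫ (-ℚ ⟪ ZPoly 𝒱 D , ψ ⟫)) ⟩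
  (⟪ ZPoly 𝒞̂ D , φ ⟫ +ℚ ⟪ ZPoly 𝒟 D , ψ ⟫) -ℚ ⟪ ZPoly 𝒱 D , ψ ⟫
    ≡⟨ sym (cong₂ _-ℚ_ (cong₂ _+ℚ_ (⟪⟫-coeff m (ZPoly 𝒞̂ D)) (substituted 𝒟)) (substituted 𝒱)) ⟩
  (Z 𝒞̂ m +ℚ Zsub 𝒟 𝒞̂ m) -ℚ Zsub 𝒱 𝒞̂ m ∎
  where
  open +-*-Solver
  D = deg m
  φ ψ : Mono → ℚ
  φ m′ = χᵇ (monoEq m m′)
  ψ m′ = ⟪ substMono (ZPoly 𝒞̂ D) m′ , φ ⟫
  substituted : ∀ K → Zsub K 𝒞̂ m ≡ ⟪ ZPoly K D , ψ ⟫
  substituted K = trans (⟪⟫-coeff m (compose (ZPoly K D) (ZPoly 𝒞̂ D))) (⟪⟫-compose (ZPoly K D) (ZPoly 𝒞̂ D) φ)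
  admissible : Admissible D φ
  admissible = record
    { invariant = λ e → cong χᵇ (monoEq-resp m e)
    ; vanish    = λ m′ lt → cong χᵇ (Boolₚ.¬-not (λ e → ℕₚ.<-irrefl (deg-resp m m′ (monoEq-sound m m′ e)) lt)) }
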